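{- Fix an integer $k\ge2$ and a real $\Gamma>0$. There exist constants $C_{k,\Gamma}>0$, $D_{k,\Gamma}=\lceil C_{k,\Gamma}\rceil$ and $K_{k,\Gamma}>D_{k,\Gamma}$, and a threshold $r_0$, all depending only on $k$ and $\Gamma$, such that for every $r\ge r_0$, over every field and for every $t\ge 1$, the following holds for every $\Gamma$-low-excess family $\mathcal H=(H_1,\dots,H_t)$ of distinct $r$-dimensional subspaces. Let $[t]=P_1\sqcup\cdots\sqcup P_\kappa$ be the connected-component partition of the graph on $[t]=\{1,\dots,t\}$ joining $i\ne j$ whenever $d_{\mathrm{Gr}}(H_i,H_j)<r/2$, and write $\mathcal H_a=\{H_i:i\in P_a\}$. Then: (i) each block has a representative $A_a^\ast\in\mathcal H_a$ with $d_{\mathrm{Gr}}(H,A_a^\ast)\le K_{k,\Gamma}$ for every $H\in\mathcal H_a$; hence $d_{\mathrm{Gr}}(H_i,H_j)\le2K_{k,\Gamma}$ for $i,j$ in one block, while $d_{\mathrm{Gr}}(H_i,H_j)\ge r-D_{k,\Gamma}-2K_{k,\Gamma}$ for $i,j$ in distinct blocks; (ii) $W_a:=\sum_{i\in P_a}H_i$ satisfies $r\le\dim W_a\le r+C_{k,\Gamma}$; (iii) for every choice of representatives $A_a\in\mathcal H_a$ $(1\le a\le\kappa)$, $0\le\kappa r-\dim(A_1+\cdots+A_\kappa)\le C_{k,\Gamma}$; (iv) $\mathfrak O=\kappa r+O_{k,\Gamma}(1)$ and $\mathfrak E=\kappa\binom rk+O_{k,\Gamma}(r^{k-1})$, with implied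 constants depending only on $k$ and $\Gamma$ (uniform in the field and in $t$).
   Context: Let $2\le k\le r$ and let $\mathcal H=(H_1,\dots,H_t)$ be a finite family of distinct $r$-dimensional subspaces of a vector space $V$. Put $\mathfrak O=\dim\sum_iH_i$, $\mathfrak E=\dim\sum_i\Lambda^kH_i$ (sum inside $\Lambda^kV$), $\beta=\frac1r\binom rk$, $G_k(\mathcal H)=\mathfrak E-\beta\mathfrak O$. The family is $\Gamma$-low-excess if $G_k(\mathcal H)\le\Gamma r^{k-1}$. For $r$-dimensional subspaces $H,A$, $d_{\mathrm{Gr}}(H,A)=r-\dim(H\cap A)$. -}

module Defs where

open import Algebra.Apartness.Bundles using (HeytingField; HeytingCommutativeRing)
open import Algebra.Bundles using (CommutativeRing)
open import Algebra.Module.Bundles using (LeftModule)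
open import Data.Fin.Base using (Fin)
open import Data.Integer.Base as ℤ using (ℤ; +_)
open import Data.Nat.Base as ℕ using (ℕ; NonZero; _^_; _∸_)
open import Data.Nat.Combinatorics using (_C_)
open import Data.Nat.Properties using (m^n≢0)
open import Data.Product.Base using (Σ-syntax; ∃; ∃-syntax; _×_; _,_)
open import Data.Rational.Base as ℚ using (ℚ; Positive; 0ℚ; _/_; _*_; 1/_; _-_; _<_)
open import Data.Rational.Properties
  using (normalize-pos; pos⇒nonZero; 1/pos⇒pos; *-inverseˡ; *-inverseʳ; *-assoc; *-identityʳ; *-monoˡ-<-pos)
open import Data.Sum.Base using (_⊎_)
open import Data.Vec.Functional using (Vector; updateAt)
open import Function.Base using (const)
open import Function.Bundles using (_⇔_; Equivalence; mk⇔)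
open import Level using (_⊔_; suc; Setω)
open import Relation.Binary.Construct.Closure.ReflexiveTransitive using (Star)
open import Relation.Binary.Core using (Rel)
open import Relation.Binary.Definitions using (_Respects_)
open import Relation.Binary.PropositionalEquality using (_≡_; _≢_; sym; trans; cong; subst)
open import Relation.Nullary.Negation using (¬_)
open import Relation.Unary using (Pred; _∈_; _≐_)
open import Algebra.Definitions.RawMonoid using (sum)

-- Existential quantification over a level-polymorphic statement; the
-- witness is chosen before, hence independently of, all universe levels.
record Σω {a} (A : Set a) (B : A → Setω) : Setω where
  constructor _,ω_
  field
    witness : A
    proof   : B witness

-- A real is a two-sided located Dedekind cut: Lower q is q < x, Upper q is
-- x < q.
record ℝ : Set₁ where
  field
    Lower       : ℚ → Set
    Upper       : ℚ → Set
    inhabitedᴸ  : ∃[ q ] Lower q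
    inhabitedᵁ  : ∃[ q ] Upper q
    roundedᴸ    : ∀ q → Lower q ⇔ (∃[ p ] (q < p × Lower p))
    roundedᵁ    : ∀ q → Upper q ⇔ (∃[ p ] (p < q × Upper p))
    disjoint    : ∀ q → ¬ (Lower q × Upper q)
    located     : ∀ p q → p < q → Lower p ⊎ Upper q

infix 4 _<ᴿ_ _≤ᴿ_

_<ᴿ_ : ℚ → ℝ → Set
q <ᴿ x = ℝ.Lower x q

_≤ᴿ_ : ℚ → ℝ → Set
q ≤ᴿ x = ¬ ℝ.Upper x q

IsCeiling : ℝ → ℤ → Set
IsCeiling x D = ((D ℤ.- + 1) / 1 <ᴿ x) × ¬ ((D / 1) <ᴿ x)

private
  module _ (s : ℚ) .{{_ : Positive s}} where
    instance
      s≢0 : ℚ.NonZero s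
      s≢0 = pos⇒nonZero s

    unscale-scale : ∀ q → (q * s) * 1/ s ≡ q
    unscale-scale q = trans (*-assoc q s (1/ s)) (trans (cong (q *_) (*-inverseʳ s)) (*-identityʳ q))

    scale-unscale : ∀ q → (q * 1/ s) * s ≡ q
    scale-unscale q = trans (*-assoc q (1/ s) s) (trans (cong (q *_) (*-inverseˡ s)) (*-identityʳ q))

    scale-< : ∀ {p q} → p < q → p * s < q * s
    scale-< = *-monoˡ-<-pos s

    unscale-< : ∀ {p q} → p < q → p * 1/ s < q * 1/ s
    unscale-< = *-monoˡ-<-pos (1/ s) {{1/pos⇒pos s}}

scale : (s : ℚ) .{{_ : Positive s}} → ℝ → ℝ
scale s x = record
  { Lower      = λ q → Lower (q * 1/ s)
  ; Upper      = λ q → Upper (q * 1/ s)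
  ; inhabitedᴸ = let (q , q<x) = inhabitedᴸ in q * s , subst Lower (sym (unscale-scale s q)) q<x
  ; inhabitedᵁ = let (q , x<q) = inhabitedᵁ in q * s , subst Upper (sym (unscale-scale s q)) x<q
  ; roundedᴸ   = λ q → mk⇔
      (λ q<x → let (p , q<p , p<x) = Equivalence.to (roundedᴸ (q * 1/ s)) q<x in
        p * s , subst (_< p * s) (scale-unscale s q) (scale-< s q<p)
              , subst Lower (sym (unscale-scale s p)) p<x)
      (λ (p , q<p , p<x) → Equivalence.from (roundedᴸ (q * 1/ s)) (p * 1/ s , unscale-< s q<p , p<x))
  ; roundedᵁ   = λ q → mk⇔
      (λ x<q → let (p , p<q , x<p) = Equivalence.to (roundedᵁ (q * 1/ s)) x<q in
        p * s , subst (p * s <_) (scale-unscale s q) (scale-< s p<q)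
              , subst Upper (sym (unscale-scale s p)) x<p)
      (λ (p , p<q , x<p) → Equivalence.from (roundedᵁ (q * 1/ s)) (p * 1/ s , unscale-< s p<q , x<p))
  ; disjoint   = λ q → disjoint (q * 1/ s)
  ; located    = λ p q p<q → located (p * 1/ s) (q * 1/ s) (unscale-< s p<q)
  }
  where
  open ℝ x
  instance
    s-nonZero : ℚ.NonZero s
    s-nonZero = pos⇒nonZero s

fromℕ : ℕ → ℚ
fromℕ n = + n / 1

infixr 7 _·ᴿ_

_·ᴿ_ : (n : ℕ) .{{_ : NonZero n}} → ℝ → ℝ
n ·ᴿ x = scale (fromℕ n) {{normalize-pos n 1}} x

infixr 7 _↑_·ᴿ_

_↑_·ᴿ_ : (r n : ℕ) .{{_ : NonZero r}} → ℝ → ℝ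
r ↑ n ·ᴿ x = _·ᴿ_ (r ^ n) {{m^n≢0 r n}} x

-- With excluded middle, a Heyting field (commutative ring with a tight
-- apartness, invertible = apart from 0) is exactly a field.
module LinearAlgebra {c ℓ₁ ℓ₂} (F : HeytingField c ℓ₁ ℓ₂) where

  private
    K = HeytingCommutativeRing.commutativeRing (HeytingField.heytingCommutativeRing F)
    module K = CommutativeRing K

  VectorSpace : ∀ m ℓm → Set _
  VectorSpace m ℓm = LeftModule K.ring m ℓm

  record Subspace {m ℓm} (V : VectorSpace m ℓm) p : Set (c ⊔ m ⊔ ℓm ⊔ suc p) where
    open LeftModule V
    field
      Member   : Pred Carrierᴹ p
      respects : Member Respects _≈ᴹ_
      0-closed : Member 0ᴹ
      +-closed : ∀ {v w} → Member v → Member w → Member (v +ᴹ w)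
      *-closed : ∀ a {v} → Member v → Member (a *ₗ v)

  open Subspace

  module _ {m ℓm} {V : VectorSpace m ℓm} where
    open LeftModule V

    _≡ˢ_ : ∀ {p} → Rel (Subspace V p) _
    U ≡ˢ W = Member U ≐ Member W

    _∩ˢ_ : ∀ {p} → Subspace V p → Subspace V p → Subspace V p
    U ∩ˢ W = record
      { Member   = λ v → Member U v × Member W v
      ; respects = λ v≈w (v∈U , v∈W) → respects U v≈w v∈U , respects W v≈w v∈W
      ; 0-closed = 0-closed U , 0-closed W
      ; +-closed = λ (v∈U , v∈W) (w∈U , w∈W) → +-closed U v∈U w∈U , +-closed W v∈W w∈W
      ; *-closed = λ a (v∈U , v∈W) → *-closed U a v∈U , *-closed W a v∈W
      }

    data Span {p} (S : Pred Carrierᴹ p) : Pred Carrierᴹ (c ⊔ m ⊔ ℓm ⊔ p) where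
      span-⊆    : ∀ {v} → v ∈ S → Span S v
      span-resp : ∀ {v w} → v ≈ᴹ w → Span S v → Span S w
      span-0    : Span S 0ᴹ
      span-+    : ∀ {v w} → Span S v → Span S w → Span S (v +ᴹ w)
      span-*    : ∀ a {v} → Span S v → Span S (a *ₗ v)

    span : ∀ {p} → Pred Carrierᴹ p → Subspace V _
    span S = record
      { Member   = Span S
      ; respects = span-resp
      ; 0-closed = span-0
      ; +-closed = span-+
      ; *-closed = span-*
      }

    ∑ˢ : ∀ {i p} {I : Set i} → (I → Subspace V p) → Subspace V _
    ∑ˢ W = span λ v → ∃[ i ] Member (W i) v

    linComb : ∀ {n} → Vector K.Carrier n → Vector Carrierᴹ n → Carrierᴹ
    linComb a b = sum +ᴹ-rawMonoid (λ i → a i *ₗ b i)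

    LinearlyIndependent : ∀ {n} → Vector Carrierᴹ n → Set _
    LinearlyIndependent b = ∀ a → linComb a b ≈ᴹ 0ᴹ → ∀ i → a i K.≈ K.0#

    HasDim : ∀ {p} → Subspace V p → ℕ → Set _
    HasDim W n = Σ[ b ∈ Vector Carrierᴹ n ]
      (∀ i → Member W (b i)) ×
      LinearlyIndependent b ×
      (∀ v → Member W v → ∃[ a ] v ≈ᴹ linComb a b)

    -- d_Gr(U , W) = d for r-dimensional U and W, i.e. d = r - dim (U ∩ W)
    GrDist : ∀ {p} → ℕ → Subspace V p → Subspace V p → ℕ → Set _
    GrDist r U W d = ∃[ n ] HasDim (U ∩ˢ W) n × d ℕ.+ n ≡ r

  -- Λᵏ V, presented as the vector space generated by the symbols
  -- v₁ ∧ … ∧ vₖ subject to multilinearity and alternation.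
  module Exterior (k : ℕ) {m ℓm} (V : VectorSpace m ℓm) where
    open LeftModule V

    _[_≔_] : Vector Carrierᴹ k → Fin k → Carrierᴹ → Vector Carrierᴹ k
    v [ i ≔ x ] = updateAt v i (const x)

    infixl 6 _⊕_
    infixr 7 _⊙_
    infix  8 ⊖_
    infix  4 _∼_

    data Term : Set (c ⊔ m) where
      ⋀   : Vector Carrierᴹ k → Term
      𝟎   : Term
      _⊕_ : Term → Term → Term
      ⊖_  : Term → Term
      _⊙_ : K.Carrier → Term → Term

    data _∼_ : Rel Term (c ⊔ ℓ₁ ⊔ m ⊔ ℓm) where
      ∼-refl      : ∀ {x} → x ∼ x
      ∼-sym       : ∀ {x y} → x ∼ y → y ∼ x
      ∼-trans     : ∀ {x y z} → x ∼ y → y ∼ z → x ∼ z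
      ⊕-cong      : ∀ {x y u v} → x ∼ y → u ∼ v → x ⊕ u ∼ y ⊕ v
      ⊖-cong      : ∀ {x y} → x ∼ y → ⊖ x ∼ ⊖ y
      ⊙-cong      : ∀ {a b x y} → a K.≈ b → x ∼ y → a ⊙ x ∼ b ⊙ y
      ⊕-assoc     : ∀ x y z → (x ⊕ y) ⊕ z ∼ x ⊕ (y ⊕ z)
      ⊕-comm      : ∀ x y → x ⊕ y ∼ y ⊕ x
      ⊕-identityˡ : ∀ x → 𝟎 ⊕ x ∼ x
      ⊕-inverseˡ  : ∀ x → ⊖ x ⊕ x ∼ 𝟎
      ⊙-zeroˡ     : ∀ x → K.0# ⊙ x ∼ 𝟎
      ⊙-zeroʳ     : ∀ a → a ⊙ 𝟎 ∼ 𝟎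
      ⊙-identityˡ : ∀ x → K.1# ⊙ x ∼ x
      ⊙-assoc     : ∀ a b x → (a K.* b) ⊙ x ∼ a ⊙ (b ⊙ x)
      ⊙-distribʳ  : ∀ x a b → (a K.+ b) ⊙ x ∼ a ⊙ x ⊕ b ⊙ x
      ⊙-distribˡ  : ∀ a x y → a ⊙ (x ⊕ y) ∼ a ⊙ x ⊕ a ⊙ y
      ⋀-cong      : ∀ {v w} → (∀ i → v i ≈ᴹ w i) → ⋀ v ∼ ⋀ w
      ⋀-+         : ∀ v i x y → ⋀ (v [ i ≔ x +ᴹ y ]) ∼ ⋀ (v [ i ≔ x ]) ⊕ ⋀ (v [ i ≔ y ])
      ⋀-*         : ∀ v i a x → ⋀ (v [ i ≔ a *ₗ x ]) ∼ a ⊙ ⋀ (v [ i ≔ x ])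
      ⋀-alt       : ∀ v {i j} → i ≢ j → v i ≈ᴹ v j → ⋀ v ∼ 𝟎

    Λ : VectorSpace (c ⊔ m) (c ⊔ ℓ₁ ⊔ m ⊔ ℓm)
    Λ = record
      { Carrierᴹ = Term ; _≈ᴹ_ = _∼_ ; _+ᴹ_ = _⊕_ ; _*ₗ_ = _⊙_ ; 0ᴹ = 𝟎 ; -ᴹ_ = ⊖_
      ; isLeftModule = record
        { isLeftSemimodule = record
          { +ᴹ-isCommutativeMonoid = record
            { isMonoid = record
              { isSemigroup = record
                { isMagma = record
                  { isEquivalence = record { refl = ∼-refl ; sym = ∼-sym ; trans = ∼-trans }
                  ; ∙-cong        = ⊕-cong
                  }
                ; assoc = ⊕-assoc
                }
              ; identity = ⊕-identityˡ , λ x → ∼-trans (⊕-comm x 𝟎) (⊕-identityˡ x)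
              }
            ; comm = ⊕-comm
            }
          ; isPreleftSemimodule = record
            { *ₗ-cong      = ⊙-cong
            ; *ₗ-zeroˡ     = ⊙-zeroˡ
            ; *ₗ-distribʳ  = ⊙-distribʳ
            ; *ₗ-identityˡ = ⊙-identityˡ
            ; *ₗ-assoc     = ⊙-assoc
            ; *ₗ-zeroʳ     = ⊙-zeroʳ
            ; *ₗ-distribˡ  = ⊙-distribˡ
            }
          }
        ; -ᴹ‿cong    = ⊖-cong
        ; -ᴹ‿inverse = ⊕-inverseˡ , λ x → ∼-trans (⊕-comm x (⊖ x)) (⊕-inverseˡ x)
        }
      }

  -- Λᵏ W as a subspace of Λᵏ V.
  Λˢ : ∀ k {m ℓm p} {V : VectorSpace m ℓm} → Subspace V p → Subspace (Exterior.Λ k V) _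
  Λˢ k {V = V} W = span λ x → Σ[ v ∈ Vector (LeftModule.Carrierᴹ V) k ]
    ((∀ i → Member W (v i)) × x ≡ Exterior.⋀ v)

  -- i ~ j  iff  i ≠ j and d_Gr(Hᵢ , Hⱼ) < r/2
  Close : ∀ {m ℓm p} {V : VectorSpace m ℓm} (r : ℕ) {t : ℕ} → (Fin t → Subspace V p) → Rel (Fin t) _
  Close r H i j = i ≢ j × (∃[ d ] GrDist r (H i) (H j) d × 2 ℕ.* d ℕ.< r)

β : (k r : ℕ) .{{_ : NonZero r}} → ℚ
β k r = + (r C k) / r

excess : (k r : ℕ) .{{_ : NonZero r}} → (𝔈 𝔒 : ℕ) → ℚ
excess k r 𝔈 𝔒 = fromℕ 𝔈 - β k r * fromℕ 𝔒

LowExcess : (Γ : ℝ) (k r : ℕ) .{{_ : NonZero r}} → (𝔈 𝔒 : ℕ) → Set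
LowExcess Γ k r 𝔈 𝔒 = excess k r 𝔈 𝔒 ≤ᴿ r ↑ (k ∸ 1) ·ᴿ Γ

-- The nonempty fibres of the map block are the connected components of a
-- symmetric graph.
record IsComponentPartition {t κ ℓ} (_~_ : Rel (Fin t) ℓ) (block : Fin t → Fin κ) : Set ℓ where
  field
    nonempty   : ∀ a → ∃[ i ] block i ≡ a
    components : ∀ i j → block i ≡ block j ⇔ Star _~_ i j

record Constants : Set₁ where
  field
    Cₖ      : ℝ
    Cₖ>0    : 0ℚ <ᴿ Cₖ
    Dₖ      : ℤ
    Dₖ≡⌈Cₖ⌉ : IsCeiling Cₖ Dₖ
    Kₖ      : ℝ
    Kₖ>Dₖ   : Dₖ / 1 <ᴿ Kₖ
    r₀      : ℕ
    O-𝔒 O-𝔈 : ℝ      -- the implied constants in the estimates for 𝔒 and 𝔈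

{-# OPTIONS --safe #-}

module Submission where

-- Add the members of the family one at a time, in any order.  A member H
-- meeting the current sum S in dimension h adds r - h to 𝔒 and at least
-- C(r,k) - C(h,k) to 𝔈: complete a basis of H ∩ S to one of H, and take the
-- k-fold wedges that are not contained in Λᵏ (H ∩ S).  Since r² C(h,k) is at
-- most h² C(r,k), the excess grows by at least C(r,k) h (r - h) / r², so low
-- excess gives Σ h (r - h) ≤ M r for every order, where M depends only on k
-- and Γ.  In particular each h is at most 2M or at least r - 2M.  Within a
-- block every new member is close to an earlier one, which bounds the
-- dimension of its span by r + 2M.  Members of distinct blocks meet in
-- dimension at most 2M; if a member A of a new block were nearly contained in
-- the sum of P and another member Q while meeting both P and Q in small
-- dimension, then products of one form vanishing on P with forms vanishing on
-- Q would detect almost all of Λᵏ A modulo Λᵏ P + Λᵏ Q, which contradicts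
-- low excess for large r.  Hence representatives of the blocks are almost
-- independent.
--
-- All conclusions are stable under double negation, so bases may be chosen
-- classically.

open import Defs
open import Algebra.Apartness.Bundles using (HeytingField; HeytingCommutativeRing)
import Algebra.Apartness.Properties.HeytingCommutativeRing as HeytingProperties
open import Algebra.Bundles using (CommutativeMonoid; CommutativeRing)
open import Algebra.Module.Bundles using (LeftModule)
open import Data.Bool.Base using (Bool; true; false)
open import Data.Empty using (⊥; ⊥-elim)
open import Data.Fin.Base using (Fin; zero; suc)
import Data.Fin.Properties as Fin
import Data.Integer.Base as ℤ
import Data.Integer.Properties as ℤ
open import Data.List.Base using (List; []; _∷_; _++_; length; map; tabulate; lookup; allFin)
open import Data.List.Properties using (length-++; length-map; length-tabulate; ++-identityʳ)
open import Data.List.Membership.Propositional using () renaming (_∈_ to _∈ˡ_)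
open import Data.List.Membership.Propositional.Properties using (∈-allFin; ∈-lookup; ∈-tabulate⁺; ∈-tabulate⁻; ∈-++⁺ˡ)
open import Data.List.Relation.Unary.All as All using (All; []; _∷_)
import Data.List.Relation.Unary.All.Properties as All
open import Data.List.Relation.Unary.AllPairs using (AllPairs; []; _∷_)
import Data.List.Relation.Unary.AllPairs.Properties as AllPairs
open import Data.List.Relation.Unary.Any using (here; there)
open import Data.Nat.Base as ℕ using (ℕ; zero; suc; z≤n; s≤s; _!; NonZero; >-nonZero)
open import Data.Nat.Combinatorics using (_C_; nCk+nC[k+1]≡[n+1]C[k+1])
import Data.Nat.Properties as ℕ
open import Data.Nat.Solver using () renaming (module +-*-Solver to ℕ-Solver)
open import Data.Product.Base using (Σ-syntax; ∃-syntax; _×_; _,_; proj₁; proj₂)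
open import Data.Rational.Base as ℚ using (ℚ; Positive; 0ℚ; 1ℚ; 1/_)
import Data.Rational.Properties as ℚ
open import Data.Rational.Solver using () renaming (module +-*-Solver to ℚ-Solver)
open import Data.Rational.Unnormalised.Base as ℚᵘ using (mkℚᵘ; *≤*; *<*; *≡*)
import Data.Rational.Unnormalised.Properties as ℚᵘ
open import Data.Sum.Base using (_⊎_; inj₁; inj₂)
open import Data.Vec.Base as Vec using (Vec; []; _∷_)
open import Data.Vec.Functional as Vector using (Vector; updateAt; head; tail)
open import Data.Vec.Properties using (lookup-replicate)
open import Function.Base using (const; _∘_)
open import Function.Bundles using (Equivalence; mk⇔)
open import Level using (Level; _⊔_; Lift; lift)
open import Relation.Binary.Construct.Closure.ReflexiveTransitive using (Star; ε; _◅_)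
open import Relation.Binary.PropositionalEquality as ≡ using (_≡_; _≢_)
open import Relation.Nullary.Decidable.Core using (yes; no; ¬¬-excluded-middle; decidable-stable)
open import Relation.Nullary.Negation using (¬_)

-- Linear algebra up to double negation

-- The gain h (r - h) vanishes at h = r: a member inside the current sum costs nothing, so this
-- estimate alone cannot exclude, say, a diagonal in P + Q. Forms with one factor for P and another
-- for Q do see it, and they exist because k ≥ 2.
--
-- The estimates are amortised. `ω` accumulates h (r - h). If h ≥ r/2, each of the r - h new
-- dimensions is paid for by r/2 units of `ω`; if r - h ≥ r/2, so is each of the h lost ones. The
-- budget M r allows 2M such dimensions in all, however many members there are.
--
-- They are partial, given by a kernel and a point of value 1, and are extended only after a
-- concrete derivation has shown which finitely many vectors matter.
--
-- M is N₀ 2^k k! with N₀ a natural number above Γ; the factor 2^k k! compares r^k with C(r,k) for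
-- large r.

infixl 1 _>>=_

_>>=_ : ∀ {a b} {A : Set a} {B : Set b} → ¬ ¬ A → (A → ¬ ¬ B) → ¬ ¬ B
(m >>= f) ¬b = m λ a → f a ¬b

return : ∀ {a} {A : Set a} → A → ¬ ¬ A
return a ¬a = ¬a a

module Scalars {c ℓ₁ ℓ₂} (F : HeytingField c ℓ₁ ℓ₂) where

  open HeytingField F using (tight; #⇒invertible)
  K : CommutativeRing c ℓ₁
  K = HeytingCommutativeRing.commutativeRing (HeytingField.heytingCommutativeRing F)
  open CommutativeRing K public
  open HeytingProperties (HeytingField.heytingCommutativeRing F) public using (x-0≈x; 1#0)

  -- Tightness makes equality the negation of apartness, and negations are stable.
  ≈-stable : ∀ {x y} → ¬ ¬ (x ≈ y) → x ≈ y
  ≈-stable {x} {y} ¬¬x≈y = proj₁ (tight x y) λ x#y → ¬¬x≈y λ x≈y → proj₂ (tight x y) x≈y x#y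

  1≉0 : ¬ (1# ≈ 0#)
  1≉0 1≈0 = proj₂ (tight 1# 0#) 1≈0 1#0

  ≉0⇒¬¬invertible : ∀ {x} → ¬ (x ≈ 0#) → ¬ ¬ (∃[ y ] y * x ≈ 1#)
  ≉0⇒¬¬invertible {x} x≉0 ¬inv = x≉0 (proj₁ (tight x 0#) λ x#0 →
    let (y , yx≈1 , _) = #⇒invertible x#0 in
    ¬inv (y , trans (*-congˡ (sym (x-0≈x x))) yx≈1))

module Subspaces {c ℓ₁ ℓ₂} (F : HeytingField c ℓ₁ ℓ₂) {m ℓm} (V : LinearAlgebra.VectorSpace F m ℓm) (p : Level) where

  open LinearAlgebra F
  private module K = Scalars F
  open LeftModule V
  open import Relation.Binary.Reasoning.Setoid ≈ᴹ-setoid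
  open import Algebra.Properties.CommutativeSemigroup (CommutativeMonoid.commutativeSemigroup +ᴹ-commutativeMonoid) using (interchange)

  -- This level is closed under `_⊞₁_`, which quantifies over scalars, vectors and equalities, so
  -- iterated sums stay in one type.
  Sub : Set _
  Sub = Subspace V (c ⊔ m ⊔ ℓm ⊔ p)

  open Subspace public

  infix 4 _∈_ _∉_ _⊑_

  _∈_ : ∀ {q} → Carrierᴹ → Subspace V q → Set q
  v ∈ U = Member U v

  _∉_ : ∀ {q} → Carrierᴹ → Subspace V q → Set q
  v ∉ U = ¬ (v ∈ U)

  record _⊑_ {q q′} (U : Subspace V q) (W : Subspace V q′) : Set (m ⊔ q ⊔ q′) where
    constructor mk⊑
    field include : ∀ {v} → v ∈ U → v ∈ W

  open _⊑_ public

  ⊑-refl : ∀ {q} {U : Subspace V q} → U ⊑ U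
  ⊑-refl = mk⊑ λ x∈ → x∈

  ⊑-trans : ∀ {q q′ q″} {U : Subspace V q} {W : Subspace V q′} {X : Subspace V q″} → U ⊑ W → W ⊑ X → U ⊑ X
  ⊑-trans U⊑W W⊑X = mk⊑ λ x∈ → include W⊑X (include U⊑W x∈)

  All-⊑ : ∀ {q q′} {U : Subspace V q} {W : Subspace V q′} → U ⊑ W → ∀ {L} → All (_∈ U) L → All (_∈ W) L
  All-⊑ U⊑W = All.map (include U⊑W)

  -ᴹ-closed : ∀ {q} (U : Subspace V q) {v} → v ∈ U → (-ᴹ v) ∈ U
  -ᴹ-closed U {v} v∈U = respects U (begin
    (K.- K.1#) *ₗ v                          ≈⟨ +ᴹ-identityʳ _ ⟨
    (K.- K.1#) *ₗ v +ᴹ 0ᴹ                    ≈⟨ +ᴹ-congˡ (-ᴹ‿inverseʳ v) ⟨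
    (K.- K.1#) *ₗ v +ᴹ (v +ᴹ -ᴹ v)           ≈⟨ +ᴹ-assoc _ _ _ ⟨
    (K.- K.1#) *ₗ v +ᴹ v +ᴹ -ᴹ v             ≈⟨ +ᴹ-congʳ (+ᴹ-congˡ (*ₗ-identityˡ v)) ⟨
    (K.- K.1#) *ₗ v +ᴹ K.1# *ₗ v +ᴹ -ᴹ v     ≈⟨ +ᴹ-congʳ (*ₗ-distribʳ v _ _) ⟨
    (K.- K.1# K.+ K.1#) *ₗ v +ᴹ -ᴹ v         ≈⟨ +ᴹ-congʳ (*ₗ-congʳ (K.-‿inverseˡ K.1#)) ⟩
    K.0# *ₗ v +ᴹ -ᴹ v                        ≈⟨ +ᴹ-congʳ (*ₗ-zeroˡ v) ⟩
    0ᴹ +ᴹ -ᴹ v                               ≈⟨ +ᴹ-identityˡ _ ⟩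
    -ᴹ v                                     ∎) (*-closed U (K.- K.1#) v∈U)

  ∈-cancelʳ : ∀ {q} (U : Subspace V q) {v x y} → v ≈ᴹ x +ᴹ y → v ∈ U → y ∈ U → x ∈ U
  ∈-cancelʳ U {v} {x} {y} v≈x+y v∈U y∈U = respects U (begin
    v +ᴹ -ᴹ y         ≈⟨ +ᴹ-congʳ v≈x+y ⟩
    x +ᴹ y +ᴹ -ᴹ y    ≈⟨ +ᴹ-assoc x y _ ⟩
    x +ᴹ (y +ᴹ -ᴹ y)  ≈⟨ +ᴹ-congˡ (-ᴹ‿inverseʳ y) ⟩
    x +ᴹ 0ᴹ           ≈⟨ +ᴹ-identityʳ x ⟩
    x                 ∎) (+-closed U v∈U (-ᴹ-closed U y∈U))

  ∈-cancelˡ : ∀ {q} (U : Subspace V q) {v x y} → v ≈ᴹ x +ᴹ y → v ∈ U → x ∈ U → y ∈ U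
  ∈-cancelˡ U v≈x+y = ∈-cancelʳ U (≈ᴹ-trans v≈x+y (+ᴹ-comm _ _))

  *-cancel : ∀ {q} (U : Subspace V q) {a x} → ¬ (a K.≈ K.0#) → a *ₗ x ∈ U → ¬ ¬ (x ∈ U)
  *-cancel U {a} {x} a≉0 ax∈U = K.≉0⇒¬¬invertible a≉0 >>= λ (b , ba≈1) →
    return (respects U (begin
      b *ₗ (a *ₗ x)  ≈⟨ *ₗ-assoc b a x ⟨
      (b K.* a) *ₗ x ≈⟨ *ₗ-congʳ ba≈1 ⟩
      K.1# *ₗ x      ≈⟨ *ₗ-identityˡ x ⟩
      x              ∎) (*-closed U b ax∈U))

  𝟘 : Sub
  𝟘 = record
    { Member   = λ v → Lift (c ⊔ m ⊔ ℓm ⊔ p) (v ≈ᴹ 0ᴹ)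
    ; respects = λ v≈w (lift v≈0) → lift (≈ᴹ-trans (≈ᴹ-sym v≈w) v≈0)
    ; 0-closed = lift ≈ᴹ-refl
    ; +-closed = λ (lift v≈0) (lift w≈0) → lift (≈ᴹ-trans (+ᴹ-cong v≈0 w≈0) (+ᴹ-identityˡ 0ᴹ))
    ; *-closed = λ a (lift v≈0) → lift (≈ᴹ-trans (*ₗ-congˡ v≈0) (*ₗ-zeroʳ a))
    }

  𝟘-least : ∀ {q} (U : Subspace V q) → 𝟘 ⊑ U
  𝟘-least U = mk⊑ λ (lift v≈0) → respects U (≈ᴹ-sym v≈0) (0-closed U)

  infixl 6 _⊞₁_ _⊞_

  -- Membership exposes the coefficient of the new vector, which elimination, coordinates and
  -- evaluation all read off; an inductive span would hide it.
  _⊞₁_ : Sub → Carrierᴹ → Sub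
  D ⊞₁ v = record
    { Member   = λ x → ∃[ a ] ∃[ d ] (d ∈ D) × (x ≈ᴹ a *ₗ v +ᴹ d)
    ; respects = λ x≈y (a , d , d∈D , x≈) → a , d , d∈D , ≈ᴹ-trans (≈ᴹ-sym x≈y) x≈
    ; 0-closed = K.0# , 0ᴹ , 0-closed D , ≈ᴹ-sym (≈ᴹ-trans (+ᴹ-identityʳ _) (*ₗ-zeroˡ v))
    ; +-closed = λ (a , d , d∈D , x≈) (b , e , e∈D , y≈) → a K.+ b , d +ᴹ e , +-closed D d∈D e∈D ,
        ≈ᴹ-trans (+ᴹ-cong x≈ y≈) (≈ᴹ-trans (interchange _ _ _ _) (+ᴹ-congʳ (≈ᴹ-sym (*ₗ-distribʳ v a b))))
    ; *-closed = λ b (a , d , d∈D , x≈) → b K.* a , b *ₗ d , *-closed D b d∈D ,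
        ≈ᴹ-trans (*ₗ-congˡ x≈) (≈ᴹ-trans (*ₗ-distribˡ b _ _) (+ᴹ-congʳ (≈ᴹ-sym (*ₗ-assoc b a v))))
    }

  _⊞_ : Sub → List Carrierᴹ → Sub
  D ⊞ []      = D
  D ⊞ (v ∷ L) = (D ⊞ L) ⊞₁ v

  ⟨_⟩ : List Carrierᴹ → Sub
  ⟨ L ⟩ = 𝟘 ⊞ L

  ⊞₁-base : ∀ D v → D ⊑ (D ⊞₁ v)
  ⊞₁-base D v = mk⊑ λ {x} x∈D → K.0# , x , x∈D , ≈ᴹ-sym (≈ᴹ-trans (+ᴹ-congʳ (*ₗ-zeroˡ v)) (+ᴹ-identityˡ x))

  ⊞₁-new : ∀ D v → v ∈ D ⊞₁ v
  ⊞₁-new D v = K.1# , 0ᴹ , 0-closed D , ≈ᴹ-sym (≈ᴹ-trans (+ᴹ-identityʳ _) (*ₗ-identityˡ v))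

  ⊞₁-least : ∀ {q D v} (U : Subspace V q) → D ⊑ U → v ∈ U → (D ⊞₁ v) ⊑ U
  ⊞₁-least U D⊑U v∈U = mk⊑ λ (a , d , d∈D , x≈) →
    respects U (≈ᴹ-sym x≈) (+-closed U (*-closed U a v∈U) (include D⊑U d∈D))

  ⊞-base : ∀ D L → D ⊑ (D ⊞ L)
  ⊞-base D []      = ⊑-refl
  ⊞-base D (v ∷ L) = ⊑-trans (⊞-base D L) (⊞₁-base (D ⊞ L) v)

  ⊞-new : ∀ D L → All (_∈ D ⊞ L) L
  ⊞-new D []      = []
  ⊞-new D (v ∷ L) = ⊞₁-new (D ⊞ L) v ∷ All-⊑ (⊞₁-base (D ⊞ L) v) (⊞-new D L)

  ⊞-least : ∀ {q D L} (U : Subspace V q) → D ⊑ U → All (_∈ U) L → (D ⊞ L) ⊑ U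
  ⊞-least U D⊑U []            = D⊑U
  ⊞-least U D⊑U (v∈U ∷ L⊆U) = ⊞₁-least U (⊞-least U D⊑U L⊆U) v∈U

  ⟨⟩-least : ∀ {q L} (U : Subspace V q) → All (_∈ U) L → ⟨ L ⟩ ⊑ U
  ⟨⟩-least U = ⊞-least U (𝟘-least U)

  ⊞₁-mono : ∀ {D E} v → D ⊑ E → (D ⊞₁ v) ⊑ (E ⊞₁ v)
  ⊞₁-mono {D} {E} v D⊑E = ⊞₁-least (E ⊞₁ v) (⊑-trans D⊑E (⊞₁-base E v)) (⊞₁-new E v)

  ⊞-mono : ∀ {D E} L → D ⊑ E → (D ⊞ L) ⊑ (E ⊞ L)
  ⊞-mono {D} {E} L D⊑E = ⊞-least (E ⊞ L) (⊑-trans D⊑E (⊞-base E L)) (⊞-new E L)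

  ⊞-++ : ∀ D L L′ → D ⊞ (L ++ L′) ≡ (D ⊞ L′) ⊞ L
  ⊞-++ D []      L′ = ≡.refl
  ⊞-++ D (v ∷ L) L′ = ≡.cong (_⊞₁ v) (⊞-++ D L L′)

  ⊞-⊞₁-comm : ∀ D L v → ((D ⊞ L) ⊞₁ v) ⊑ ((D ⊞₁ v) ⊞ L)
  ⊞-⊞₁-comm D L v =
    ⊞₁-least ((D ⊞₁ v) ⊞ L) (⊞-mono L (⊞₁-base D v)) (include (⊞-base (D ⊞₁ v) L) (⊞₁-new D v))

  -- The coefficient of `v` in `x` cannot vanish, since then `x` would lie in `D`. Its inverse
  -- exists only up to double negation, and so does the conclusion.
  exchange : ∀ D {v x} → x ∈ D ⊞₁ v → x ∉ D → ¬ ¬ (v ∈ D ⊞₁ x)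
  exchange D {v} {x} (a , d , d∈D , x≈) x∉D = *-cancel (D ⊞₁ x) a≉0
    (∈-cancelʳ (D ⊞₁ x) x≈ (⊞₁-new D x) (include (⊞₁-base D x) d∈D))
    where
    a≉0 : ¬ (a K.≈ K.0#)
    a≉0 a≈0 = x∉D (respects D (≈ᴹ-sym (begin
      x            ≈⟨ x≈ ⟩
      a *ₗ v +ᴹ d  ≈⟨ +ᴹ-congʳ (≈ᴹ-trans (*ₗ-congʳ a≈0) (*ₗ-zeroˡ v)) ⟩
      0ᴹ +ᴹ d      ≈⟨ +ᴹ-identityˡ d ⟩
      d            ∎)) d∈D)

  -- Linear independence in the quotient by `D`, without forming the quotient.
  data Independent (D : Sub) : List Carrierᴹ → Set (c ⊔ m ⊔ ℓm ⊔ p) where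
    []  : Independent D []
    _∷_ : ∀ {v L} → v ∉ D ⊞ L → Independent D L → Independent D (v ∷ L)

  independent-antitone : ∀ {D E L} → D ⊑ E → Independent E L → Independent D L
  independent-antitone D⊑E []                     = []
  independent-antitone D⊑E (_∷_ {L = L} v∉ indep) = (λ v∈ → v∉ (include (⊞-mono L D⊑E) v∈)) ∷ independent-antitone D⊑E indep

  independent-++ : ∀ {D L L′} → Independent (D ⊞ L′) L → Independent D L′ → Independent D (L ++ L′)
  independent-++ []                           indep′ = indep′
  independent-++ {D} {v ∷ L} {L′} (v∉ ∷ indep) indep′ =
    (λ v∈ → v∉ (≡.subst (v ∈_) (⊞-++ D L L′) v∈)) ∷ independent-++ indep indep′

  -- Generators are peeled off until `w` first leaves the span; the one removed at that moment is
  -- traded for `w`, and the others are kept.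
  exchange-generator : ∀ D gs {w} → w ∈ D ⊞ gs → w ∉ D →
    ¬ ¬ (∃[ gs′ ] (suc (length gs′) ≡ length gs) × ((D ⊞ gs) ⊑ ((D ⊞₁ w) ⊞ gs′)))
  exchange-generator D []       w∈ w∉D = λ _ → w∉D w∈
  exchange-generator D (g ∷ gs) {w} w∈ w∉D = ¬¬-excluded-middle >>= λ where
    (yes w∈D⊞gs) → exchange-generator D gs w∈D⊞gs w∉D >>= λ (gs′ , len , ⊑′) →
      return (g ∷ gs′ , ≡.cong suc len , ⊞₁-mono g ⊑′)
    (no w∉D⊞gs) → exchange (D ⊞ gs) w∈ w∉D⊞gs >>= λ g∈ →
      return (gs , ≡.refl , ⊑-trans (⊞₁-least ((D ⊞ gs) ⊞₁ w) (⊞₁-base (D ⊞ gs) w) g∈) (⊞-⊞₁-comm D gs w))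

  steinitz-exchange : ∀ D gs {ws} → Independent D ws → All (_∈ D ⊞ gs) ws →
    ¬ ¬ (∃[ gs′ ] (length gs′ ℕ.+ length ws ≡ length gs) × ((D ⊞ gs) ⊑ ((D ⊞ ws) ⊞ gs′)))
  steinitz-exchange D gs [] [] = return (gs , ℕ.+-identityʳ _ , ⊑-refl)
  steinitz-exchange D gs {w ∷ ws} (w∉ ∷ indep) (w∈ ∷ ws⊆) =
    steinitz-exchange D gs indep ws⊆ >>= λ (gs′ , len , ⊑′) →
    exchange-generator (D ⊞ ws) gs′ (include ⊑′ w∈) w∉ >>= λ (gs″ , len′ , ⊑″) →
    return (gs″ , ≡.trans (ℕ.+-suc _ _) (≡.trans (≡.cong (ℕ._+ length ws) len′) len) , ⊑-trans ⊑′ ⊑″)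

  steinitz : ∀ D gs {ws} → Independent D ws → All (_∈ D ⊞ gs) ws → length ws ℕ.≤ length gs
  steinitz D gs {ws} indep ws⊆ with length ws ℕ.≤? length gs
  ... | yes ws≤gs = ws≤gs
  ... | no  ws≰gs = ⊥-elim (steinitz-exchange D gs indep ws⊆ λ (gs′ , len , _) →
    ws≰gs (≡.subst (length ws ℕ.≤_) len (ℕ.m≤n+m (length ws) (length gs′))))

  extract-independent : ∀ {q} {Q : Carrierᴹ → Set q} D {gs} → All Q gs →
    ¬ ¬ (∃[ ws ] Independent D ws × All Q ws × (All (_∈ D ⊞ ws) gs) × (length ws ℕ.≤ length gs))
  extract-independent D [] = return ([] , [] , [] , [] , ℕ.z≤n)
  extract-independent D {g ∷ gs} (Qg ∷ Qgs) =
    extract-independent D Qgs >>= λ (ws , indep , Qws , gs⊆ , len) →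
    ¬¬-excluded-middle >>= λ where
      (yes g∈) → return (ws , indep , Qws , g∈ ∷ gs⊆ , ℕ.m≤n⇒m≤1+n len)
      (no  g∉) → return (g ∷ ws , g∉ ∷ indep , Qg ∷ Qws ,
        ⊞₁-new (D ⊞ ws) g ∷ All-⊑ (⊞₁-base (D ⊞ ws) g) gs⊆ , ℕ.s≤s len)

  -- The modular law: subtracting the `L`-part of `v` leaves a vector `e` in both `D` and `A`. The
  -- last component adds that part back over any `U` containing `e`, because it is needed over
  -- different subspaces.
  modular : ∀ {q D} (A : Subspace V q) {L} → All (_∈ A) L → ∀ {v} → v ∈ D ⊞ L → v ∈ A →
    ∃[ e ] (e ∈ D) × (e ∈ A) × (∀ (U : Sub) → e ∈ U → v ∈ U ⊞ L)
  modular A []          v∈ v∈A = _ , v∈ , v∈A , λ U e∈U → e∈U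
  modular A (w∈A ∷ L⊆A) (a , d , d∈ , v≈) v∈A =
    let (e , e∈D , e∈A , rec) = modular A L⊆A d∈ (∈-cancelˡ A v≈ v∈A (*-closed A a w∈A)) in
    e , e∈D , e∈A , λ U e∈U → a , d , rec U e∈U , v≈

  -- Only the trace of `P` on `A` matters: if a vector of `A` lies in `P ⊞ L`, its `P`-part is in
  -- `A` by `modular`, hence in `D`.
  independent-enlarge : ∀ {q D P} (A : Subspace V q) {L} → All (_∈ A) L → (∀ {v} → v ∈ P → v ∈ A → v ∈ D) →
    Independent D L → Independent P L
  independent-enlarge A []          P∩A⊑D []           = []
  independent-enlarge {D = D} A (v∈A ∷ L⊆A) P∩A⊑D (v∉ ∷ indep) =
    (λ v∈ → let (e , e∈P , e∈A , rec) = modular A L⊆A v∈ v∈A in v∉ (rec D (P∩A⊑D e∈P e∈A)))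
    ∷ independent-enlarge A L⊆A P∩A⊑D indep

  -- Independence modulo `S` forces the coefficient of each vector of `L` in `y` to vanish.
  independent-avoid : ∀ {S U L} → Independent S L → U ⊑ S → ∀ {y} → y ∈ U ⊞ L → y ∈ S → y ∈ U
  independent-avoid []           U⊑S y∈U y∈S = y∈U
  independent-avoid {S} {U} {w ∷ L} (w∉ ∷ indep) U⊑S {y} (a , d , d∈ , y≈) y∈S =
    independent-avoid indep U⊑S (respects (U ⊞ L) d≈y d∈) y∈S
    where
    a≈0 : a K.≈ K.0#
    a≈0 = K.≈-stable λ a≉0 →
      *-cancel (S ⊞ L) a≉0 (∈-cancelʳ (S ⊞ L) y≈ (include (⊞-base S L) y∈S) (include (⊞-mono L U⊑S) d∈)) w∉

    d≈y : d ≈ᴹ y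
    d≈y = ≈ᴹ-sym (begin
      y            ≈⟨ y≈ ⟩
      a *ₗ w +ᴹ d  ≈⟨ +ᴹ-congʳ (≈ᴹ-trans (*ₗ-congʳ a≈0) (*ₗ-zeroˡ w)) ⟩
      0ᴹ +ᴹ d      ≈⟨ +ᴹ-identityˡ d ⟩
      d            ∎)

-- Bases, dimension, and splitting a subspace along another.

module Bases {c ℓ₁ ℓ₂} (F : HeytingField c ℓ₁ ℓ₂) {m ℓm} (V : LinearAlgebra.VectorSpace F m ℓm) (p : Level) where

  open LinearAlgebra F
  open Subspaces F V p public
  private module K = Scalars F
  open LeftModule V
  open import Relation.Binary.Reasoning.Setoid ≈ᴹ-setoid
  open import Algebra.Properties.Ring K.ring using (-0#≈0#; -‿involutive)

  linComb-∈ : ∀ {n} (a : Vector K.Carrier n) (b : Vector Carrierᴹ n) → linComb {V = V} a b ∈ ⟨ tabulate b ⟩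
  linComb-∈ {zero}  a b = lift ≈ᴹ-refl
  linComb-∈ {suc n} a b = a zero , _ , linComb-∈ (λ i → a (suc i)) (λ i → b (suc i)) , ≈ᴹ-refl

  linComb-lookup-∈ : ∀ L (a : Vector K.Carrier (length L)) → linComb {V = V} a (lookup L) ∈ ⟨ L ⟩
  linComb-lookup-∈ []      a = lift ≈ᴹ-refl
  linComb-lookup-∈ (v ∷ L) a = a zero , _ , linComb-lookup-∈ L (λ i → a (suc i)) , ≈ᴹ-refl

  ∈-linComb : ∀ {n} (b : Vector Carrierᴹ n) {v} → v ∈ ⟨ tabulate b ⟩ → ∃[ a ] v ≈ᴹ linComb {V = V} a b
  ∈-linComb {zero}  b (lift v≈0)          = (λ ()) , v≈0
  ∈-linComb {suc n} b (a , d , d∈ , v≈) =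
    let (as , d≈) = ∈-linComb (λ i → b (suc i)) d∈ in
    (λ { zero → a ; (suc i) → as i }) , ≈ᴹ-trans v≈ (+ᴹ-congˡ d≈)

  ∈-linComb-lookup : ∀ L {v} → v ∈ ⟨ L ⟩ → ∃[ a ] v ≈ᴹ linComb {V = V} a (lookup L)
  ∈-linComb-lookup []      (lift v≈0)          = (λ ()) , v≈0
  ∈-linComb-lookup (w ∷ L) (a , d , d∈ , v≈) =
    let (as , d≈) = ∈-linComb-lookup L d∈ in
    (λ { zero → a ; (suc i) → as i }) , ≈ᴹ-trans v≈ (+ᴹ-congˡ d≈)

  independent-tabulate : ∀ {n} (b : Vector Carrierᴹ n) → LinearlyIndependent {V = V} b → Independent 𝟘 (tabulate b)
  independent-tabulate {zero}  b indep = []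
  independent-tabulate {suc n} b indep =
    (λ b₀∈ → let (a , b₀≈) = ∈-linComb (λ i → b (suc i)) b₀∈ in
      K.1≉0 (K.trans (K.sym (-‿involutive K.1#)) (K.trans
        (K.-‿cong (indep (λ { zero → K.- K.1# ; (suc i) → a i }) (relation a b₀≈) zero)) -0#≈0#)))
    ∷ independent-tabulate (λ i → b (suc i)) λ a lc≈0 i →
        indep (λ { zero → K.0# ; (suc i) → a i })
          (≈ᴹ-trans (+ᴹ-cong (*ₗ-zeroˡ (b zero)) lc≈0) (+ᴹ-identityˡ 0ᴹ)) (suc i)
    where
    relation : ∀ a → b zero ≈ᴹ linComb {V = V} a (λ i → b (suc i)) →
      (K.- K.1#) *ₗ b zero +ᴹ linComb {V = V} a (λ i → b (suc i)) ≈ᴹ 0ᴹ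
    relation a b₀≈ = begin
      (K.- K.1#) *ₗ b zero +ᴹ linComb {V = V} a (λ i → b (suc i)) ≈⟨ +ᴹ-congˡ b₀≈ ⟨
      (K.- K.1#) *ₗ b zero +ᴹ b zero              ≈⟨ +ᴹ-congˡ (*ₗ-identityˡ (b zero)) ⟨
      (K.- K.1#) *ₗ b zero +ᴹ K.1# *ₗ b zero      ≈⟨ *ₗ-distribʳ (b zero) (K.- K.1#) K.1# ⟨
      (K.- K.1# K.+ K.1#) *ₗ b zero               ≈⟨ *ₗ-congʳ (K.-‿inverseˡ K.1#) ⟩
      K.0# *ₗ b zero                              ≈⟨ *ₗ-zeroˡ (b zero) ⟩
      0ᴹ                                          ∎

  linearlyIndependent-lookup : ∀ {L} → Independent 𝟘 L → LinearlyIndependent {V = V} (lookup L)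
  linearlyIndependent-lookup {v ∷ L} (v∉ ∷ indep) a lc≈0 = λ where
      zero    → a₀≈0
      (suc i) → linearlyIndependent-lookup indep (λ i → a (suc i)) rest≈0 i
    where
    rest : Carrierᴹ
    rest = linComb {V = V} (λ i → a (suc i)) (lookup L)

    a₀≈0 : a zero K.≈ K.0#
    a₀≈0 = K.≈-stable λ a₀≉0 → *-cancel ⟨ L ⟩ a₀≉0
      (∈-cancelʳ ⟨ L ⟩ (≈ᴹ-sym lc≈0) (0-closed ⟨ L ⟩) (linComb-lookup-∈ L (λ i → a (suc i)))) v∉

    rest≈0 : rest ≈ᴹ 0ᴹ
    rest≈0 = begin
      rest                  ≈⟨ +ᴹ-identityˡ rest ⟨
      0ᴹ +ᴹ rest            ≈⟨ +ᴹ-congʳ (≈ᴹ-trans (*ₗ-congʳ a₀≈0) (*ₗ-zeroˡ v)) ⟨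
      a zero *ₗ v +ᴹ rest   ≈⟨ lc≈0 ⟩
      0ᴹ                    ∎

  record Basis {q} (W : Subspace V q) (n : ℕ) : Set (c ⊔ m ⊔ ℓm ⊔ p ⊔ q) where
    field
      basis       : List Carrierᴹ
      length≡     : length basis ≡ n
      independent : Independent 𝟘 basis
      inside      : All (_∈ W) basis
      spanning    : W ⊑ ⟨ basis ⟩

    ⟨⟩⊑ : ⟨ basis ⟩ ⊑ W
    ⟨⟩⊑ = ⟨⟩-least W inside

  open Basis public

  hasDim⇒basis : ∀ {q} (W : Subspace V q) {n} → HasDim W n → Basis W n
  hasDim⇒basis W (b , b∈W , indep , span) = record
    { basis       = tabulate b
    ; length≡     = length-tabulate b
    ; independent = independent-tabulate b indep
    ; inside      = All.tabulate⁺ b∈W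
    ; spanning    = mk⊑ λ {v} v∈W → let (a , v≈) = span v v∈W in respects ⟨ tabulate b ⟩ (≈ᴹ-sym v≈) (linComb-∈ a b)
    }

  basis⇒hasDim : ∀ {q} (W : Subspace V q) L → Independent 𝟘 L → All (_∈ W) L →
    (∀ {v} → v ∈ W → v ∈ ⟨ L ⟩) → HasDim W (length L)
  basis⇒hasDim W L indep L⊆W W⊑ =
    lookup L , (λ i → All.lookup L⊆W (∈-lookup i)) , linearlyIndependent-lookup indep , λ v v∈W → ∈-linComb-lookup L (W⊑ v∈W)

  -- u is a basis of ⟨ e ⟩ ∩ S, and w completes it to a basis of ⟨ e ⟩.
  record Split (S : Sub) (e : List Carrierᴹ) : Set (c ⊔ m ⊔ ℓm ⊔ p) where
    field
      w u     : List Carrierᴹ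
      w-indep : Independent S w
      u-indep : Independent 𝟘 u
      w⊆      : All (_∈ ⟨ e ⟩) w
      u⊆      : All (_∈ ⟨ e ⟩) u
      u⊆S     : All (_∈ S) u
      meet    : ∀ {v} → v ∈ ⟨ e ⟩ → v ∈ S → v ∈ ⟨ u ⟩
      covers  : ⟨ e ⟩ ⊑ (S ⊞ w)
      total   : length w ℕ.+ length u ≡ length e

    u-largest : ∀ {y} → Independent 𝟘 y → All (_∈ ⟨ e ⟩) y → All (_∈ S) y → length y ℕ.≤ length u
    u-largest y-indep y⊆ y⊆S = steinitz 𝟘 u y-indep (All.map (λ (y∈ , y∈S) → meet y∈ y∈S) (All.zip (y⊆ , y⊆S)))

  private
    -- `modular` strips the `w`-part off every generator. What remains lies in both `S` and `A`, and
    -- supplies the basis of the intersection.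
    remainders : ∀ {q} S (A : Subspace V q) w {gs} → All (_∈ A) w → All (_∈ S ⊞ w) gs → All (_∈ A) gs →
      ∃[ s ] All (λ v → v ∈ S × v ∈ A) s × All (_∈ ⟨ s ⟩ ⊞ w) gs
    remainders S A w w⊆A []            []            = [] , [] , []
    remainders S A w w⊆A (g∈ ∷ gs⊆) (g∈A ∷ gs⊆A) =
      let (s , s⊆ , gs⊆′)          = remainders S A w w⊆A gs⊆ gs⊆A
          (e , e∈S , e∈A , rec) = modular A w⊆A g∈ g∈A in
      e ∷ s , (e∈S , e∈A) ∷ s⊆ , rec ⟨ e ∷ s ⟩ (⊞₁-new ⟨ s ⟩ e) ∷ All-⊑ (⊞-mono w (⊞₁-base ⟨ s ⟩ e)) gs⊆′

  split : ∀ S e → Independent 𝟘 e → ¬ ¬ (Split S e)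
  split S e e-indep =
    extract-independent S (⊞-new 𝟘 e) >>= λ (w , w-indep , w⊆ , e⊆S⊞w , _) →
    let (s , s⊆ , e⊆s⊞w) = remainders S ⟨ e ⟩ w w⊆ e⊆S⊞w (⊞-new 𝟘 e) in
    extract-independent 𝟘 s⊆ >>= λ (u , u-indep , u⊆ , s⊆u , _) →
    let u⊆S      = All.map proj₁ u⊆
        u⊆e      = All.map proj₂ u⊆
        u⊑S      = ⟨⟩-least S u⊆S
        e⊆u⊞w    = All-⊑ (⊞-mono w (⟨⟩-least ⟨ u ⟩ s⊆u)) e⊆s⊞w
        wu-indep = independent-++ (independent-antitone u⊑S w-indep) u-indep
    in return record
      { w = w ; u = u ; w-indep = w-indep ; u-indep = u-indep ; w⊆ = w⊆ ; u⊆ = u⊆e ; u⊆S = u⊆S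
      ; meet   = λ v∈e v∈S → independent-avoid w-indep u⊑S (include (⟨⟩-least (⟨ u ⟩ ⊞ w) e⊆u⊞w) v∈e) v∈S
      ; covers = ⟨⟩-least (S ⊞ w) e⊆S⊞w
      ; total  = ≡.trans (≡.sym (length-++ w)) (ℕ.≤-antisym
          (steinitz 𝟘 e wu-indep (All.++⁺ w⊆ u⊆e))
          (steinitz 𝟘 (w ++ u) e-indep
            (≡.subst (λ D → All (_∈ D) e) (≡.sym (⊞-++ 𝟘 w u)) e⊆u⊞w)))
      }

  -- Choosing `a` independent modulo the join of both intersections makes it independent modulo `P`
  -- and modulo `Q` separately, by `independent-enlarge`. At most the dimensions of the two
  -- intersections are lost.
  complement₂ : ∀ {P Q e} → Independent 𝟘 e → (p : Split P e) (q : Split Q e) →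
    ¬ ¬ (∃[ a ] Independent P a × Independent Q a × All (_∈ ⟨ e ⟩) a ×
      (length e ℕ.≤ length a ℕ.+ (length (Split.u p) ℕ.+ length (Split.u q))))
  complement₂ {P} {Q} {e} e-indep p q =
    extract-independent ⟨ d ⟩ (⊞-new 𝟘 e) >>= λ (a , a-indep , a⊆ , e⊆ , _) → return
      ( a
      , independent-enlarge ⟨ e ⟩ a⊆ (λ v∈P v∈e → include P⊑ (Split.meet p v∈e v∈P)) a-indep
      , independent-enlarge ⟨ e ⟩ a⊆ (λ v∈Q v∈e → include Q⊑ (Split.meet q v∈e v∈Q)) a-indep
      , a⊆
      , ≡.subst (length e ℕ.≤_) (≡.trans (length-++ a) (≡.cong (length a ℕ.+_) (length-++ (Split.u p))))
          (steinitz 𝟘 (a ++ d) e-indep (≡.subst (λ D → All (_∈ D) e) (≡.sym (⊞-++ 𝟘 a d)) e⊆)))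
    where
    d : List Carrierᴹ
    d = Split.u p ++ Split.u q

    P⊑ : ⟨ Split.u p ⟩ ⊑ ⟨ d ⟩
    P⊑ = ⟨⟩-least ⟨ d ⟩ (All.++⁻ˡ (Split.u p) (⊞-new 𝟘 d))

    Q⊑ : ⟨ Split.u q ⟩ ⊑ ⟨ d ⟩
    Q⊑ = ⟨⟩-least ⟨ d ⟩ (All.++⁻ʳ (Split.u p) (⊞-new 𝟘 d))

-- Linear independence in exterior powers

-- The coordinates of an element of the exterior algebra of Kⁿ are indexed
-- by the subsets of {1,…,n}.
module Grassmann {c ℓ} (K : CommutativeRing c ℓ) where

  open CommutativeRing K hiding (zero)
  open import Algebra.Properties.Ring ring
    using (-0#≈0#; -‿distribʳ-*; -‿+-comm; +-inverseˡ-unique)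
  open import Algebra.Properties.CommutativeSemigroup +-commutativeSemigroup using (interchange)
  open import Algebra.Properties.CommutativeSemigroup *-commutativeSemigroup using (x∙yz≈y∙xz)
  open import Relation.Binary.Reasoning.Setoid setoid

  Ext : ℕ → Set c
  Ext n = Vec Bool n → Carrier

  infix 4 _≋_
  _≋_ : ∀ {n} → Ext n → Ext n → Set ℓ
  ω ≋ η = ∀ s → ω s ≈ η s

  _without₀ _with₀ : ∀ {n} → Ext (suc n) → Ext n
  (ω without₀) s = ω (false ∷ s)
  (ω with₀) s    = ω (true ∷ s)

  infixr 7 _∧_
  -- Write ω = ω₀ + e₀ ∧ ω₁ and v = v₀ e₀ + v′. Then v ∧ ω = v′ ∧ ω₀ + e₀ ∧ (v₀ ω₀ - v′ ∧ ω₁), the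
  -- sign coming from moving v′ past e₀.
  _∧_ : ∀ {n} → Vector Carrier n → Ext n → Ext n
  (v ∧ ω) []          = 0#
  (v ∧ ω) (false ∷ s) = (tail v ∧ ω without₀) s
  (v ∧ ω) (true ∷ s)  = head v * ω (false ∷ s) - (tail v ∧ ω with₀) s

  private
    sub-cong : ∀ {x y u v} → x ≈ y → u ≈ v → x - u ≈ y - v
    sub-cong x≈y u≈v = +-cong x≈y (-‿cong u≈v)

    sub-interchange : ∀ a b c d → (a + b) - (c + d) ≈ (a - c) + (b - d)
    sub-interchange a b c d = trans (+-congˡ (sym (-‿+-comm c d))) (interchange a b (- c) (- d))

    *-sub : ∀ a x y → a * x - a * y ≈ a * (x - y)
    *-sub a x y = trans (+-congˡ (-‿distribʳ-* a y)) (sym (distribˡ a x (- y)))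

    x-x≈0 : ∀ {x y} → x ≈ y → x - y ≈ 0#
    x-x≈0 {x} {y} x≈y = trans (+-congʳ x≈y) (-‿inverseʳ y)

    0-0≈0 : ∀ {x y} → x ≈ 0# → y ≈ 0# → x - y ≈ 0#
    0-0≈0 x≈0 y≈0 = x-x≈0 (trans x≈0 (sym y≈0))

    x-0≈x : ∀ {x y} → y ≈ 0# → x - y ≈ x
    x-0≈x y≈0 = trans (+-congˡ (trans (-‿cong y≈0) -0#≈0#)) (+-identityʳ _)

  ∧-cong : ∀ {n} {v w : Vector Carrier n} {ω η : Ext n} → (∀ i → v i ≈ w i) → ω ≋ η → v ∧ ω ≋ w ∧ η
  ∧-cong v≈w ω≋η []          = refl
  ∧-cong v≈w ω≋η (false ∷ s) = ∧-cong (v≈w ∘ suc) (ω≋η ∘ (false ∷_)) s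
  ∧-cong v≈w ω≋η (true ∷ s)  =
    sub-cong (*-cong (v≈w zero) (ω≋η (false ∷ s))) (∧-cong (v≈w ∘ suc) (ω≋η ∘ (true ∷_)) s)

  ∧-congˡ : ∀ {n} {v : Vector Carrier n} {ω η : Ext n} → ω ≋ η → v ∧ ω ≋ v ∧ η
  ∧-congˡ = ∧-cong λ _ → refl

  ∧-distribʳ : ∀ {n} (v w : Vector Carrier n) (ω : Ext n) →
    (λ i → v i + w i) ∧ ω ≋ λ s → (v ∧ ω) s + (w ∧ ω) s
  ∧-distribʳ v w ω []          = sym (+-identityˡ 0#)
  ∧-distribʳ v w ω (false ∷ s) = ∧-distribʳ (tail v) (tail w) (ω without₀) s
  ∧-distribʳ v w ω (true ∷ s)  =
    trans (sub-cong (distribʳ _ _ _) (∧-distribʳ (tail v) (tail w) (ω with₀) s)) (sub-interchange _ _ _ _)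

  ∧-distribˡ : ∀ {n} (v : Vector Carrier n) (ω η : Ext n) →
    v ∧ (λ s → ω s + η s) ≋ λ s → (v ∧ ω) s + (v ∧ η) s
  ∧-distribˡ v ω η []          = sym (+-identityˡ 0#)
  ∧-distribˡ v ω η (false ∷ s) = ∧-distribˡ (tail v) (ω without₀) (η without₀) s
  ∧-distribˡ v ω η (true ∷ s)  =
    trans (sub-cong (distribˡ _ _ _) (∧-distribˡ (tail v) (ω with₀) (η with₀) s)) (sub-interchange _ _ _ _)

  ∧-homoʳ : ∀ {n} a (v : Vector Carrier n) (ω : Ext n) → (λ i → a * v i) ∧ ω ≋ λ s → a * (v ∧ ω) s
  ∧-homoʳ a v ω []          = sym (zeroʳ a)
  ∧-homoʳ a v ω (false ∷ s) = ∧-homoʳ a (tail v) (ω without₀) s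
  ∧-homoʳ a v ω (true ∷ s)  =
    trans (sub-cong (*-assoc _ _ _) (∧-homoʳ a (tail v) (ω with₀) s)) (*-sub a _ _)

  ∧-homoˡ : ∀ {n} a (v : Vector Carrier n) (ω : Ext n) → v ∧ (λ s → a * ω s) ≋ λ s → a * (v ∧ ω) s
  ∧-homoˡ a v ω []          = sym (zeroʳ a)
  ∧-homoˡ a v ω (false ∷ s) = ∧-homoˡ a (tail v) (ω without₀) s
  ∧-homoˡ a v ω (true ∷ s)  =
    trans (sub-cong (x∙yz≈y∙xz _ _ _) (∧-homoˡ a (tail v) (ω with₀) s)) (*-sub a _ _)

  ∧-zero : ∀ {n} (v : Vector Carrier n) {ω : Ext n} → (∀ s → ω s ≈ 0#) → ∀ s → (v ∧ ω) s ≈ 0#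
  ∧-zero v ω≈0 []          = refl
  ∧-zero v ω≈0 (false ∷ s) = ∧-zero (tail v) (ω≈0 ∘ (false ∷_)) s
  ∧-zero v ω≈0 (true ∷ s)  =
    0-0≈0 (trans (*-congˡ (ω≈0 (false ∷ s))) (zeroʳ _)) (∧-zero (tail v) (ω≈0 ∘ (true ∷_)) s)

  ∧-neg : ∀ {n} (v : Vector Carrier n) (ω : Ext n) → v ∧ (λ s → - ω s) ≋ λ s → - (v ∧ ω) s
  ∧-neg v ω s = +-inverseˡ-unique _ _ (trans (sym (∧-distribˡ v (λ s → - ω s) ω s))
    (∧-zero v (λ s → -‿inverseˡ (ω s)) s))

  -- In the e₀-part the two terms v₀ (v′ ∧ ω₀) cancel and v′ ∧ v′ ∧ ω₁ remains, zero by induction.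
  -- Anticommutativity is derived from alternation, so characteristic 2 needs no separate treatment.
  ∧-square : ∀ {n} (v : Vector Carrier n) (ω : Ext n) → ∀ s → (v ∧ v ∧ ω) s ≈ 0#
  ∧-square v ω []          = refl
  ∧-square v ω (false ∷ s) = ∧-square (tail v) (ω without₀) s
  ∧-square v ω (true ∷ s)  = x-x≈0 (sym (begin
    (tail v ∧ (v ∧ ω) with₀) s
      ≈⟨ ∧-distribˡ (tail v) (λ s → head v * ω (false ∷ s)) (λ s → - (tail v ∧ ω with₀) s) s ⟩
    (tail v ∧ (λ s → head v * ω (false ∷ s))) s + (tail v ∧ (λ s → - (tail v ∧ ω with₀) s)) s
      ≈⟨ +-cong (∧-homoˡ (head v) (tail v) (ω without₀) s) (∧-neg (tail v) (tail v ∧ ω with₀) s) ⟩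
    head v * (tail v ∧ ω without₀) s - (tail v ∧ tail v ∧ ω with₀) s
      ≈⟨ x-0≈x (∧-square (tail v) (ω with₀) s) ⟩
    head v * (tail v ∧ ω without₀) s
      ∎))

  ∧-anticomm : ∀ {n} (v w : Vector Carrier n) (ω : Ext n) → ∀ s → (v ∧ w ∧ ω) s ≈ - (w ∧ v ∧ ω) s
  ∧-anticomm v w ω s = +-inverseˡ-unique _ _ (begin
    (v ∧ w ∧ ω) s + (w ∧ v ∧ ω) s
      ≈⟨ +-cong (+-identityˡ _) (+-identityʳ _) ⟨
    (0# + (v ∧ w ∧ ω) s) + ((w ∧ v ∧ ω) s + 0#)
      ≈⟨ +-cong (+-congʳ (∧-square v ω s)) (+-congˡ (∧-square w ω s)) ⟨
    ((v ∧ v ∧ ω) s + (v ∧ w ∧ ω) s) + ((w ∧ v ∧ ω) s + (w ∧ w ∧ ω) s)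
      ≈⟨ +-cong (∧-distribˡ v (v ∧ ω) (w ∧ ω) s) (∧-distribˡ w (v ∧ ω) (w ∧ ω) s) ⟨
    (v ∧ (λ s → (v ∧ ω) s + (w ∧ ω) s)) s + (w ∧ (λ s → (v ∧ ω) s + (w ∧ ω) s)) s
      ≈⟨ ∧-distribʳ v w (λ s → (v ∧ ω) s + (w ∧ ω) s) s ⟨
    ((λ i → v i + w i) ∧ (λ s → (v ∧ ω) s + (w ∧ ω) s)) s
      ≈⟨ ∧-congˡ (∧-distribʳ v w ω) s ⟨
    ((λ i → v i + w i) ∧ (λ i → v i + w i) ∧ ω) s
      ≈⟨ ∧-square (λ i → v i + w i) ω s ⟩
    0#
      ∎)

  one : ∀ {n} → Ext n
  one []          = 1#
  one (false ∷ s) = one s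
  one (true ∷ s)  = 0#

  ⋁ : ∀ {k n} → Vector (Vector Carrier n) k → Ext n
  ⋁ {zero}  c = one
  ⋁ {suc k} c = head c ∧ ⋁ (tail c)

  ⋁-cong : ∀ {k n} {c d : Vector (Vector Carrier n) k} → (∀ j i → c j i ≈ d j i) → ⋁ c ≋ ⋁ d
  ⋁-cong {zero}  c≈d s = refl
  ⋁-cong {suc k} c≈d   = ∧-cong (c≈d zero) (⋁-cong (c≈d ∘ suc))

  ⋁-+ : ∀ {k n} (c : Vector (Vector Carrier n) k) j x y →
    ⋁ (updateAt c j (const λ i → x i + y i)) ≋
    λ s → ⋁ (updateAt c j (const x)) s + ⋁ (updateAt c j (const y)) s
  ⋁-+ c zero    x y   = ∧-distribʳ x y (⋁ (tail c))
  ⋁-+ c (suc j) x y s = trans (∧-congˡ (⋁-+ (tail c) j x y) s) (∧-distribˡ (head c) _ _ s)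

  ⋁-* : ∀ {k n} (c : Vector (Vector Carrier n) k) j a x →
    ⋁ (updateAt c j (const λ i → a * x i)) ≋ λ s → a * ⋁ (updateAt c j (const x)) s
  ⋁-* c zero    a x   = ∧-homoʳ a x (⋁ (tail c))
  ⋁-* c (suc j) a x s = trans (∧-congˡ (⋁-* (tail c) j a x) s) (∧-homoˡ a (head c) _ s)

  ∧-⋁-repeated : ∀ {k n} (v : Vector Carrier n) (c : Vector (Vector Carrier n) k) j →
    (∀ i → v i ≈ c j i) → ∀ s → (v ∧ ⋁ c) s ≈ 0#
  ∧-⋁-repeated v c zero    v≈ s =
    trans (∧-congˡ (∧-cong (λ i → sym (v≈ i)) (λ _ → refl)) s) (∧-square v (⋁ (tail c)) s)
  ∧-⋁-repeated v c (suc j) v≈ s =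
    trans (∧-anticomm v (head c) (⋁ (tail c)) s) (trans
      (-‿cong (∧-zero (head c) (∧-⋁-repeated v (tail c) j v≈) s)) -0#≈0#)

  ⋁-alternating : ∀ {k n} (c : Vector (Vector Carrier n) k) {j l} → j ≢ l →
    (∀ i → c j i ≈ c l i) → ∀ s → ⋁ c s ≈ 0#
  ⋁-alternating c {zero}  {zero}  j≢l cj≈cl = ⊥-elim (j≢l ≡.refl)
  ⋁-alternating c {zero}  {suc l} j≢l cj≈cl = ∧-⋁-repeated (head c) (tail c) l cj≈cl
  ⋁-alternating c {suc j} {zero}  j≢l cj≈cl = ∧-⋁-repeated (head c) (tail c) j (λ i → sym (cj≈cl i))
  ⋁-alternating c {suc j} {suc l} j≢l cj≈cl =
    ∧-zero (head c) (⋁-alternating (tail c) (j≢l ∘ ≡.cong suc) cj≈cl)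

  Avoids : ∀ {n} → Fin n → Ext n → Set ℓ
  Avoids i ω = ∀ s → Vec.lookup s i ≡ true → ω s ≈ 0#

  ∧-avoids : ∀ {n} (v : Vector Carrier n) {ω : Ext n} i → v i ≈ 0# → Avoids i ω → Avoids i (v ∧ ω)
  ∧-avoids v zero    v₀≈0 avoids (true ∷ s)  _   =
    0-0≈0 (trans (*-congʳ v₀≈0) (zeroˡ _)) (∧-zero (tail v) (λ s → avoids (true ∷ s) ≡.refl) s)
  ∧-avoids v (suc i) vᵢ≈0 avoids (false ∷ s) i∈s = ∧-avoids (tail v) i vᵢ≈0 (avoids ∘ (false ∷_)) s i∈s
  ∧-avoids v (suc i) vᵢ≈0 avoids (true ∷ s)  i∈s =
    0-0≈0 (trans (*-congˡ (avoids (false ∷ s) i∈s)) (zeroʳ _)) (∧-avoids (tail v) i vᵢ≈0 (avoids ∘ (true ∷_)) s i∈s)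

  one-avoids : ∀ {n} (i : Fin n) → Avoids i one
  one-avoids zero    (true ∷ s)  i∈s = refl
  one-avoids (suc i) (false ∷ s) i∈s = one-avoids i s i∈s
  one-avoids (suc i) (true ∷ s)  i∈s = refl

  ⋁-avoids : ∀ {k n} (c : Vector (Vector Carrier n) k) i → (∀ j → c j i ≈ 0#) → Avoids i (⋁ c)
  ⋁-avoids {zero}  c i c≈0 = one-avoids i
  ⋁-avoids {suc k} c i c≈0 = ∧-avoids (head c) i (c≈0 zero) (⋁-avoids (tail c) i (c≈0 ∘ suc))

  ⋁-without₀ : ∀ {k n} (c : Vector (Vector Carrier (suc n)) k) → (⋁ c) without₀ ≋ ⋁ (tail ∘ c)
  ⋁-without₀ {zero}  c s = refl
  ⋁-without₀ {suc k} c s = ∧-congˡ (⋁-without₀ (tail c)) s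

  -- As the top coefficient of a product of `k` vectors, the determinant inherits multilinearity and
  -- alternation from `⋁`.
  det : ∀ {k} → Vector (Vector Carrier k) k → Carrier
  det {k} c = ⋁ c (Vec.replicate k true)

  det-zero-row : ∀ {k} (c : Vector (Vector Carrier k) k) i → (∀ j → c j i ≈ 0#) → det c ≈ 0#
  det-zero-row c i c≈0 = ⋁-avoids c i c≈0 _ (lookup-replicate i true)

  -- Laplace expansion along a coordinate reading 1, 0, ..., 0: no later vector involves e₀, so the
  -- second summand of `_∧_` vanishes.
  det-minor : ∀ {k} (c : Vector (Vector Carrier (suc k)) (suc k)) → c zero zero ≈ 1# →
    (∀ j → c (suc j) zero ≈ 0#) → det c ≈ det (tail ∘ tail c)
  det-minor {k} c c₀₀≈1 row≈0 = begin
    head (head c) * ⋁ (tail c) (false ∷ s) - (tail (head c) ∧ (⋁ (tail c)) with₀) s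
      ≈⟨ x-0≈x (∧-zero (tail (head c)) (λ s → ⋁-avoids (tail c) zero row≈0 (true ∷ s) ≡.refl) s) ⟩
    head (head c) * ⋁ (tail c) (false ∷ s)  ≈⟨ *-cong c₀₀≈1 (⋁-without₀ (tail c) s) ⟩
    1# * det (tail ∘ tail c)                  ≈⟨ *-identityˡ _ ⟩
    det (tail ∘ tail c)                       ∎
    where
    s : Vec Bool k
    s = Vec.replicate k true

¬¬-Fin : ∀ {a n} {A : Fin n → Set a} → (∀ i → ¬ ¬ A i) → ¬ ¬ (∀ i → A i)
¬¬-Fin {n = zero}  f = return λ ()
¬¬-Fin {n = suc n} f = f zero >>= λ a → ¬¬-Fin (f ∘ suc) >>= λ as → return λ { zero → a ; (suc i) → as i }

-- Partial functionals and the evaluation of wedges.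

module Forms {c ℓ₁ ℓ₂} (F : HeytingField c ℓ₁ ℓ₂) {m ℓm} (V : LinearAlgebra.VectorSpace F m ℓm) (p : Level) where

  open LinearAlgebra F using (module Exterior)
  open Bases F V p
  private module K = Scalars F
  open Grassmann K.K
  open LeftModule V
  open import Relation.Binary.Reasoning.Setoid ≈ᴹ-setoid
  open import Algebra.Properties.Ring K.ring using (x∙y⁻¹≈ε⇒x≈y)

  -- A linear functional defined on hyper ⊞₁ point, with kernel hyper and
  -- value 1 at point.
  record Functional : Set (Level.suc (c ⊔ m ⊔ ℓm ⊔ p)) where
    field
      point        : Carrierᴹ
      hyper        : Sub
      point∉hyper : point ∉ hyper

  open Functional

  record Value (φ : Functional) (v : Carrierᴹ) (a : K.Carrier) : Set (c ⊔ m ⊔ ℓm ⊔ p) where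
    constructor mkValue
    field decomposition : ∃[ d ] (d ∈ hyper φ) × (v ≈ᴹ a *ₗ point φ +ᴹ d)

  open Value

  Domain : Functional → Sub
  Domain φ = hyper φ ⊞₁ point φ

  -- The difference of two values multiplies the point into the kernel, so a nonzero difference
  -- would put the point itself there.
  value-unique : ∀ φ {v w a b} → v ≈ᴹ w → Value φ v a → Value φ w b → a K.≈ b
  value-unique φ {v} {w} {a} {b} v≈w (mkValue (d , d∈ , v≈)) (mkValue (e , e∈ , w≈)) = x∙y⁻¹≈ε⇒x≈y a b (K.≈-stable λ a-b≉0 →
    *-cancel (hyper φ) a-b≉0 (∈-cancelʳ (hyper φ) eq (+-closed (hyper φ) e∈ (-ᴹ-closed (hyper φ) d∈))
      (0-closed (hyper φ))) (point∉hyper φ))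
    where
    x = point φ

    eq : e +ᴹ -ᴹ d ≈ᴹ (a K.- b) *ₗ x +ᴹ 0ᴹ
    eq = begin
      e +ᴹ -ᴹ d
        ≈⟨ +ᴹ-identityˡ _ ⟨
      0ᴹ +ᴹ (e +ᴹ -ᴹ d)
        ≈⟨ +ᴹ-congʳ (≈ᴹ-trans (*ₗ-congʳ (K.-‿inverseʳ b)) (*ₗ-zeroˡ x)) ⟨
      (b K.- b) *ₗ x +ᴹ (e +ᴹ -ᴹ d)
        ≈⟨ +ᴹ-congʳ (*ₗ-congʳ (K.+-comm _ _)) ⟩
      (K.- b K.+ b) *ₗ x +ᴹ (e +ᴹ -ᴹ d)
        ≈⟨ +ᴹ-congʳ (*ₗ-distribʳ x _ _) ⟩
      ((K.- b) *ₗ x +ᴹ b *ₗ x) +ᴹ (e +ᴹ -ᴹ d)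
        ≈⟨ ≈ᴹ-trans (≈ᴹ-sym (+ᴹ-assoc _ _ _)) (+ᴹ-congʳ (+ᴹ-assoc _ _ _)) ⟩
      (K.- b) *ₗ x +ᴹ (b *ₗ x +ᴹ e) +ᴹ -ᴹ d
        ≈⟨ +ᴹ-congʳ (+ᴹ-congˡ (≈ᴹ-trans (≈ᴹ-sym w≈) (≈ᴹ-trans (≈ᴹ-sym v≈w) v≈))) ⟩
      (K.- b) *ₗ x +ᴹ (a *ₗ x +ᴹ d) +ᴹ -ᴹ d
        ≈⟨ +ᴹ-congʳ (≈ᴹ-trans (≈ᴹ-sym (+ᴹ-assoc _ _ _)) (+ᴹ-congʳ (+ᴹ-comm _ _))) ⟩
      a *ₗ x +ᴹ (K.- b) *ₗ x +ᴹ d +ᴹ -ᴹ d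
        ≈⟨ +ᴹ-assoc _ _ _ ⟩
      a *ₗ x +ᴹ (K.- b) *ₗ x +ᴹ (d +ᴹ -ᴹ d)
        ≈⟨ +ᴹ-cong (≈ᴹ-sym (*ₗ-distribʳ x a (K.- b))) (-ᴹ‿inverseʳ d) ⟩
      (a K.- b) *ₗ x +ᴹ 0ᴹ
        ∎

  value-resp : ∀ φ {v w a} → v ≈ᴹ w → Value φ v a → Value φ w a
  value-resp φ v≈w (mkValue (d , d∈ , v≈)) = mkValue (d , d∈ , ≈ᴹ-trans (≈ᴹ-sym v≈w) v≈)

  value-+ : ∀ φ {v w a b} → Value φ v a → Value φ w b → Value φ (v +ᴹ w) (a K.+ b)
  value-+ φ (mkValue v↦a) (mkValue w↦b) = mkValue (proj₂ (+-closed (Domain φ) (_ , v↦a) (_ , w↦b)))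

  value-* : ∀ φ b {v a} → Value φ v a → Value φ (b *ₗ v) (b K.* a)
  value-* φ b (mkValue v↦a) = mkValue (proj₂ (*-closed (Domain φ) b (_ , v↦a)))

  value-point : ∀ φ → Value φ (point φ) K.1#
  value-point φ = mkValue (proj₂ (⊞₁-new (hyper φ) (point φ)))

  value-hyper : ∀ φ {v} → v ∈ hyper φ → Value φ v K.0#
  value-hyper φ v∈ = mkValue (proj₂ (include (⊞₁-base (hyper φ) (point φ)) v∈))

  -- A larger kernel with the same point enlarges the graph, so existing values persist.
  record _≼_ (φ ψ : Functional) : Set (c ⊔ m ⊔ ℓm ⊔ p) where
    constructor mk≼
    field
      point≡ : point φ ≡ point ψ
      hyper⊑ : hyper φ ⊑ hyper ψ

  open _≼_

  extend : ∀ φ L → ¬ ¬ (∃[ ψ ] φ ≼ ψ × All (_∈ Domain ψ) L)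
  extend φ []      = return (φ , mk≼ ≡.refl ⊑-refl , [])
  extend φ (v ∷ L) = extend φ L >>= λ (ψ , φ≼ψ , L⊆) → ¬¬-excluded-middle >>= λ where
    (yes v∈) → return (ψ , φ≼ψ , v∈ ∷ L⊆)
    (no  v∉) →
      let ψ′ = record
            { point        = point ψ
            ; hyper        = hyper ψ ⊞₁ v
            -- If the point entered the enlarged kernel, exchange would place `v` in the old domain.
            ; point∉hyper = λ x∈ → exchange (hyper ψ) x∈ (point∉hyper ψ) v∉
            }
          hyper⊑′ = ⊞₁-base (hyper ψ) v
      in return
        ( ψ′
        , mk≼ (point≡ φ≼ψ) (⊑-trans (hyper⊑ φ≼ψ) hyper⊑′)
        , include (⊞₁-base (hyper ψ′) (point ψ)) (⊞₁-new (hyper ψ) v)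
          ∷ All-⊑ (⊞₁-mono (point ψ) hyper⊑′) L⊆
        )

  System : ℕ → Set _
  System k = Vector Functional k

  -- One vanishing factor suffices for the product of the functionals to vanish on Λᵏ P: it makes a
  -- row of every determinant zero.
  Kills : ∀ {k} → System k → Sub → Set _
  Kills λs P = ∃[ i ] P ⊑ hyper (λs i)

  module Evaluation (k : ℕ) where

    open Exterior k V

    Within : System k → List Carrierᴹ → Set _
    Within λs = All λ v → ∀ i → v ∈ Domain (λs i)

    Matrix : Set c
    Matrix = Vector (Vector K.Carrier k) k

    Entries : System k → Vector Carrierᴹ k → Matrix → Set _
    Entries λs v M = ∀ j i → Value (λs i) (v j) (M j i)

    -- The product of the functionals, sending v₁ ∧ ... ∧ vₖ to det (λᵢ vⱼ). It is a relation
    -- because the functionals are partial; the equation in each constructor allows a change of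
    -- value without recursion.
    data Eval (λs : System k) : Term → K.Carrier → Set (c ⊔ ℓ₁ ⊔ m ⊔ ℓm ⊔ p) where
      eval-⋀ : ∀ {v a} M → Entries λs v M → a K.≈ det M → Eval λs (⋀ v) a
      eval-𝟎 : ∀ {a} → a K.≈ K.0# → Eval λs 𝟎 a
      eval-⊕ : ∀ {x y a b e} → Eval λs x a → Eval λs y b → e K.≈ a K.+ b → Eval λs (x ⊕ y) e
      eval-⊖ : ∀ {x a e} → Eval λs x a → e K.≈ K.- a → Eval λs (⊖ x) e
      eval-⊙ : ∀ b {x a e} → Eval λs x a → e K.≈ b K.* a → Eval λs (b ⊙ x) e

    eval-resp : ∀ {λs x a b} → a K.≈ b → Eval λs x a → Eval λs x b
    eval-resp a≈b (eval-⋀ M es a≈)  = eval-⋀ M es (K.trans (K.sym a≈b) a≈)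
    eval-resp a≈b (eval-𝟎 a≈)       = eval-𝟎 (K.trans (K.sym a≈b) a≈)
    eval-resp a≈b (eval-⊕ ex ey a≈) = eval-⊕ ex ey (K.trans (K.sym a≈b) a≈)
    eval-resp a≈b (eval-⊖ ex a≈)    = eval-⊖ ex (K.trans (K.sym a≈b) a≈)
    eval-resp a≈b (eval-⊙ s ex a≈)  = eval-⊙ s ex (K.trans (K.sym a≈b) a≈)

    eval-unique : ∀ {λs x a b} → Eval λs x a → Eval λs x b → a K.≈ b
    eval-unique {λs} (eval-⋀ M es a≈) (eval-⋀ N fs b≈) = K.trans a≈ (K.trans
      (⋁-cong (λ j i → value-unique (λs i) ≈ᴹ-refl (es j i) (fs j i)) _) (K.sym b≈))
    eval-unique (eval-𝟎 a≈) (eval-𝟎 b≈) = K.trans a≈ (K.sym b≈)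
    eval-unique (eval-⊕ ex ey a≈) (eval-⊕ fx fy b≈) =
      K.trans a≈ (K.trans (K.+-cong (eval-unique ex fx) (eval-unique ey fy)) (K.sym b≈))
    eval-unique (eval-⊖ ex a≈) (eval-⊖ fx b≈) = K.trans a≈ (K.trans (K.-‿cong (eval-unique ex fx)) (K.sym b≈))
    eval-unique (eval-⊙ s ex a≈) (eval-⊙ s fx b≈) = K.trans a≈ (K.trans (K.*-congˡ (eval-unique ex fx)) (K.sym b≈))

    vectors : Term → List Carrierᴹ
    vectors (⋀ v)   = tabulate v
    vectors 𝟎       = []
    vectors (x ⊕ y) = vectors x ++ vectors y
    vectors (⊖ x)   = vectors x
    vectors (a ⊙ x) = vectors x

    entries : ∀ λs {v} → Within λs (tabulate v) → ∃[ M ] Entries λs v M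
    entries λs within = (λ j i → proj₁ (All.tabulate⁻ within j i)) , λ j i → mkValue (proj₂ (All.tabulate⁻ within j i))

    eval-total : ∀ λs x → Within λs (vectors x) → ∃[ a ] Eval λs x a
    eval-total λs (⋀ v) within = let (M , es) = entries λs within in _ , eval-⋀ M es K.refl
    eval-total λs 𝟎 within = _ , eval-𝟎 K.refl
    eval-total λs (x ⊕ y) within =
      let (_ , ex) = eval-total λs x (All.++⁻ˡ (vectors x) within)
          (_ , ey) = eval-total λs y (All.++⁻ʳ (vectors x) within)
      in _ , eval-⊕ ex ey K.refl
    eval-total λs (⊖ x) within = let (_ , ex) = eval-total λs x within in _ , eval-⊖ ex K.refl
    eval-total λs (a ⊙ x) within = let (_ , ex) = eval-total λs x within in _ , eval-⊙ a ex K.refl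

    Agree : System k → Term → Term → Set _
    Agree λs x y = ∃[ a ] Eval λs x a × Eval λs y a

    private
      AgreeNear : Term → Term → Set _
      AgreeNear x y = ∃[ L ] ∀ λs → Within λs L → Agree λs x y

      both : ∀ {x y x′ y′ x″ y″} → AgreeNear x y → AgreeNear x′ y′ →
        (∀ λs → Agree λs x y → Agree λs x′ y′ → Agree λs x″ y″) → AgreeNear x″ y″
      both (L , f) (L′ , g) h = L ++ L′ , λ λs within →
        h λs (f λs (All.++⁻ˡ L within)) (g λs (All.++⁻ʳ L within))

      entries-update : ∀ {n} {λs : System k} {v : Vector Carrierᴹ n} {M : Vector (Vector K.Carrier k) n} j {x : Carrierᴹ} {X : Vector K.Carrier k} →
        (∀ l i → Value (λs i) (v l) (M l i)) → (∀ i → Value (λs i) x (X i)) →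
        ∀ l i → Value (λs i) (updateAt v j (const x) l) (updateAt M j (const X) l i)
      entries-update zero    es ex zero    = ex
      entries-update zero    es ex (suc l) = es (suc l)
      entries-update (suc j) es ex zero    = es zero
      entries-update (suc j) es ex (suc l) = entries-update j (es ∘ suc) ex l

    -- A derivation of an equality mentions finitely many vectors, and it
    -- is enough that all functionals are defined on these.
    sound : ∀ {x y} → x ∼ y → ∃[ L ] ∀ λs → Within λs L → Agree λs x y
    sound {x} ∼-refl = vectors x , λ λs within → let (a , ex) = eval-total λs x within in a , ex , ex
    sound (∼-sym x∼y) = let (L , f) = sound x∼y in L , λ λs within → let (a , ex , ey) = f λs within in a , ey , ex
    sound (∼-trans x∼y y∼z) = both (sound x∼y) (sound y∼z) λ _ (a , ex , ey) (b , ey′ , ez) →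
      a , ex , eval-resp (eval-unique ey′ ey) ez
    sound (⊕-cong x∼y u∼v) = both (sound x∼y) (sound u∼v) λ _ (a , ex , ey) (b , eu , ev) →
      _ , eval-⊕ ex eu K.refl , eval-⊕ ey ev K.refl
    sound (⊖-cong x∼y) = let (L , f) = sound x∼y in L , λ λs within → let (a , ex , ey) = f λs within in
      _ , eval-⊖ ex K.refl , eval-⊖ ey K.refl
    sound (⊙-cong a≈b x∼y) = let (L , f) = sound x∼y in L , λ λs within → let (a , ex , ey) = f λs within in
      _ , eval-⊙ _ ex K.refl , eval-⊙ _ ey (K.*-congʳ a≈b)
    sound (⊕-assoc x y z) = vectors ((x ⊕ y) ⊕ z) , λ λs within → case-⊕ (eval-total λs ((x ⊕ y) ⊕ z) within)
      where
      case-⊕ : ∀ {λs} → ∃[ a ] Eval λs ((x ⊕ y) ⊕ z) a → Agree λs ((x ⊕ y) ⊕ z) (x ⊕ (y ⊕ z))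
      case-⊕ (_ , exyz@(eval-⊕ (eval-⊕ ex ey e≈) ez f≈)) = _ , exyz ,
        eval-⊕ ex (eval-⊕ ey ez K.refl) (K.trans f≈ (K.trans (K.+-congʳ e≈) (K.+-assoc _ _ _)))
    sound (⊕-comm x y) = vectors (x ⊕ y) , λ λs within → case-⊕ (eval-total λs (x ⊕ y) within)
      where
      case-⊕ : ∀ {λs} → ∃[ a ] Eval λs (x ⊕ y) a → Agree λs (x ⊕ y) (y ⊕ x)
      case-⊕ (_ , exy@(eval-⊕ ex ey e≈)) = _ , exy , eval-⊕ ey ex (K.trans e≈ (K.+-comm _ _))
    sound (⊕-identityˡ x) = vectors x , λ λs within → let (a , ex) = eval-total λs x within in
      a , eval-⊕ (eval-𝟎 K.refl) ex (K.sym (K.+-identityˡ a)) , ex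
    sound (⊕-inverseˡ x) = vectors x , λ λs within → let (a , ex) = eval-total λs x within in
      _ , eval-⊕ (eval-⊖ ex K.refl) ex (K.sym (K.-‿inverseˡ a)) , eval-𝟎 K.refl
    sound (⊙-zeroˡ x) = vectors x , λ λs within → let (a , ex) = eval-total λs x within in
      _ , eval-⊙ K.0# ex (K.sym (K.zeroˡ a)) , eval-𝟎 K.refl
    sound (⊙-zeroʳ b) = [] , λ λs within →
      _ , eval-⊙ b (eval-𝟎 K.refl) (K.sym (K.zeroʳ b)) , eval-𝟎 K.refl
    sound (⊙-identityˡ x) = vectors x , λ λs within → let (a , ex) = eval-total λs x within in
      a , eval-⊙ K.1# ex (K.sym (K.*-identityˡ a)) , ex
    sound (⊙-assoc a b x) = vectors x , λ λs within → let (e , ex) = eval-total λs x within in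
      _ , eval-⊙ (a K.* b) ex K.refl , eval-⊙ a (eval-⊙ b ex K.refl) (K.*-assoc a b e)
    sound (⊙-distribʳ x a b) = vectors x , λ λs within → let (e , ex) = eval-total λs x within in
      _ , eval-⊙ (a K.+ b) ex K.refl , eval-⊕ (eval-⊙ a ex K.refl) (eval-⊙ b ex K.refl) (K.distribʳ e a b)
    sound (⊙-distribˡ a x y) = vectors x ++ vectors y , λ λs within →
      let (e , ex) = eval-total λs x (All.++⁻ˡ (vectors x) within)
          (f , ey) = eval-total λs y (All.++⁻ʳ (vectors x) within)
      in _ , eval-⊙ a (eval-⊕ ex ey K.refl) K.refl , eval-⊕ (eval-⊙ a ex K.refl) (eval-⊙ a ey K.refl) (K.distribˡ a e f)
    sound (⋀-cong {v} {w} v≈w) = tabulate v , λ λs within → let (M , es) = entries λs within in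
      _ , eval-⋀ M es K.refl , eval-⋀ M (λ j i → value-resp (λs i) (v≈w j) (es j i)) K.refl
    sound (⋀-+ v j x y) = x ∷ y ∷ tabulate v , λ { λs (x∈ ∷ y∈ ∷ within) →
      let (M , es) = entries λs within
          X i      = proj₁ (x∈ i)
          Y i      = proj₁ (y∈ i)
          ex       = λ i → mkValue {λs i} (proj₂ (x∈ i))
          ey       = λ i → mkValue {λs i} (proj₂ (y∈ i))
      in _ , eval-⋀ (updateAt M j (const λ i → X i K.+ Y i))
               (entries-update j es λ i → value-+ (λs i) (ex i) (ey i)) K.refl
           , eval-⊕ (eval-⋀ _ (entries-update j es ex) K.refl) (eval-⋀ _ (entries-update j es ey) K.refl)
               (⋁-+ M j X Y _) }
    sound (⋀-* v j a x) = x ∷ tabulate v , λ { λs (x∈ ∷ within) →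
      let (M , es) = entries λs within
          X i      = proj₁ (x∈ i)
          ex       = λ i → mkValue {λs i} (proj₂ (x∈ i))
      in _ , eval-⋀ (updateAt M j (const λ i → a K.* X i))
               (entries-update j es λ i → value-* (λs i) a (ex i)) K.refl
           , eval-⊙ a (eval-⋀ _ (entries-update j es ex) K.refl) (⋁-* M j a X _) }
    sound (⋀-alt v {i} {j} i≢j vᵢ≈vⱼ) = tabulate v , λ λs within → let (M , es) = entries λs within in
      _ , eval-⋀ M es K.refl
        , eval-𝟎 (⋁-alternating M i≢j (λ l → value-unique (λs l) vᵢ≈vⱼ (es i l) (es j l)) _)

-- Independence of wedges modulo sums of exterior powers.

module Wedges {c ℓ₁ ℓ₂} (F : HeytingField c ℓ₁ ℓ₂) {m ℓm} (V : LinearAlgebra.VectorSpace F m ℓm) (p : Level) where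

  open LinearAlgebra F using (span; span-⊆; span-resp; span-0; span-+; span-*; module Exterior)
  open Bases F V p
  open Forms F V p
  open Functional
  private module K = Scalars F
  open Grassmann K.K using (det; det-zero-row; det-minor)
  open LeftModule V using (Carrierᴹ; ≈ᴹ-refl)
  open Exterior using (⋀; Λ)

  module Λ (k : ℕ) = Bases F (Λ k V) (c ⊔ m ⊔ ℓm ⊔ p)

  Tuple : ℕ → Set m
  Tuple = Vector Carrierᴹ

  _⊆_ : ∀ {k} → Tuple k → Sub → Set _
  J ⊆ P = ∀ j → J j ∈ P

  ΣΛ : ∀ k {n} → Vector Sub n → Λ.Sub k
  ΣΛ k Ps = span λ x → ∃[ J ] ∃[ a ] (J ⊆ Ps a) × x ≡ ⋀ J

  _≼*_ : ∀ {k} → System k → System k → Set _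
  λs ≼* μs = ∀ i → λs i ≼ μs i

  Entries : ∀ {k} → System k → Tuple k → Vector (Vector K.Carrier k) k → Set _
  Entries {k} = Evaluation.Entries k

  -- The extensions are needed because the vectors on which the functionals
  -- have to be defined are only known once a derivation is given.
  Takes : ∀ {k} → K.Carrier → System k → Tuple k → Set _
  Takes x λs J = ∀ μs → λs ≼* μs → ∀ M → Entries μs J M → det M K.≈ x

  -- A triangular dual family: each tuple has a form with value 1 on it and 0 on the later tuples
  -- and on Λᵏ of every subspace in `Ps`.
  data Detected {n} (Ps : Vector Sub n) {k} : List (Tuple k) → Set (Level.suc (c ⊔ m ⊔ ℓm ⊔ p) ⊔ ℓ₁) where
    []     : Detected Ps []
    detect : ∀ {J Js} λs → (∀ a → Kills λs (Ps a)) → Takes K.1# λs J → All (Takes K.0# λs) Js →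
      Detected Ps Js → Detected Ps (J ∷ Js)

  module _ {k : ℕ} where

    private module E = Λ k
    open Evaluation k hiding (Entries)

    ΣΛ-sound : ∀ {n} {Ps : Vector Sub n} {x} → x E.∈ ΣΛ k Ps →
      ∃[ L ] ∀ λs → Within λs L → (∀ a → Kills λs (Ps a)) → Eval λs x K.0#
    ΣΛ-sound (span-⊆ (J , a , J⊆ , ≡.refl)) = tabulate J , λ λs within kills →
      let (M , es)   = entries λs within
          (i , P⊑) = kills a
      in eval-⋀ M es (K.sym (det-zero-row M i λ j →
           value-unique (λs i) ≈ᴹ-refl (es j i) (value-hyper (λs i) (include P⊑ (J⊆ j)))))
    ΣΛ-sound (span-resp x∼y x∈) =
      let (L , f) = sound x∼y ; (L′ , g) = ΣΛ-sound x∈ in L ++ L′ , λ λs within kills →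
      let (a , ex , ey) = f λs (All.++⁻ˡ L within) in
      eval-resp (eval-unique ex (g λs (All.++⁻ʳ L within) kills)) ey
    ΣΛ-sound span-0 = [] , λ λs within kills → eval-𝟎 K.refl
    ΣΛ-sound (span-+ x∈ y∈) =
      let (L , f) = ΣΛ-sound x∈ ; (L′ , g) = ΣΛ-sound y∈ in L ++ L′ , λ λs within kills →
      eval-⊕ (f λs (All.++⁻ˡ L within) kills) (g λs (All.++⁻ʳ L within) kills) (K.sym (K.+-identityˡ K.0#))
    ΣΛ-sound (span-* a x∈) =
      let (L , f) = ΣΛ-sound x∈ in L , λ λs within kills →
      eval-⊙ a (f λs within kills) (K.sym (K.zeroʳ a))

    ⊞-sound : ∀ {n} {Ps : Vector Sub n} Js {x} → x E.∈ ΣΛ k Ps E.⊞ map ⋀ Js →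
      ∃[ L ] ∀ λs → Within λs L → (∀ a → Kills λs (Ps a)) → All (Takes K.0# λs) Js → Eval λs x K.0#
    ⊞-sound [] x∈ = let (L , f) = ΣΛ-sound x∈ in L , λ λs within kills _ → f λs within kills
    ⊞-sound (J ∷ Js) (a , d , d∈ , x∼) =
      let (L , f) = sound x∼ ; (L′ , g) = ⊞-sound Js d∈ in tabulate J ++ L ++ L′ ,
      λ { λs within kills (zero-J ∷ zero-Js) →
      let (M , es)      = entries λs (All.++⁻ˡ (tabulate J) within)
          within′       = All.++⁻ʳ (tabulate J) within
          (e , ex , ey) = f λs (All.++⁻ˡ L within′)
          ed            = g λs (All.++⁻ʳ L within′) kills zero-Js
          eJ            = eval-⋀ M es (K.sym (zero-J λs (λ _ → mk≼ ≡.refl ⊑-refl) M es))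
      in eval-resp (eval-unique ey (eval-⊕ (eval-⊙ a eJ K.refl) ed
           (K.sym (K.trans (K.+-identityʳ _) (K.zeroʳ a))))) ex }

    extend-system : ∀ (λs : System k) L → ¬ ¬ (∃[ μs ] λs ≼* μs × Within μs L)
    extend-system λs L = ¬¬-Fin (λ i → extend (λs i) L) >>= λ f → return
      ( (λ i → proj₁ (f i))
      , (λ i → proj₁ (proj₂ (f i)))
      , All.tabulate λ v∈L i → All.lookup (proj₂ (proj₂ (f i))) v∈L
      )

    ≼*-trans : ∀ {λs μs νs : System k} → λs ≼* μs → μs ≼* νs → λs ≼* νs
    ≼*-trans λ≼μ μ≼ν i = mk≼ (≡.trans (_≼_.point≡ (λ≼μ i)) (_≼_.point≡ (μ≼ν i)))
      (⊑-trans (_≼_.hyper⊑ (λ≼μ i)) (_≼_.hyper⊑ (μ≼ν i)))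

    takes-extend : ∀ {x} {λs μs : System k} → λs ≼* μs → ∀ {J} → Takes x λs J → Takes x μs J
    takes-extend λ≼μ takes νs μ≼ν = takes νs (≼*-trans λ≼μ μ≼ν)

    kills-extend : ∀ {λs μs : System k} {P} → λs ≼* μs → Kills λs P → Kills μs P
    kills-extend λ≼μ (i , P⊑) = i , ⊑-trans P⊑ (_≼_.hyper⊑ (λ≼μ i))

    detected⇒independent : ∀ {n} {Ps : Vector Sub n} {Js} → Detected Ps Js →
      E.Independent (ΣΛ k Ps) (map ⋀ Js)
    detected⇒independent [] = E.[]
    detected⇒independent (detect {J} {Js} λs kills one-J zero-Js detected) =
      -- The derivation of the supposed dependence comes first; only then are the functionals
      -- extended to the vectors it mentions, and evaluation gives 1 = 0.
      (λ J∈ → let (L , f) = ⊞-sound Js J∈ in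
        extend-system λs (tabulate J ++ L) λ (μs , λ≼μ , within) →
        let (M , es) = entries μs (All.++⁻ˡ (tabulate J) within)
            e₀       = f μs (All.++⁻ʳ (tabulate J) within) (λ a → kills-extend λ≼μ (kills a))
                         (All.map (takes-extend λ≼μ) zero-Js)
            e₁       = eval-⋀ M es (K.sym (one-J μs λ≼μ M es))
        in K.1≉0 (eval-unique e₁ e₀))
      E.∷ detected⇒independent detected

  module _ {k} (φ : Functional) (λs : System k) where

    private
      μs : System (suc k)
      μs = φ Vector.∷ λs

    takes-0-outside : ∀ {J} → J ⊆ hyper φ → Takes K.0# μs J
    takes-0-outside J⊆ νs μ≼ν M es = det-zero-row M zero λ j →
      value-unique (νs zero) ≈ᴹ-refl (es j zero) (value-hyper (νs zero) (include (_≼_.hyper⊑ (μ≼ν zero)) (J⊆ j)))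

    takes-cons : ∀ {x J} → J ⊆ hyper φ → Takes x λs J → Takes x μs (point φ Vector.∷ J)
    takes-cons J⊆ takes νs μ≼ν M es = K.trans
      (det-minor M
        (value-unique (νs zero) ≈ᴹ-refl (es zero zero)
          (≡.subst (λ v → Value (νs zero) v K.1#) (≡.sym (_≼_.point≡ (μ≼ν zero))) (value-point (νs zero))))
        (λ j → value-unique (νs zero) ≈ᴹ-refl (es (suc j) zero)
          (value-hyper (νs zero) (include (_≼_.hyper⊑ (μ≼ν zero)) (J⊆ j)))))
      (takes (νs ∘ suc) (μ≼ν ∘ suc) _ λ j i → es (suc j) (suc i))

  -- Tuples containing the point are expanded along `φ`; tuples inside its kernel take the value 0.
  -- Each subspace is killed by `φ` or contained in one that the remaining factors kill, so
  -- different factors may vanish on different subspaces.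
  detected-cons : ∀ {n n′ k} {Ps : Vector Sub n} {Ps′ : Vector Sub n′} (φ : Functional) {Js : List (Tuple k)} {Ks} →
    (∀ a → Ps a ⊑ hyper φ ⊎ ∃[ b ] Ps a ⊑ Ps′ b) →
    All (_⊆ hyper φ) Js → All (_⊆ hyper φ) Ks → Detected Ps′ Js → Detected Ps Ks →
    Detected Ps (map (point φ Vector.∷_) Js ++ Ks)
  detected-cons φ cover [] Ks⊆ [] Ks-detected = Ks-detected
  detected-cons {Ps = Ps} {Ps′} φ cover (J⊆ ∷ Js⊆) Ks⊆ (detect λs kills one-J zero-Js Js-detected) Ks-detected =
    detect (φ Vector.∷ λs) (λ a → kill a (cover a)) (takes-cons φ λs J⊆ one-J)
      (All.++⁺ (All.map⁺ (All.map (λ (K⊆ , zero-K) → takes-cons φ λs K⊆ zero-K) (All.zip (Js⊆ , zero-Js))))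
        (All.map (takes-0-outside φ λs) Ks⊆))
      (detected-cons φ cover Js⊆ Ks⊆ Js-detected Ks-detected)
    where
    kill : ∀ a → Ps a ⊑ hyper φ ⊎ ∃[ b ] Ps a ⊑ Ps′ b → Kills (φ Vector.∷ λs) (Ps a)
    kill a (inj₁ P⊑)       = zero , P⊑
    kill a (inj₂ (b , P⊑)) = let (i , P′⊑) = kills b in suc i , ⊑-trans P⊑ P′⊑

  combinations : ∀ k → List Carrierᴹ → List (Tuple k)
  combinations zero    L       = Vector.[] ∷ []
  combinations (suc k) []      = []
  combinations (suc k) (v ∷ L) = map (v Vector.∷_) (combinations k L) ++ combinations (suc k) L

  -- The combinations of elements of w ++ u that are not contained in u.
  combinationsᶜ : ∀ k (w u : List Carrierᴹ) → List (Tuple (suc k))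
  combinationsᶜ k []      u = []
  combinationsᶜ k (v ∷ w) u = map (v Vector.∷_) (combinations k (w ++ u)) ++ combinationsᶜ k w u

  private
    cons-⊆ : ∀ P {k v} {Js : List (Tuple k)} → v ∈ P → All (_⊆ P) Js → All (_⊆ P) (map (v Vector.∷_) Js)
    cons-⊆ P v∈P Js⊆ = All.map⁺ (All.map (λ { J⊆ zero → v∈P ; J⊆ (suc j) → J⊆ j }) Js⊆)

  combinations-⊆ : ∀ P k {L} → All (_∈ P) L → All (_⊆ P) (combinations k L)
  combinations-⊆ P zero    L⊆          = (λ ()) ∷ []
  combinations-⊆ P (suc k) []          = []
  combinations-⊆ P (suc k) (v∈ ∷ L⊆) =
    All.++⁺ (cons-⊆ P v∈ (combinations-⊆ P k L⊆)) (combinations-⊆ P (suc k) L⊆)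

  combinationsᶜ-⊆ : ∀ P k {w u} → All (_∈ P) w → All (_∈ P) u → All (_⊆ P) (combinationsᶜ k w u)
  combinationsᶜ-⊆ P k []          u⊆ = []
  combinationsᶜ-⊆ P k (v∈ ∷ w⊆) u⊆ =
    All.++⁺ (cons-⊆ P v∈ (combinations-⊆ P k (All.++⁺ w⊆ u⊆))) (combinationsᶜ-⊆ P k w⊆ u⊆)

  length-combinations : ∀ k L → length (combinations k L) ≡ length L C k
  length-combinations zero    []      = ≡.refl
  length-combinations zero    (v ∷ L) = ≡.refl
  length-combinations (suc k) []      = ≡.refl
  length-combinations (suc k) (v ∷ L) = begin
    length (map (v Vector.∷_) (combinations k L) ++ combinations (suc k) L)
      ≡⟨ length-++ (map (v Vector.∷_) (combinations k L)) ⟩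
    length (map (v Vector.∷_) (combinations k L)) ℕ.+ length (combinations (suc k) L)
      ≡⟨ ≡.cong₂ ℕ._+_ (≡.trans (length-map _ (combinations k L)) (length-combinations k L))
           (length-combinations (suc k) L) ⟩
    length L C k ℕ.+ length L C suc k
      ≡⟨ nCk+nC[k+1]≡[n+1]C[k+1] (length L) k ⟩
    suc (length L) C suc k
      ∎
    where open ≡.≡-Reasoning

  length-combinationsᶜ : ∀ k w u →
    length (combinationsᶜ k w u) ℕ.+ length u C suc k ≡ (length w ℕ.+ length u) C suc k
  length-combinationsᶜ k []      u = ≡.refl
  length-combinationsᶜ k (v ∷ w) u = begin
    length (map (v Vector.∷_) (combinations k (w ++ u)) ++ combinationsᶜ k w u) ℕ.+ length u C suc k
      ≡⟨ ≡.cong (ℕ._+ length u C suc k) (length-++ (map (v Vector.∷_) (combinations k (w ++ u)))) ⟩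
    length (map (v Vector.∷_) (combinations k (w ++ u))) ℕ.+ length (combinationsᶜ k w u) ℕ.+ length u C suc k
      ≡⟨ ℕ.+-assoc (length (map (v Vector.∷_) (combinations k (w ++ u)))) _ _ ⟩
    length (map (v Vector.∷_) (combinations k (w ++ u))) ℕ.+ (length (combinationsᶜ k w u) ℕ.+ length u C suc k)
      ≡⟨ ≡.cong₂ ℕ._+_ (≡.trans (length-map _ (combinations k (w ++ u))) (≡.trans
           (length-combinations k (w ++ u)) (≡.cong (_C k) (length-++ w)))) (length-combinationsᶜ k w u) ⟩
    (length w ℕ.+ length u) C k ℕ.+ (length w ℕ.+ length u) C suc k
      ≡⟨ nCk+nC[k+1]≡[n+1]C[k+1] (length w ℕ.+ length u) k ⟩
    suc (length w ℕ.+ length u) C suc k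
      ∎
    where open ≡.≡-Reasoning

  -- A product without factors kills no subspace, hence the empty vector of subspaces.
  detected-combinations-0 : ∀ L → Detected Vector.[] (combinations 0 L)
  detected-combinations-0 L = detect (λ ()) (λ ()) (λ _ _ _ _ → K.refl) [] []

  detected-combinations : ∀ {Q L} k → Independent Q L → Detected (Q Vector.∷ Vector.[]) (combinations (suc k) L)
  detected-combinations k [] = []
  -- In degree one the single factor is the new functional, so it has to vanish on `Q` itself.
  detected-combinations {Q} {v ∷ L} zero (v∉ ∷ indep) =
    detected-cons (record { point = v ; hyper = Q ⊞ L ; point∉hyper = v∉ })
      (λ { zero → inj₁ (⊞-base Q L) }) (combinations-⊆ (Q ⊞ L) 0 (⊞-new Q L)) (combinations-⊆ (Q ⊞ L) 1 (⊞-new Q L))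
      (detected-combinations-0 L) (detected-combinations 0 indep)
  detected-combinations {Q} {v ∷ L} (suc k) (v∉ ∷ indep) =
    detected-cons (record { point = v ; hyper = Q ⊞ L ; point∉hyper = v∉ })
      (λ { zero → inj₁ (⊞-base Q L) })
      (combinations-⊆ (Q ⊞ L) (suc k) (⊞-new Q L)) (combinations-⊆ (Q ⊞ L) (suc (suc k)) (⊞-new Q L))
      (detected-combinations k indep) (detected-combinations (suc k) indep)

  _,₂_ : Sub → Sub → Vector Sub 2
  P ,₂ Q = P Vector.∷ Q Vector.∷ Vector.[]

  -- The first factor of each form is a functional vanishing on P, and the
  -- other ones vanish on Q.
  detected-combinationsᶜ : ∀ {P Q} k w {u} → Independent P w → All (_∈ P) u → Independent Q (w ++ u) →
    Detected (P ,₂ Q) (combinationsᶜ (suc k) w u)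
  detected-combinationsᶜ k [] [] u⊆P indepQ = []
  detected-combinationsᶜ {P} {Q} k (v ∷ w) {u} (v∉ ∷ indepP) u⊆P (_ ∷ indepQ) =
    detected-cons (record { point = v ; hyper = P ⊞ w ; point∉hyper = v∉ })
      (λ { zero → inj₁ (⊞-base P w) ; (suc zero) → inj₂ (zero , ⊑-refl) })
      (combinations-⊆ (P ⊞ w) (suc k) (All.++⁺ (⊞-new P w) u⊆P⊞w)) (combinationsᶜ-⊆ (P ⊞ w) (suc k) (⊞-new P w) u⊆P⊞w)
      (detected-combinations k indepQ) (detected-combinationsᶜ k w indepP u⊆P indepQ)
    where
    u⊆P⊞w : All (_∈ P ⊞ w) u
    u⊆P⊞w = All-⊑ (⊞-base P w) u⊆P

  wedges-independent : ∀ {P Q} k w {u} → Independent P w → All (_∈ P) u → Independent Q (w ++ u) →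
    Λ.Independent (suc (suc k)) (ΣΛ (suc (suc k)) (P ,₂ Q)) (map ⋀ (combinationsᶜ (suc k) w u))
  wedges-independent k w indepP u⊆P indepQ = detected⇒independent (detected-combinationsᶜ k w indepP u⊆P indepQ)

-- Binomial estimates

open import Data.Nat.Base using (_+_; _*_; _^_; _∸_; _≤_; _<_)
open import Data.Rational.Base using (_-_; _/_; ∣_∣)

module Binomials where

  open import Data.Nat.Properties
  open import Algebra.Properties.CommutativeSemigroup *-commutativeSemigroup using (x∙yz≈y∙xz)
  open import Relation.Binary.PropositionalEquality using (refl; sym; trans; cong; cong₂; module ≡-Reasoning)
  open ℕ-Solver using (solve; _:=_; _:+_; _:*_; con)

  C-absorption : ∀ n k → suc k * (suc n C suc k) ≡ suc n * (n C k)
  C-absorption zero    zero    = refl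
  C-absorption zero    (suc k) = *-zeroʳ k
  C-absorption (suc n) zero    = begin
    1 * (suc (suc n) C 1)                      ≡⟨ *-identityˡ _ ⟩
    suc (suc n) C 1                            ≡⟨ nCk+nC[k+1]≡[n+1]C[k+1] (suc n) 0 ⟨
    1 + suc n C 1                              ≡⟨ cong (1 +_) (trans (sym (*-identityˡ _)) (C-absorption n 0)) ⟩
    1 + suc n * 1                              ∎
    where open ≡-Reasoning
  C-absorption (suc n) (suc k) = begin
    suc (suc k) * (suc (suc n) C suc (suc k))
      ≡⟨ cong (suc (suc k) *_) (nCk+nC[k+1]≡[n+1]C[k+1] (suc n) (suc k)) ⟨
    suc (suc k) * (X + suc n C suc (suc k))
      ≡⟨ *-distribˡ-+ (suc (suc k)) X _ ⟩
    (X + suc k * X) + suc (suc k) * (suc n C suc (suc k))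
      ≡⟨ cong₂ (λ a b → (X + a) + b) (C-absorption n k) (C-absorption n (suc k)) ⟩
    (X + suc n * (n C k)) + suc n * (n C suc k)
      ≡⟨ +-assoc X _ _ ⟩
    X + (suc n * (n C k) + suc n * (n C suc k))
      ≡⟨ cong (X +_) (*-distribˡ-+ (suc n) (n C k) _) ⟨
    X + suc n * (n C k + n C suc k)
      ≡⟨ cong (λ a → X + suc n * a) (nCk+nC[k+1]≡[n+1]C[k+1] n k) ⟩
    suc (suc n) * X
      ∎
    where
    open ≡-Reasoning
    X = suc n C suc k

  C-monoˡ : ∀ {m n} k → m ≤ n → m C k ≤ n C k
  C-monoˡ {n = n} zero    m≤n             = ≤-refl
  C-monoˡ {n = n} (suc k) z≤n             = z≤n
  C-monoˡ {suc m} {suc n} (suc k) (s≤s m≤n) = begin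
    suc m C suc k          ≡⟨ nCk+nC[k+1]≡[n+1]C[k+1] m k ⟨
    m C k + m C suc k      ≤⟨ +-mono-≤ (C-monoˡ k m≤n) (C-monoˡ (suc k) m≤n) ⟩
    n C k + n C suc k      ≡⟨ nCk+nC[k+1]≡[n+1]C[k+1] n k ⟩
    suc n C suc k          ∎
    where open ≤-Reasoning

  C-ratio : ∀ {h r} k → h ≤ r → r * (h C suc k) ≤ h * (r C suc k)
  C-ratio {zero}  {r}     k z≤n       = ≤-reflexive (*-zeroʳ r)
  C-ratio {suc h} {suc r} k (s≤s h≤r) = *-cancelˡ-≤ (suc k) (begin
    suc k * (suc r * (suc h C suc k))  ≡⟨ x∙yz≈y∙xz (suc k) (suc r) _ ⟩
    suc r * (suc k * (suc h C suc k))  ≡⟨ cong (suc r *_) (C-absorption h k) ⟩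
    suc r * (suc h * (h C k))          ≤⟨ *-monoʳ-≤ (suc r) (*-monoʳ-≤ (suc h) (C-monoˡ k h≤r)) ⟩
    suc r * (suc h * (r C k))          ≡⟨ x∙yz≈y∙xz (suc r) (suc h) _ ⟩
    suc h * (suc r * (r C k))          ≡⟨ cong (suc h *_) (C-absorption r k) ⟨
    suc h * (suc k * (suc r C suc k))  ≡⟨ x∙yz≈y∙xz (suc h) (suc k) _ ⟩
    suc k * (suc h * (suc r C suc k))  ∎)
    where
    open ≤-Reasoning
  -- C(h,k) / C(r,k) is the product of (h - i) / (r - i) over i < k, each at most h / r. Two factors
  -- give the square, which is why the degree is at least two.
  C-ratio² : ∀ {h r} k → h ≤ r → r * r * (h C suc (suc k)) ≤ h * h * (r C suc (suc k))
  C-ratio² {zero}  {r}     k z≤n       = ≤-reflexive (*-zeroʳ (r * r))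
  C-ratio² {suc h} {suc r} k (s≤s h≤r) = *-cancelˡ-≤ (suc (suc k)) (begin
    suc (suc k) * (suc r * suc r * (suc h C suc (suc k)))
      ≡⟨ pull (suc (suc k)) (suc r) (suc r) (suc h C suc (suc k)) ⟩
    suc r * (suc r * (suc (suc k) * (suc h C suc (suc k))))
      ≡⟨ cong (λ a → suc r * (suc r * a)) (C-absorption h (suc k)) ⟩
    suc r * (suc r * (suc h * (h C suc k)))
      ≤⟨ *-monoʳ-≤ (suc r) (≤-trans (≤-reflexive (x∙yz≈y∙xz (suc r) (suc h) _)) (*-monoʳ-≤ (suc h) step)) ⟩
    suc r * (suc h * (suc h * (r C suc k)))
      ≡⟨ rotate (suc r) (suc h) _ ⟩
    suc h * (suc h * (suc r * (r C suc k)))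
      ≡⟨ cong (λ a → suc h * (suc h * a)) (C-absorption r (suc k)) ⟨
    suc h * (suc h * (suc (suc k) * (suc r C suc (suc k))))
      ≡⟨ pull (suc (suc k)) (suc h) (suc h) (suc r C suc (suc k)) ⟨
    suc (suc k) * (suc h * suc h * (suc r C suc (suc k)))
      ∎)
    where
    open ≤-Reasoning
    rotate : ∀ a b c → a * (b * (b * c)) ≡ b * (b * (a * c))
    rotate = solve 3 (λ a b c → a :* (b :* (b :* c)) := b :* (b :* (a :* c))) refl

    pull : ∀ a b c d → a * (b * c * d) ≡ b * (c * (a * d))
    pull = solve 4 (λ a b c d → a :* (b :* c :* d) := b :* (c :* (a :* d))) refl

    step : suc r * (h C suc k) ≤ suc h * (r C suc k)
    step = +-mono-≤ (C-monoˡ (suc k) h≤r) (C-ratio k h≤r)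

  -- k! C(k+n,k) is the product (n+1) ... (n+k).
  C-lower : ∀ n k → n ^ k ≤ k ! * ((k + n) C k)
  C-lower n zero    = ≤-refl
  C-lower n (suc k) = begin
    n * n ^ k                                     ≤⟨ *-mono-≤ (m≤n+m n (suc k)) (C-lower n k) ⟩
    suc (k + n) * (k ! * ((k + n) C k))           ≡⟨ x∙yz≈y∙xz (suc (k + n)) (k !) _ ⟩
    k ! * (suc (k + n) * ((k + n) C k))           ≡⟨ cong (k ! *_) (C-absorption (k + n) k) ⟨
    k ! * (suc k * (suc (k + n) C suc k))         ≡⟨ assoc (k !) (suc k) _ ⟩
    suc k * k ! * (suc (k + n) C suc k)           ∎
    where
    open ≤-Reasoning
    assoc : ∀ a b c → a * (b * c) ≡ b * a * c
    assoc = solve 3 (λ a b c → a :* (b :* c) := b :* a :* c) refl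

  C-upper : ∀ r k → r C k ≤ r ^ k
  C-upper r       zero    = ≤-refl
  C-upper zero    (suc k) = z≤n
  C-upper (suc r) (suc k) = begin
    suc r C suc k            ≤⟨ m≤m+n _ _ ⟩
    suc k * (suc r C suc k)  ≡⟨ C-absorption r k ⟩
    suc r * (r C k)          ≤⟨ *-monoʳ-≤ (suc r) (C-upper r k) ⟩
    suc r * r ^ k            ≤⟨ *-monoʳ-≤ (suc r) (^-monoˡ-≤ k (n≤1+n r)) ⟩
    suc r * suc r ^ k        ∎
    where open ≤-Reasoning

  ^-distribʳ-* : ∀ a b k → (a * b) ^ k ≡ a ^ k * b ^ k
  ^-distribʳ-* a b zero    = refl
  ^-distribʳ-* a b (suc k) = trans (cong (a * b *_) (^-distribʳ-* a b k)) (interchange a b (a ^ k) (b ^ k))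
    where
    interchange : ∀ a b c d → a * b * (c * d) ≡ a * c * (b * d)
    interchange = solve 4 (λ a b c d → a :* b :* (c :* d) := a :* c :* (b :* d)) refl

  -- Once m ≥ k + r/2, C(m,k) is at least (r/2)^k / k!.
  growth : ℕ → ℕ
  growth k = 2 ^ k * k !

  C-growth : ∀ {r m} k → 2 * k + r ≤ 2 * m → r ^ k ≤ growth k * (m C k)
  C-growth {r} {m} k 2k+r≤2m = begin
    r ^ k                               ≤⟨ ^-monoˡ-≤ k r≤2n ⟩
    (2 * n) ^ k                         ≡⟨ ^-distribʳ-* 2 n k ⟩
    2 ^ k * n ^ k                       ≤⟨ *-monoʳ-≤ (2 ^ k) (C-lower n k) ⟩
    2 ^ k * (k ! * ((k + n) C k))       ≡⟨ *-assoc (2 ^ k) (k !) _ ⟨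
    growth k * ((k + n) C k)            ≡⟨ cong (λ m → growth k * (m C k)) (m+[n∸m]≡n k≤m) ⟩
    growth k * (m C k)                  ∎
    where
    open ≤-Reasoning
    n = m ∸ k

    k≤m : k ≤ m
    k≤m = *-cancelˡ-≤ 2 (m+n≤o⇒m≤o (2 * k) 2k+r≤2m)

    r≤2n : r ≤ 2 * n
    r≤2n = +-cancelˡ-≤ (2 * k) r (2 * n) (≤-trans 2k+r≤2m (≤-reflexive
      (trans (cong (2 *_) (sym (m+[n∸m]≡n k≤m))) (*-distribˡ-+ 2 k n))))

  -- The gain h q of a step that adds q dimensions to a sum meeting an
  -- r-dimensional subspace in dimension h.
  step-gain : ∀ k {r h q y} → q + h ≡ r → y + (h C suc (suc k)) ≡ r C suc (suc k) →
    (r C suc (suc k)) * (h * q + r * q) ≤ r * r * y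
  -- As r² - h² = h q + r q, the claim is r² y ≥ (r² - h²) B, here with h² B added to both sides.
  step-gain k {r} {h} {q} {y} refl y+Bₕ≡B = +-cancelʳ-≤ (h * h * B) _ _ (begin
    B * (h * q + (q + h) * q) + h * h * B      ≡⟨ square B h q ⟩
    (q + h) * (q + h) * B                      ≡⟨ cong ((q + h) * (q + h) *_) y+Bₕ≡B ⟨
    (q + h) * (q + h) * (y + Bₕ)               ≡⟨ *-distribˡ-+ ((q + h) * (q + h)) y Bₕ ⟩
    (q + h) * (q + h) * y + (q + h) * (q + h) * Bₕ
      ≤⟨ +-monoʳ-≤ ((q + h) * (q + h) * y) (C-ratio² k (m≤n+m h q)) ⟩
    (q + h) * (q + h) * y + h * h * B          ∎)
    where
    open ≤-Reasoning
    B  = (q + h) C suc (suc k)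
    Bₕ = h C suc (suc k)

    square : ∀ B h q → B * (h * q + (q + h) * q) + h * h * B ≡ (q + h) * (q + h) * B
    square = solve 3 (λ B h q → B :* (h :* q :+ (q :+ h) :* q) :+ h :* h :* B := (q :+ h) :* (q :+ h) :* B) refl

  complement-half : ∀ {r h q} → q + h ≡ r → 2 * h ≤ r → r ≤ 2 * q
  complement-half {h = h} {q} refl 2h≤r = +-cancelʳ-≤ (2 * h) _ _ (begin
    q + h + 2 * h        ≤⟨ +-monoʳ-≤ (q + h) 2h≤r ⟩
    q + h + (q + h)      ≡⟨ solve 2 (λ q h → q :+ h :+ (q :+ h) := con 2 :* q :+ con 2 :* h) refl q h ⟩
    2 * q + 2 * h        ∎)
    where open ≤-Reasoning

  complement-half-< : ∀ {r h q} → q + h ≡ r → r < 2 * h → 2 * q < r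
  complement-half-< {h = h} {q} refl r<2h = +-cancelʳ-< (2 * h) _ _ (begin-strict
    2 * q + 2 * h        ≡⟨ solve 2 (λ q h → con 2 :* q :+ con 2 :* h := q :+ h :+ (q :+ h)) refl q h ⟩
    q + h + (q + h)      <⟨ +-monoʳ-< (q + h) r<2h ⟩
    q + h + 2 * h        ∎)
    where open ≤-Reasoning

  half-gain : ∀ {r q} h → r ≤ 2 * q → r * h ≤ 2 * (h * q)
  half-gain {r} {q} h r≤2q = begin
    r * h        ≤⟨ *-monoˡ-≤ h r≤2q ⟩
    2 * q * h    ≡⟨ solve 2 (λ q h → con 2 :* q :* h := con 2 :* (h :* q)) refl q h ⟩
    2 * (h * q)  ∎
    where open ≤-Reasoning

  average : ∀ {r n X ω} M .{{_ : NonZero r}} → r * n ≤ r * X + 2 * ω → ω ≤ M * r → n ≤ X + 2 * M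
  average {r} {n} {X} {ω} M rn≤ ω≤ = *-cancelˡ-≤ r (begin
    r * n                ≤⟨ rn≤ ⟩
    r * X + 2 * ω        ≤⟨ +-monoʳ-≤ (r * X) (*-monoʳ-≤ 2 ω≤) ⟩
    r * X + 2 * (M * r)  ≡⟨ solve 3 (λ r X M → r :* X :+ con 2 :* (M :* r) := r :* (X :+ con 2 :* M)) refl r X M ⟩
    r * (X + 2 * M)      ∎)
    where open ≤-Reasoning

  small-factor : ∀ {r h q} M .{{_ : NonZero r}} → r ≤ 2 * q → h * q ≤ M * r → h ≤ 2 * M
  small-factor {r} {h} {q} M r≤2q = average {X = 0} M
    (≤-trans (half-gain {q = q} h r≤2q) (m≤n+m (2 * (h * q)) (r * 0)))

  -- When the gain is compared with low excess, the terms B r 𝔒 cancel. The error r N₀ r^k is at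
  -- most N₀ T B r, so B cancels as well.
  gain-bound : ∀ {B r n N ω 𝔒 𝔈} N₀ k T .{{_ : NonZero r}} →
    B * (ω + r * n) ≤ r * r * N → 𝔒 ≤ n → N ≤ 𝔈 → r * 𝔈 ≤ B * 𝔒 + N₀ * r ^ k → r ^ k ≤ T * B →
    ω ≤ N₀ * T * r
  gain-bound {B} {r} {n} {N} {ω} {𝔒} {𝔈} N₀ k T gain 𝔒≤n N≤𝔈 low r^k≤TB =
    *-cancelˡ-≤ B {{B≢0}} (+-cancelʳ-≤ (B * (r * 𝔒)) _ _ (begin
      B * ω + B * (r * 𝔒)              ≡⟨ *-distribˡ-+ B ω (r * 𝔒) ⟨
      B * (ω + r * 𝔒)                  ≤⟨ *-monoʳ-≤ B (+-monoʳ-≤ ω (*-monoʳ-≤ r 𝔒≤n)) ⟩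
      B * (ω + r * n)                   ≤⟨ gain ⟩
      r * r * N                         ≤⟨ *-monoʳ-≤ (r * r) N≤𝔈 ⟩
      r * r * 𝔈                        ≡⟨ *-assoc r r 𝔈 ⟩
      r * (r * 𝔈)                      ≤⟨ *-monoʳ-≤ r low ⟩
      r * (B * 𝔒 + N₀ * r ^ k)         ≤⟨ *-monoʳ-≤ r (+-monoʳ-≤ (B * 𝔒) (*-monoʳ-≤ N₀ r^k≤TB)) ⟩
      r * (B * 𝔒 + N₀ * (T * B))       ≡⟨ rearrange r B 𝔒 N₀ T ⟩
      B * (N₀ * T * r) + B * (r * 𝔒)   ∎))
    where
    open ≤-Reasoning
    rearrange : ∀ r B O N T → r * (B * O + N * (T * B)) ≡ B * (N * T * r) + B * (r * O)
    rearrange = solve 5 (λ r B O N T →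
      r :* (B :* O :+ N :* (T :* B)) := B :* (N :* T :* r) :+ B :* (r :* O)) refl

    B≢0 : NonZero B
    B≢0 = >-nonZero (n≢0⇒n>0 λ { refl → <⇒≱ (m^n>0 r k) (≤-trans r^k≤TB (≤-reflexive (*-zeroʳ T))) })

  -- The new wedges number at least B / T, while the left side is at most (3M + 1) r B. So once r ≥
  -- T (3M + 1), they afford a gain of M r + 1.
  special-gain : ∀ {B r q y} k M T → B ≤ r ^ k → r ^ k ≤ T * y → q ≤ 2 * M → 1 ≤ r → T * suc (3 * M) ≤ r →
    B * (suc (M * r) + r * q) ≤ r * r * y
  special-gain {B} {r} {q} {y} k M T B≤ r^k≤ q≤2M 1≤r large = begin
    B * (suc (M * r) + r * q)
      ≤⟨ *-mono-≤ (≤-trans B≤ r^k≤) (+-mono-≤ (+-monoˡ-≤ (M * r) 1≤r) (*-monoʳ-≤ r q≤2M)) ⟩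
    T * y * (r + M * r + r * (2 * M))
      ≡⟨ solve 4 (λ T y r M → T :* y :* (r :+ M :* r :+ r :* (con 2 :* M)) :=
           T :* (con 1 :+ con 3 :* M) :* (r :* y)) refl T y r M ⟩
    T * suc (3 * M) * (r * y)
      ≤⟨ *-monoˡ-≤ (r * y) large ⟩
    r * (r * y)
      ≡⟨ *-assoc r r y ⟨
    r * r * y
      ∎
    where open ≤-Reasoning

open Binomials

-- Families of low excess

≤-stable : ∀ {m n} → ¬ ¬ (m ≤ n) → m ≤ n
≤-stable = decidable-stable (_ ℕ.≤? _)

module Sums {c ℓ₁ ℓ₂} (F : HeytingField c ℓ₁ ℓ₂) {m ℓm} (V : LinearAlgebra.VectorSpace F m ℓm) (p : Level) where

  open LinearAlgebra F
  open Bases F V p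
  open LeftModule V using (Carrierᴹ)

  span-least : ∀ {q s} {S : Carrierᴹ → Set s} (U : Subspace V q) → (∀ {v} → S v → v ∈ U) → span {V = V} S ⊑ U
  span-least {S = S} U S⊆U = mk⊑ go
    where
    go : ∀ {v} → Span {V = V} S v → v ∈ U
    go (span-⊆ v∈)        = S⊆U v∈
    go (span-resp v≈w v∈) = respects U v≈w (go v∈)
    go span-0             = 0-closed U
    go (span-+ v∈ w∈)     = +-closed U (go v∈) (go w∈)
    go (span-* a v∈)      = *-closed U a (go v∈)

  ∑-least : ∀ {i q q′} {I : Set i} {W : I → Subspace V q} (U : Subspace V q′) → (∀ i → W i ⊑ U) → ∑ˢ W ⊑ U
  ∑-least U W⊑U = span-least U λ (i , v∈) → include (W⊑U i) v∈

  ⊑-∑ : ∀ {i q} {I : Set i} (W : I → Subspace V q) i → W i ⊑ ∑ˢ W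
  ⊑-∑ W i = mk⊑ λ v∈ → span-⊆ (i , v∈)

-- The first two terms make `C-growth` applicable after a loss of 4M dimensions; the last is what
-- `special-gain` asks for.
threshold : ℕ → ℕ → ℕ
threshold k M = 2 * k + 8 * M + growth k * suc (3 * M)

module Family
  {c ℓ₁ ℓ₂} (F : HeytingField c ℓ₁ ℓ₂) {m ℓm q} (V : LinearAlgebra.VectorSpace F m ℓm)
  (k₀ r : ℕ) .{{_ : NonZero r}} {t : ℕ} (H : Fin t → LinearAlgebra.Subspace F V q)
  (H-basis : ∀ i → Bases.Basis F V Level.zero (H i) r)
  {𝔒 𝔈 : ℕ}
  (𝔒-basis : Bases.Basis F V Level.zero (LinearAlgebra.∑ˢ F H) 𝔒)
  (𝔈-basis : Wedges.Λ.Basis F V Level.zero (suc (suc k₀))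
    (LinearAlgebra.∑ˢ F λ i → LinearAlgebra.Λˢ F (suc (suc k₀)) (H i)) 𝔈)
  (N₀ : ℕ) (low-excess : r * 𝔈 ≤ (r C suc (suc k₀)) * 𝔒 + N₀ * r ^ suc (suc k₀))
  (large : threshold (suc (suc k₀)) (N₀ * growth (suc (suc k₀))) ≤ r)
  {κ : ℕ} (block : Fin t → Fin κ) (partition : IsComponentPartition (LinearAlgebra.Close F r H) block)
  where

  open LinearAlgebra F
  open Wedges F V Level.zero hiding (module Λ)
  open Bases F V Level.zero
  open Sums F V Level.zero
  open LeftModule V using (Carrierᴹ)
  open ℕ-Solver using (solve; _:=_; _:+_; _:*_; con)

  k B M : ℕ
  k = suc (suc k₀)
  B = r C k
  M = N₀ * growth k

  open Exterior k V using (Term; ⋀)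
  private
    module E = Wedges.Λ F V Level.zero k

  2k+8M≤r : 2 * k + 8 * M ≤ r
  2k+8M≤r = ℕ.m+n≤o⇒m≤o (2 * k + 8 * M) large

  4M≤r : 4 * M ≤ r
  4M≤r = ℕ.≤-trans (ℕ.*-monoˡ-≤ M {4} {8} (s≤s (s≤s (s≤s (s≤s z≤n))))) (ℕ.m+n≤o⇒n≤o (2 * k) 2k+8M≤r)

  1≤r : 1 ≤ r
  1≤r = ℕ.≤-trans (s≤s z≤n) 2k+8M≤r

  -- The same subspace as `H i`, moved to the level of `Sub`, where sums are formed.
  U : Fin t → Sub
  U i = ⟨ basis (H-basis i) ⟩

  U⊑H : ∀ i → U i ⊑ H i
  U⊑H i = ⟨⟩⊑ (H-basis i)

  H⊑U : ∀ i → H i ⊑ U i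
  H⊑U i = spanning (H-basis i)

  SplitAt : Sub → Fin t → Set _
  SplitAt S i = Split S (basis (H-basis i))

  split-at : ∀ S i → ¬ ¬ SplitAt S i
  split-at S i = split S (basis (H-basis i)) (independent (H-basis i))

  dim-w dim-u : ∀ {S i} → SplitAt S i → ℕ
  dim-w sp = length (Split.w sp)
  dim-u sp = length (Split.u sp)

  dim-total : ∀ {S i} (sp : SplitAt S i) → dim-w sp + dim-u sp ≡ r
  dim-total {i = i} sp = ≡.trans (Split.total sp) (length≡ (H-basis i))

  dim-w≤r : ∀ {S i} (sp : SplitAt S i) → dim-w sp ≤ r
  dim-w≤r sp = ≡.subst (dim-w sp ≤_) (dim-total sp) (ℕ.m≤m+n _ _)

  -- A sum of members of the family built up one member at a time: b is a
  -- basis of the sum, and the independent wedges xs of members outgrow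
  -- β · dim by the gain.
  record State (is : List (Fin t)) : Set (c ⊔ ℓ₁ ⊔ m ⊔ ℓm) where
    field
      b        : List Carrierᴹ
      b-indep  : Independent 𝟘 b
      b-from   : All (λ v → ∃[ i ] (i ∈ˡ is) × (v ∈ U i)) b
      b-covers : ∀ {i} → i ∈ˡ is → U i ⊑ ⟨ b ⟩
      b-short  : length b ≤ length is * r
      xs       : List Term
      xs-indep : E.Independent E.𝟘 xs
      xs-from  : All (λ x → ∃[ i ] ∃[ J ] (i ∈ˡ is) × (J ⊆ U i) × (x ≡ ⋀ J)) xs
      ω        : ℕ
      gain     : B * (ω + r * length b) ≤ r * r * length xs

  open State

  dim : ∀ {is} → State is → ℕ
  dim s = length (b s)

  empty : State []
  empty = record
    { b = [] ; b-indep = [] ; b-from = [] ; b-covers = λ () ; b-short = z≤n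
    ; xs = [] ; xs-indep = E.[] ; xs-from = [] ; ω = 0
    ; gain = ℕ.≤-reflexive (≡.trans (≡.cong (B *_) (ℕ.*-zeroʳ r)) (≡.trans (ℕ.*-zeroʳ B) (≡.sym (ℕ.*-zeroʳ (r * r)))))
    }

  -- The gain `Δ` is a parameter because two kinds of wedges get added: the generic ones of `step`
  -- and those of `no-skew`, detected modulo two subspaces.
  add : ∀ {is} (s : State is) {i} (sp : SplitAt ⟨ b s ⟩ i) Js → All (_⊆ U i) Js →
    E.Independent E.⟨ xs s ⟩ (map ⋀ Js) → ∀ Δ → B * (Δ + r * dim-w sp) ≤ r * r * length Js → State (i ∷ is)
  add {is} s {i} sp Js Js⊆ Js-indep Δ Δ-gain = record
    { b        = w ++ b s
    ; b-indep  = independent-++ (Split.w-indep sp) (b-indep s)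
    ; b-from   = All.++⁺ (All.map (λ v∈ → i , here ≡.refl , v∈) (Split.w⊆ sp))
                   (All.map (λ (j , j∈ , v∈) → j , there j∈ , v∈) (b-from s))
    ; b-covers = λ where
        (here ≡.refl) → ≡.subst (U i ⊑_) (≡.sym (⊞-++ 𝟘 w (b s))) (Split.covers sp)
        (there j∈)    → ⊑-trans (b-covers s j∈)
          (≡.subst (⟨ b s ⟩ ⊑_) (≡.sym (⊞-++ 𝟘 w (b s))) (⊞-base ⟨ b s ⟩ w))
    ; b-short  = ≡.subst (_≤ r + length is * r) (≡.sym (length-++ w)) (ℕ.+-mono-≤ (dim-w≤r sp) (b-short s))
    ; xs       = map ⋀ Js ++ xs s
    ; xs-indep = E.independent-++ Js-indep (xs-indep s)
    ; xs-from  = All.++⁺ (All.map⁺ (All.map (λ J⊆ → i , _ , here ≡.refl , J⊆ , ≡.refl) Js⊆))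
                   (All.map (λ (j , J , j∈ , rest) → j , J , there j∈ , rest) (xs-from s))
    ; ω        = ω s + Δ
    ; gain     = begin
        B * (ω s + Δ + r * length (w ++ b s))
          ≡⟨ ≡.cong (λ n → B * (ω s + Δ + r * n)) (length-++ w) ⟩
        B * (ω s + Δ + r * (dim-w sp + dim s))
          ≡⟨ rearrange B (ω s) Δ r (dim-w sp) (dim s) ⟩
        B * (Δ + r * dim-w sp) + B * (ω s + r * dim s)
          ≤⟨ ℕ.+-mono-≤ Δ-gain (gain s) ⟩
        r * r * length Js + r * r * length (xs s)
          ≡⟨ ℕ.*-distribˡ-+ (r * r) (length Js) _ ⟨
        r * r * (length Js + length (xs s))
          ≡⟨ ≡.cong (λ n → r * r * (n + length (xs s))) (length-map ⋀ Js) ⟨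
        r * r * (length (map ⋀ Js) + length (xs s))
          ≡⟨ ≡.cong (r * r *_) (length-++ (map ⋀ Js)) ⟨
        r * r * length (map ⋀ Js ++ xs s)
          ∎
    }
    where
    open ℕ.≤-Reasoning

    w : List Carrierᴹ
    w = Split.w sp

    rearrange : ∀ B ω Δ r q n → B * (ω + Δ + r * (q + n)) ≡ B * (Δ + r * q) + B * (ω + r * n)
    rearrange = solve 6 (λ B ω Δ r q n →
      B :* (ω :+ Δ :+ r :* (q :+ n)) := B :* (Δ :+ r :* q) :+ B :* (ω :+ r :* n)) ≡.refl

  xs⊑ΣΛ : ∀ {is} (s : State is) P Q → (∀ {i} → i ∈ˡ is → U i ⊑ P ⊎ U i ⊑ Q) → E.⟨ xs s ⟩ E.⊑ ΣΛ k (P ,₂ Q)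
  xs⊑ΣΛ s P Q is⊑ = E.⟨⟩-least (ΣΛ k (P ,₂ Q)) (All.map member (xs-from s))
    where
    member : ∀ {x} → ∃[ i ] ∃[ J ] (i ∈ˡ _) × (J ⊆ U i) × (x ≡ ⋀ J) → x E.∈ ΣΛ k (P ,₂ Q)
    member (i , J , i∈ , J⊆ , x≡) with is⊑ i∈
    ... | inj₁ ⊑P = span-⊆ (J , zero , (λ j → include ⊑P (J⊆ j)) , x≡)
    ... | inj₂ ⊑Q = span-⊆ (J , suc zero , (λ j → include ⊑Q (J⊆ j)) , x≡)

  step : ∀ {is} (s : State is) {i} (sp : SplitAt ⟨ b s ⟩ i) → State (i ∷ is)
  step s {i} sp = add s sp (combinationsᶜ (suc k₀) w u) (combinationsᶜ-⊆ (U i) (suc k₀) (Split.w⊆ sp) (Split.u⊆ sp))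
    -- With `𝟘` as second subspace, only the first factor of each form is constrained.
    (E.independent-antitone (xs⊑ΣΛ s ⟨ b s ⟩ 𝟘 (λ i∈ → inj₁ (b-covers s i∈)))
      (wedges-independent k₀ w (Split.w-indep sp) (Split.u⊆S sp)
        (independent-++ (independent-antitone (⟨⟩-least ⟨ b s ⟩ (Split.u⊆S sp)) (Split.w-indep sp)) (Split.u-indep sp))))
    (dim-u sp * dim-w sp)
    (step-gain k₀ (dim-total sp) (≡.trans (length-combinationsᶜ (suc k₀) w u) (≡.cong (_C k) (dim-total sp))))
    where
    w u : List Carrierᴹ
    w = Split.w sp
    u = Split.u sp

  dim-step : ∀ {is} (s : State is) {i} (sp : SplitAt ⟨ b s ⟩ i) → dim (step s sp) ≡ dim-w sp + dim s
  dim-step s sp = length-++ (Split.w sp)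

  add-all : ∀ {is} (s : State is) js → ¬ ¬ (Σ[ s′ ∈ State (js ++ is) ] ω s ≤ ω s′)
  add-all s []       = return (s , ℕ.≤-refl)
  add-all s (j ∷ js) = add-all s js >>= λ (s′ , ω≤) → split-at ⟨ b s′ ⟩ j >>= λ sp →
    return (step s′ sp , ℕ.≤-trans ω≤ (ℕ.m≤m+n (ω s′) _))

  xs≤𝔈 : ∀ {is} (s : State is) → length (xs s) ≤ 𝔈
  xs≤𝔈 s = ≡.subst (length (xs s) ≤_) (E.length≡ 𝔈-basis) (E.steinitz E.𝟘 (E.basis 𝔈-basis) (xs-indep s)
    (All.map (λ (i , J , _ , J⊆ , x≡) → E.include (E.spanning 𝔈-basis)
      (span-⊆ (i , span-⊆ (J , (λ j → include (U⊑H i) (J⊆ j)) , x≡)))) (xs-from s)))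

  dim-≥ : ∀ {is} (s : State is) {q n} {W : Subspace V q} → Basis W n → W ⊑ ⟨ b s ⟩ → n ≤ dim s
  dim-≥ s W-basis W⊑ = ≡.subst (_≤ dim s) (length≡ W-basis)
    (steinitz 𝟘 (b s) (independent W-basis) (All-⊑ W⊑ (inside W-basis)))

  dim-≤ : ∀ {is} (s : State is) {q n} {W : Subspace V q} → Basis W n → (∀ {i} → i ∈ˡ is → U i ⊑ W) → dim s ≤ n
  dim-≤ s W-basis ⊑W = ≡.subst (dim s ≤_) (length≡ W-basis) (steinitz 𝟘 (basis W-basis) (b-indep s)
    (All.map (λ (i , i∈ , v∈) → include (spanning W-basis) (include (⊑W i∈) v∈)) (b-from s)))

  dim≤𝔒 : ∀ {is} (s : State is) → dim s ≤ 𝔒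
  dim≤𝔒 s = dim-≤ s 𝔒-basis λ {i} _ → ⊑-trans (U⊑H i) (⊑-∑ H i)

  𝔒≤dim : ∀ {is} (s : State is) → (∀ i → i ∈ˡ is) → 𝔒 ≤ dim s
  𝔒≤dim s all∈ = dim-≥ s 𝔒-basis (∑-least ⟨ b s ⟩ λ i → ⊑-trans (H⊑U i) (b-covers s (all∈ i)))

  -- Used with n = r, and with n the dimension left after removing two intersections of dimension at
  -- most 2M.
  r^k≤ : ∀ n → r ≤ n + (2 * M + 2 * M) → r ^ k ≤ growth k * (n C k)
  r^k≤ n r≤n+4M = C-growth {r} {n} k (ℕ.+-cancelʳ-≤ (8 * M) _ _ (begin
    2 * k + r + 8 * M                ≡⟨ solve 3 (λ k r M → con 2 :* k :+ r :+ con 8 :* M := r :+ (con 2 :* k :+ con 8 :* M)) ≡.refl k r M ⟩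
    r + (2 * k + 8 * M)              ≤⟨ ℕ.+-monoʳ-≤ r 2k+8M≤r ⟩
    r + r                            ≤⟨ ℕ.+-mono-≤ r≤n+4M r≤n+4M ⟩
    n + (2 * M + 2 * M) + (n + (2 * M + 2 * M))
      ≡⟨ solve 2 (λ n M → n :+ (con 2 :* M :+ con 2 :* M) :+ (n :+ (con 2 :* M :+ con 2 :* M)) := con 2 :* n :+ con 8 :* M) ≡.refl n M ⟩
    2 * n + 8 * M                    ∎))
    where
    open ℕ.≤-Reasoning

  -- Low excess concerns the whole family, so the partial sum is completed first, which only
  -- increases `ω`. Members may be added twice: 𝔒 and 𝔈 are compared with spans, not with the list.
  ω-bound : ∀ {is} (s : State is) → ω s ≤ M * r
  ω-bound s = ≤-stable (add-all s (allFin t) >>= λ (s′ , ω≤) → return (ℕ.≤-trans ω≤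
    (gain-bound N₀ k (growth k) (gain s′) (𝔒≤dim s′ (λ i → ∈-++⁺ˡ (∈-allFin i))) (xs≤𝔈 s′) low-excess
      (r^k≤ r (ℕ.m≤m+n r _)))))

  step-bound : ∀ {is} (s : State is) {i} (sp : SplitAt ⟨ b s ⟩ i) → dim-u sp * dim-w sp ≤ M * r
  step-bound s sp = ℕ.≤-trans (ℕ.m≤n+m _ (ω s)) (ω-bound (step s sp))

  -- Two numbers with sum r have one that is at least r/2, so a product of at most M r leaves the
  -- other at most 2M.
  small-or-large : ∀ {S i} (sp : SplitAt S i) → dim-u sp * dim-w sp ≤ M * r →
    (2 * dim-u sp ≤ r × dim-u sp ≤ 2 * M) ⊎ (r < 2 * dim-u sp × dim-w sp ≤ 2 * M)
  small-or-large sp bound with 2 * dim-u sp ℕ.≤? r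
  ... | yes 2u≤r = inj₁ (2u≤r , small-factor {q = dim-w sp} M (complement-half {h = dim-u sp} {dim-w sp} (dim-total sp) 2u≤r) bound)
  ... | no  2u≰r = inj₂ (ℕ.≰⇒> 2u≰r , small-factor {q = dim-u sp} M (ℕ.<⇒≤ (ℕ.≰⇒> 2u≰r))
                     (≡.subst (_≤ M * r) (ℕ.*-comm (dim-u sp) (dim-w sp)) bound))

  -- Products of one functional vanishing on ⟨ b s ⟩ with functionals
  -- vanishing on U j detect almost all of Λᵏ (U i), although U i adds at
  -- most 2 M dimensions to the sum.
  no-skew : ∀ {is j i} (s : State is) (s′ : State (j ∷ is)) (sp : SplitAt ⟨ b s′ ⟩ i) →
    (p : SplitAt ⟨ b s ⟩ i) (q : SplitAt (U j) i) →
    dim-u p ≤ 2 * M → dim-u q ≤ 2 * M → ¬ (dim-w sp ≤ 2 * M)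
  no-skew {is} {j} {i} s s′ sp p q p≤ q≤ w≤ =
    complement₂ (independent (H-basis i)) p q λ (a , indepP , indepQ , a⊆ , e≤) →
    let Js      = combinationsᶜ (suc k₀) a []
        length≡′ = ≡.trans (≡.sym (ℕ.+-identityʳ (length Js)))
          (≡.trans (length-combinationsᶜ (suc k₀) a []) (≡.cong (_C k) (ℕ.+-identityʳ (length a))))
        s″      = add s′ sp Js (combinationsᶜ-⊆ (U i) (suc k₀) a⊆ [])
          (E.independent-antitone (xs⊑ΣΛ s′ ⟨ b s ⟩ (U j) cover)
            (wedges-independent k₀ a indepP [] (≡.subst (Independent (U j)) (≡.sym (++-identityʳ a)) indepQ)))
          -- One more than `ω-bound` allows.
          (suc (M * r))
          (special-gain k M (growth k) (C-upper r k)
            (≡.subst (λ y → r ^ k ≤ growth k * y) (≡.sym length≡′)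
              (r^k≤ (length a) (ℕ.≤-trans (≡.subst (_≤ _) (length≡ (H-basis i)) e≤) (ℕ.+-monoʳ-≤ (length a) (ℕ.+-mono-≤ p≤ q≤)))))
            w≤ 1≤r (ℕ.m+n≤o⇒n≤o (2 * k + 8 * M) large))
    in ℕ.<⇒≱ (ℕ.m≤n+m (suc (M * r)) (ω s′)) (ω-bound s″)
    where
    cover : ∀ {l} → l ∈ˡ j ∷ is → U l ⊑ ⟨ b s ⟩ ⊎ U l ⊑ U j
    cover (here ≡.refl) = inj₂ ⊑-refl
    cover (there l∈)    = inj₁ (b-covers s l∈)

  -- Each dimension beyond `X` has been paid for by r/2 units of `ω`. As `ω` is at most M r, the
  -- surplus never exceeds 2M.
  Tight : ∀ {is} → ℕ → State is → Set
  Tight X s = r * dim s ≤ r * X + 2 * ω s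

  tight⇒dim≤ : ∀ {is X} (s : State is) → Tight X s → dim s ≤ X + 2 * M
  tight⇒dim≤ s tight = average M tight (ω-bound s)

  dim≤⇒tight : ∀ {is X} (s : State is) → dim s ≤ X → Tight X s
  dim≤⇒tight s dim≤ = ℕ.≤-trans (ℕ.*-monoʳ-≤ r dim≤) (ℕ.m≤m+n _ _)

  -- Weaker than `Close`: the common part may be exactly half and the indices may coincide, so that
  -- it holds for any two members of a block.
  record Near (i j : Fin t) : Set (c ⊔ m ⊔ ℓm) where
    field
      y       : List Carrierᴹ
      y-indep : Independent 𝟘 y
      y⊆i     : All (_∈ U i) y
      y⊆j     : All (_∈ U j) y
      r≤2y    : r ≤ 2 * length y

  -- The new member meets the sum in dimension u ≥ r/2, so its w new dimensions satisfy r w ≤ 2 u w,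
  -- twice the gain.
  near-step : ∀ {is X} (s : State is) → Tight X s → ∀ {i j} → i ∈ˡ is → Near i j →
    ¬ ¬ (Σ[ s′ ∈ State (j ∷ is) ] Tight X s′)
  near-step {X = X} s tight {j = j} i∈ near = split-at ⟨ b s ⟩ j >>= λ sp →
    let r≤2u = ℕ.≤-trans r≤2y (ℕ.*-monoʳ-≤ 2 (Split.u-largest sp y-indep y⊆j (All-⊑ (b-covers s i∈) y⊆i)))
    in return (step s sp , (begin
      r * dim (step s sp)
        ≡⟨ ≡.trans (≡.cong (r *_) (dim-step s sp)) (ℕ.*-distribˡ-+ r (dim-w sp) (dim s)) ⟩
      r * dim-w sp + r * dim s
        ≤⟨ ℕ.+-mono-≤ (half-gain {q = dim-u sp} (dim-w sp) r≤2u) tight ⟩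
      2 * (dim-w sp * dim-u sp) + (r * X + 2 * ω s)
        ≡⟨ solve 4 (λ w u rX ω → con 2 :* (w :* u) :+ (rX :+ con 2 :* ω) := rX :+ con 2 :* (ω :+ u :* w))
             ≡.refl (dim-w sp) (dim-u sp) (r * X) (ω s) ⟩
      r * X + 2 * ω (step s sp)
        ∎))
    where
    open Near near
    open ℕ.≤-Reasoning

  singleton : ∀ i → ¬ ¬ (State (i ∷ []))
  singleton i = split-at ⟨ [] ⟩ i >>= λ sp → return (step empty sp)

  singleton-tight : ∀ {i} (s : State (i ∷ [])) → Tight r s
  singleton-tight s = dim≤⇒tight s (≡.subst (dim s ≤_) (ℕ.+-identityʳ r) (b-short s))

  -- Distances within a block and between blocks.

  close⇒near : ∀ {i j} → Close r H i j → Near i j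
  close⇒near {i} {j} (_ , d , (n , hasDim , d+n≡r) , 2d<r) =
    let meet = hasDim⇒basis (H i ∩ˢ H j) hasDim in record
    { y       = basis meet
    ; y-indep = independent meet
    ; y⊆i     = All.map (λ v∈ → include (H⊑U i) (proj₁ v∈)) (inside meet)
    ; y⊆j     = All.map (λ v∈ → include (H⊑U j) (proj₂ v∈)) (inside meet)
    ; r≤2y    = ≡.subst (λ n → r ≤ 2 * n) (≡.sym (length≡ meet))
                  (complement-half {h = d} {n} (≡.trans (ℕ.+-comm n d) d+n≡r) (ℕ.<⇒≤ 2d<r))
    }

  -- Each vertex of the path is close to its predecessor, which is already in the sum; `Tight r`
  -- makes the bound independent of the length of the path.
  follow : ∀ {i j is} → Star (Close r H) i j → (s : State is) → Tight r s → i ∈ˡ is →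
    ¬ ¬ (∃[ is′ ] Σ[ s′ ∈ State is′ ] Tight r s′ × (j ∈ˡ is′) × (∀ l → l ∈ˡ is → l ∈ˡ is′))
  follow ε              s tight i∈ = return (_ , s , tight , i∈ , λ _ l∈ → l∈)
  follow (close ◅ path) s tight i∈ =
    near-step s tight i∈ (close⇒near close) >>= λ (s₁ , tight₁) →
    follow path s₁ tight₁ (here ≡.refl) >>= λ (_ , s′ , tight′ , j∈ , is⊆) →
    return (_ , s′ , tight′ , j∈ , λ _ l∈ → is⊆ _ (there l∈))

  -- Both members lie in one sum of dimension at most r + 2M, so at most 2M dimensions of `U j` are
  -- outside `U i`.
  same-block-split : ∀ {i j} → block i ≡ block j → ¬ ¬ (Σ[ sp ∈ SplitAt (U i) j ] dim-w sp ≤ 2 * M)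
  same-block-split {i} {j} same =
    singleton i >>= λ s₀ →
    follow (Equivalence.to (IsComponentPartition.components partition i j) same) s₀ (singleton-tight s₀) (here ≡.refl)
      >>= λ (_ , s , tight , j∈ , is⊆) →
    split-at (U i) j >>= λ sp →
    return (sp , ℕ.+-cancelʳ-≤ r _ _ (begin
      dim-w sp + r
        ≡⟨ ≡.cong (dim-w sp +_) (length≡ (H-basis i)) ⟨
      dim-w sp + length (basis (H-basis i))
        ≡⟨ length-++ (Split.w sp) ⟨
      length (Split.w sp ++ basis (H-basis i))
        ≤⟨ steinitz 𝟘 (b s) (independent-++ (Split.w-indep sp) (independent (H-basis i)))
             (All.++⁺ (All-⊑ (b-covers s j∈) (Split.w⊆ sp)) (All-⊑ (b-covers s (is⊆ _ (here ≡.refl))) (⊞-new 𝟘 _))) ⟩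
      dim s
        ≤⟨ tight⇒dim≤ s tight ⟩
      r + 2 * M
        ≡⟨ ℕ.+-comm r (2 * M) ⟩
      2 * M + r
        ∎))
    where open ℕ.≤-Reasoning

  -- Since 4M ≤ r, losing 2M dimensions leaves at least half. Hence the members of a block can be
  -- added in any order once one of them is present.
  same-block-near : ∀ {i j} → block i ≡ block j → ¬ ¬ Near i j
  same-block-near {i} {j} same = same-block-split same >>= λ (sp , w≤) → return record
    { y       = Split.u sp
    ; y-indep = Split.u-indep sp
    ; y⊆i     = Split.u⊆S sp
    ; y⊆j     = Split.u⊆ sp
    ; r≤2y    = complement-half {h = dim-w sp} {dim-u sp} (≡.trans (ℕ.+-comm (dim-u sp) (dim-w sp)) (dim-total sp))
        (ℕ.≤-trans (ℕ.*-monoʳ-≤ 2 w≤) (≡.subst (_≤ r) (ℕ.*-assoc 2 2 M) 4M≤r))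
    }

  same-block-distance : ∀ {i j d} → block i ≡ block j → GrDist r (H i) (H j) d → d ≤ 2 * M
  same-block-distance {i} {j} {d} same (n , hasDim , d+n≡r) = ≤-stable (same-block-split same >>= λ (sp , w≤) →
    let meet = hasDim⇒basis (H i ∩ˢ H j) hasDim
        u≤n  = ≡.subst (dim-u sp ≤_) (length≡ meet) (steinitz 𝟘 (basis meet) (Split.u-indep sp)
          (All.map (λ (v∈i , v∈j) → include (spanning meet) (include (U⊑H i) v∈i , include (U⊑H j) v∈j))
            (All.zip (Split.u⊆S sp , Split.u⊆ sp))))
    in return (ℕ.≤-trans (ℕ.+-cancelʳ-≤ n d (dim-w sp) (begin
      d + n                 ≡⟨ d+n≡r ⟩
      r                     ≡⟨ dim-total sp ⟨
      dim-w sp + dim-u sp   ≤⟨ ℕ.+-monoʳ-≤ (dim-w sp) u≤n ⟩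
      dim-w sp + n          ∎)) w≤))
    where open ℕ.≤-Reasoning

  split-resp : ∀ {S S′ i} → S ⊑ S′ → S′ ⊑ S → SplitAt S i → SplitAt S′ i
  split-resp S⊑S′ S′⊑S sp = record
    { w = w ; u = u ; w-indep = independent-antitone S′⊑S w-indep ; u-indep = u-indep ; w⊆ = w⊆ ; u⊆ = u⊆
    ; u⊆S = All-⊑ S⊑S′ u⊆S ; meet = λ v∈e v∈S′ → meet v∈e (include S′⊑S v∈S′)
    ; covers = ⊑-trans covers (⊞-mono w S⊑S′) ; total = total
    }
    where open Split sp

  -- For these two members alone, the intersection is small or more than half, and the latter would
  -- make `i` and `j` adjacent.
  distinct-block-split : ∀ {i j} → block i ≢ block j → ¬ ¬ (Σ[ sp ∈ SplitAt (U i) j ] dim-u sp ≤ 2 * M)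
  distinct-block-split {i} {j} distinct =
    singleton i >>= λ s → split-at ⟨ b s ⟩ j >>= λ sp → return (small s sp (small-or-large sp (step-bound s sp)))
    where
    b⊑U : (s : State (i ∷ [])) → ⟨ b s ⟩ ⊑ U i
    b⊑U s = ⟨⟩-least (U i) (All.map (λ { (_ , here ≡.refl , v∈) → v∈ }) (b-from s))

    not-large : (sp : SplitAt (U i) j) → ¬ (r < 2 * dim-u sp)
    not-large sp r<2u = distinct (Equivalence.from (IsComponentPartition.components partition i j) (close ◅ ε))
      where
      close : Close r H i j
      close = (λ { ≡.refl → distinct ≡.refl })
        , dim-w sp
        , ( dim-u sp
          , basis⇒hasDim (H i ∩ˢ H j) (Split.u sp) (Split.u-indep sp)
              (All.map (λ (v∈i , v∈j) → include (U⊑H i) v∈i , include (U⊑H j) v∈j)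
                (All.zip (Split.u⊆S sp , Split.u⊆ sp)))
              (λ (v∈i , v∈j) → Split.meet sp (include (H⊑U j) v∈j) (include (H⊑U i) v∈i))
          , dim-total sp)
        , complement-half-< {h = dim-u sp} {dim-w sp} (dim-total sp) r<2u

    small : (s : State (i ∷ [])) (sp : SplitAt ⟨ b s ⟩ j) →
      (2 * dim-u sp ≤ r × dim-u sp ≤ 2 * M) ⊎ (r < 2 * dim-u sp × dim-w sp ≤ 2 * M) →
      Σ[ sp ∈ SplitAt (U i) j ] dim-u sp ≤ 2 * M
    small s sp (inj₁ (_ , u≤))   = split-resp (b⊑U s) (b-covers s (here ≡.refl)) sp , u≤
    small s sp (inj₂ (r<2u , _)) =
      ⊥-elim (not-large (split-resp (b⊑U s) (b-covers s (here ≡.refl)) sp) r<2u)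

  distinct-block-distance : ∀ {i j d} → block i ≢ block j → GrDist r (H i) (H j) d → r ≤ d + 2 * M
  distinct-block-distance {i} {j} {d} distinct (n , hasDim , d+n≡r) =
    ≤-stable (distinct-block-split distinct >>= λ (sp , u≤) →
    let meet = hasDim⇒basis (H i ∩ˢ H j) hasDim
        n≤u  = ≡.subst (_≤ dim-u sp) (length≡ meet) (Split.u-largest sp (independent meet)
          (All.map (λ v∈ → include (H⊑U j) (proj₂ v∈)) (inside meet))
          (All.map (λ v∈ → include (H⊑U i) (proj₁ v∈)) (inside meet)))
    in return (≡.subst (_≤ d + 2 * M) d+n≡r (ℕ.+-monoʳ-≤ d (ℕ.≤-trans n≤u u≤))))

  -- Dimensions of blocks and of sums of representatives.

  Gathered : ∀ {ℓ} → ℕ → List (Fin t) → (Fin t → Set ℓ) → List (Fin t) → Set _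
  Gathered X is Skip js = ∃[ is′ ] Σ[ s ∈ State is′ ]
    Tight X s × (∀ l → l ∈ˡ is → l ∈ˡ is′) × All (λ j → Skip j ⊎ j ∈ˡ is′) js

  gather : ∀ {is X} (s : State is) → Tight X s → ∀ {ℓ} (Skip : Fin t → Set ℓ) js →
    All (λ j → Skip j ⊎ ∃[ i ] (i ∈ˡ is) × block i ≡ block j) js → ¬ ¬ Gathered X is Skip js
  gather s tight Skip [] [] = return (_ , s , tight , (λ _ l∈ → l∈) , [])
  gather {is} {X} s tight Skip (j ∷ js) (how ∷ hows) = gather s tight Skip js hows >>= gather₁ how
    where
    gather₁ : Skip j ⊎ ∃[ i ] (i ∈ˡ is) × block i ≡ block j → Gathered X is Skip js → ¬ ¬ Gathered X is Skip (j ∷ js)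
    gather₁ (inj₁ skip) (_ , s , tight , is⊆ , js∈) = return (_ , s , tight , is⊆ , inj₁ skip ∷ js∈)
    gather₁ (inj₂ (i , i∈ , same)) (_ , s , tight , is⊆ , js∈) =
      same-block-near same >>= λ near → near-step s tight (is⊆ _ i∈) near >>= λ (s′ , tight′) →
      return (_ , s′ , tight′ , (λ _ l∈ → there (is⊆ _ l∈)) ,
        inj₂ (here ≡.refl) ∷ All.map (λ { (inj₁ skip) → inj₁ skip ; (inj₂ j∈) → inj₂ (there j∈) }) js∈)

  block-dimension : ∀ a d → HasDim (∑ˢ {I = Σ[ i ∈ Fin t ] block i ≡ a} (λ x → H (proj₁ x))) d →
    (r ≤ d) × (d ≤ r + 2 * M)
  block-dimension a d hasDim = r≤d , ≤-stable (singleton i₀ >>= λ s₀ →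
    gather s₀ (singleton-tight s₀) (λ j → block j ≢ a) (allFin t) (All.tabulate λ {j} _ → how j) >>= λ (_ , s , tight , _ , all∈) →
    return (ℕ.≤-trans (dim-≥ s W-basis (∑-least ⟨ b s ⟩ λ (j , same) →
        ⊑-trans (H⊑U j) (b-covers s (found same (All.lookup all∈ (∈-allFin j))))))
      (tight⇒dim≤ s tight)))
    where
    i₀ = proj₁ (IsComponentPartition.nonempty partition a)

    i₀∈a : block i₀ ≡ a
    i₀∈a = proj₂ (IsComponentPartition.nonempty partition a)

    W-basis = hasDim⇒basis (∑ˢ {I = Σ[ i ∈ Fin t ] block i ≡ a} (λ x → H (proj₁ x))) hasDim

    r≤d : r ≤ d
    r≤d = ≡.subst₂ _≤_ (length≡ (H-basis i₀)) (length≡ W-basis)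
      (steinitz 𝟘 (basis W-basis) (independent (H-basis i₀))
        (All-⊑ (⊑-trans (⊑-∑ {I = Σ[ i ∈ Fin t ] block i ≡ a} (λ x → H (proj₁ x)) (i₀ , i₀∈a)) (spanning W-basis)) (inside (H-basis i₀))))

    how : ∀ j → block j ≢ a ⊎ ∃[ i ] (i ∈ˡ i₀ ∷ []) × block i ≡ block j
    how j with block j Fin.≟ a
    ... | yes same    = inj₂ (i₀ , here ≡.refl , ≡.trans i₀∈a (≡.sym same))
    ... | no distinct = inj₁ distinct

    found : ∀ {j is} → block j ≡ a → block j ≢ a ⊎ j ∈ˡ is → j ∈ˡ is
    found same (inj₁ distinct) = ⊥-elim (distinct same)
    found same (inj₂ j∈)       = j∈

  Transversal : ∀ {is} → State is → Set _
  Transversal {is} s = ∀ i → All (λ j → block j ≢ block i) is → ¬ ¬ (Σ[ sp ∈ SplitAt ⟨ b s ⟩ i ] dim-u sp ≤ 2 * M)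

  -- By `small-or-large` the intersection could only jump to almost everything. `no-skew` excludes
  -- this, as the old sum and `U j` each meet `U i` in small dimension.
  transversal-step : ∀ {is j} (s : State is) → Transversal s → (s′ : State (j ∷ is)) → Transversal s′
  transversal-step {j = j} s transversal s′ i (j≢i ∷ is≢i) =
    split-at ⟨ b s′ ⟩ i >>= λ sp → transversal i is≢i >>= λ (p , p≤) →
    distinct-block-split j≢i >>= λ (q , q≤) → case sp p p≤ q q≤ (small-or-large sp (step-bound s′ sp))
    where
    case : (sp : SplitAt ⟨ b s′ ⟩ i) (p : SplitAt ⟨ b s ⟩ i) → dim-u p ≤ 2 * M → (q : SplitAt (U j) i) → dim-u q ≤ 2 * M →
      _ → ¬ ¬ (Σ[ sp ∈ SplitAt ⟨ b s′ ⟩ i ] dim-u sp ≤ 2 * M)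
    case sp p p≤ q q≤ (inj₁ (_ , u≤)) = return (sp , u≤)
    case sp p p≤ q q≤ (inj₂ (_ , w≤)) = ⊥-elim (no-skew s s′ sp p q p≤ q≤ w≤)

  -- The counterpart of `Tight`: every dimension missing from a direct sum has been paid for by r/2
  -- units of `ω`, because a representative overlapping the sum in dimension u adds w ≥ r/2 and
  -- gains u w.
  Spread : ∀ {is} → State is → Set
  Spread {is} s = r * (length is * r) ≤ r * dim s + 2 * ω s

  spread-step : ∀ {is j} (s : State is) → Spread s → (sp : SplitAt ⟨ b s ⟩ j) → dim-u sp ≤ 2 * M → Spread (step s sp)
  spread-step {is} s spread sp u≤ = begin
    r * (r + length is * r)
      ≡⟨ ℕ.*-distribˡ-+ r r _ ⟩
    r * r + r * (length is * r)
      ≤⟨ ℕ.+-mono-≤ (ℕ.≤-reflexive (≡.trans (≡.cong (r *_) (≡.sym (dim-total sp))) (ℕ.*-distribˡ-+ r (dim-w sp) (dim-u sp)))) spread ⟩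
    r * dim-w sp + r * dim-u sp + (r * dim s + 2 * ω s)
      ≤⟨ ℕ.+-monoˡ-≤ _ (ℕ.+-monoʳ-≤ (r * dim-w sp) (half-gain {q = dim-w sp} (dim-u sp) r≤2w)) ⟩
    r * dim-w sp + 2 * (dim-u sp * dim-w sp) + (r * dim s + 2 * ω s)
      ≡⟨ solve 5 (λ r w n g ω → r :* w :+ con 2 :* g :+ (r :* n :+ con 2 :* ω) := r :* (w :+ n) :+ con 2 :* (ω :+ g))
           ≡.refl r (dim-w sp) (dim s) (dim-u sp * dim-w sp) (ω s) ⟩
    r * (dim-w sp + dim s) + 2 * ω (step s sp)
      ≡⟨ ≡.cong (λ n → r * n + 2 * ω (step s sp)) (dim-step s sp) ⟨
    r * dim (step s sp) + 2 * ω (step s sp)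
      ∎
    where
    open ℕ.≤-Reasoning

    r≤2w : r ≤ 2 * dim-w sp
    r≤2w = complement-half {h = dim-u sp} {dim-w sp} (dim-total sp)
      (ℕ.≤-trans (ℕ.*-monoʳ-≤ 2 u≤) (≡.subst (_≤ r) (ℕ.*-assoc 2 2 M) 4M≤r))

  spread⇒≤dim : ∀ {is} (s : State is) → Spread s → length is * r ≤ dim s + 2 * M
  spread⇒≤dim s spread = average M spread (ω-bound s)

  representatives : ∀ {is} → AllPairs (λ i j → block j ≢ block i) is → ¬ ¬ (Σ[ s ∈ State is ] Spread s × Transversal s)
  representatives [] = return
    ( empty
    , ℕ.≤-trans (ℕ.≤-reflexive (ℕ.*-zeroʳ r)) z≤n
    , λ i _ → split-at ⟨ [] ⟩ i >>= λ sp → return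
        (sp , ℕ.≤-trans (steinitz 𝟘 [] (Split.u-indep sp) (Split.u⊆S sp)) z≤n)
    )
  representatives {i ∷ is} (distinct ∷ pairs) =
    representatives pairs >>= λ (s , spread , transversal) → transversal i distinct >>= λ (sp , u≤) →
    return (step s sp , spread-step s spread sp u≤ , transversal-step s transversal (step s sp))

  module _ (A : Fin κ → Fin t) (A-block : ∀ a → block (A a) ≡ a) where

    distinct : AllPairs (λ i j → block j ≢ block i) (tabulate A)
    distinct = AllPairs.tabulate⁺ λ {i} {j} i≢j same →
      i≢j (≡.trans (≡.sym (A-block i)) (≡.trans (≡.sym same) (A-block j)))

    |A|r≡κr : length (tabulate A) * r ≡ κ * r
    |A|r≡κr = ≡.cong (_* r) (length-tabulate A)

    dim≤κr : (s : State (tabulate A)) → dim s ≤ κ * r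
    dim≤κr s = ≡.subst (dim s ≤_) |A|r≡κr (b-short s)

    κr≤dim : (s : State (tabulate A)) → Spread s → κ * r ≤ dim s + 2 * M
    κr≤dim s spread = ≡.subst (_≤ dim s + 2 * M) |A|r≡κr (spread⇒≤dim s spread)

    representatives-dimension : ∀ d → HasDim (∑ˢ λ a → H (A a)) d → (d ≤ κ * r) × (κ * r ≤ d + 2 * M)
    representatives-dimension d hasDim =
      ≤-stable (representatives distinct >>= λ (s , _) → return (ℕ.≤-trans (d≤dim s) (dim≤κr s))) ,
      ≤-stable (representatives distinct >>= λ (s , spread , _) →
        return (ℕ.≤-trans (κr≤dim s spread) (ℕ.+-monoˡ-≤ (2 * M) (dim≤d s))))
      where
      W-basis = hasDim⇒basis (∑ˢ λ a → H (A a)) hasDim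

      d≤dim : (s : State (tabulate A)) → d ≤ dim s
      d≤dim s = dim-≥ s W-basis (∑-least ⟨ b s ⟩ λ a → ⊑-trans (H⊑U (A a)) (b-covers s (∈-tabulate⁺ a)))

      dim≤d : (s : State (tabulate A)) → dim s ≤ d
      dim≤d s = dim-≤ s W-basis λ i∈ → member (∈-tabulate⁻ i∈)
        where
        member : ∀ {i} → ∃[ a ] i ≡ A a → U i ⊑ ∑ˢ λ a → H (A a)
        member (a , ≡.refl) = ⊑-trans (U⊑H (A a)) (⊑-∑ (λ a → H (A a)) a)

  -- Estimates for 𝔒 and 𝔈.

  private
    rep : Fin κ → Fin t
    rep a = proj₁ (IsComponentPartition.nonempty partition a)

    rep-block : ∀ a → block (rep a) ≡ a
    rep-block a = proj₂ (IsComponentPartition.nonempty partition a)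

  κr≤𝔒+2M : κ * r ≤ 𝔒 + 2 * M
  κr≤𝔒+2M = ≤-stable (representatives (distinct rep rep-block) >>= λ (s , spread , _) →
    return (ℕ.≤-trans (κr≤dim rep rep-block s spread) (ℕ.+-monoˡ-≤ (2 * M) (dim≤𝔒 s))))

  -- Representatives span at most κ r dimensions and every member is near one of them, so adding the
  -- whole family keeps the sum `Tight` for X = κ r.
  𝔒≤κr+2M : 𝔒 ≤ κ * r + 2 * M
  𝔒≤κr+2M = ≤-stable (representatives (distinct rep rep-block) >>= λ (s₀ , _) →
    gather s₀ (dim≤⇒tight s₀ (dim≤κr rep rep-block s₀)) (λ _ → ⊥) (allFin t)
      (All.tabulate λ {j} _ → inj₂ (rep (block j) , ∈-tabulate⁺ (block j) , rep-block (block j)))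
      >>= λ (_ , s , tight , _ , all∈) →
    return (ℕ.≤-trans (𝔒≤dim s λ j → found (All.lookup all∈ (∈-allFin j))) (tight⇒dim≤ s tight)))
    where
    found : ∀ {j is} → ⊥ ⊎ j ∈ˡ is → j ∈ˡ is
    found (inj₂ j∈) = j∈

  -- Nonnegativity of the excess: the gain inequality of the completed sum with `ω` discarded.
  B𝔒≤r𝔈 : B * 𝔒 ≤ r * 𝔈
  B𝔒≤r𝔈 = ≤-stable (add-all empty (allFin t) >>= λ (s , _) → return (ℕ.*-cancelˡ-≤ r (begin
    r * (B * 𝔒)            ≡⟨ solve 3 (λ r B O → r :* (B :* O) := B :* (r :* O)) ≡.refl r B 𝔒 ⟩
    B * (r * 𝔒)            ≤⟨ ℕ.*-monoʳ-≤ B (ℕ.*-monoʳ-≤ r (𝔒≤dim s λ i →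
                                 ≡.subst (i ∈ˡ_) (≡.sym (++-identityʳ (allFin t))) (∈-allFin i))) ⟩
    B * (r * dim s)         ≤⟨ ℕ.*-monoʳ-≤ B (ℕ.m≤n+m _ (ω s)) ⟩
    B * (ω s + r * dim s)   ≤⟨ gain s ⟩
    r * r * length (xs s)   ≤⟨ ℕ.*-monoʳ-≤ (r * r) (xs≤𝔈 s) ⟩
    r * r * 𝔈              ≡⟨ ℕ.*-assoc r r 𝔈 ⟩
    r * (r * 𝔈)            ∎)))
    where open ℕ.≤-Reasoning

  private
    2MB≤ : 2 * M * B ≤ 2 * M * r ^ k
    2MB≤ = ℕ.*-monoʳ-≤ (2 * M) (C-upper r k)

  -- A deviation of 2M in 𝔒 becomes 2M B / r ≤ 2M r^(k-1) in 𝔈; the N₀ r^(k-1) of low excess is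
  -- added to obtain one constant for both directions.
  κB≤𝔈+ : κ * B ≤ 𝔈 + (2 * M + N₀) * r ^ suc k₀
  κB≤𝔈+ = ℕ.*-cancelˡ-≤ r (begin
    r * (κ * B)                              ≡⟨ solve 3 (λ r κ B → r :* (κ :* B) := B :* (κ :* r)) ≡.refl r κ B ⟩
    B * (κ * r)                              ≤⟨ ℕ.*-monoʳ-≤ B κr≤𝔒+2M ⟩
    B * (𝔒 + 2 * M)                         ≡⟨ solve 3 (λ B O D → B :* (O :+ D) := B :* O :+ D :* B) ≡.refl B 𝔒 (2 * M) ⟩
    B * 𝔒 + 2 * M * B                       ≤⟨ ℕ.+-mono-≤ B𝔒≤r𝔈 2MB≤ ⟩
    r * 𝔈 + 2 * M * (r * r ^ suc k₀)        ≤⟨ ℕ.+-monoʳ-≤ (r * 𝔈) (ℕ.*-monoˡ-≤ (r * r ^ suc k₀) (ℕ.m≤m+n (2 * M) N₀)) ⟩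
    r * 𝔈 + (2 * M + N₀) * (r * r ^ suc k₀) ≡⟨ solve 4 (λ r E D R → r :* E :+ D :* (r :* R) := r :* (E :+ D :* R))
                                                  ≡.refl r 𝔈 (2 * M + N₀) (r ^ suc k₀) ⟩
    r * (𝔈 + (2 * M + N₀) * r ^ suc k₀)     ∎)
    where open ℕ.≤-Reasoning

  𝔈≤κB+ : 𝔈 ≤ κ * B + (2 * M + N₀) * r ^ suc k₀
  𝔈≤κB+ = ℕ.*-cancelˡ-≤ r (begin
    r * 𝔈                                               ≤⟨ low-excess ⟩
    B * 𝔒 + N₀ * r ^ k                                  ≤⟨ ℕ.+-monoˡ-≤ _ (ℕ.*-monoʳ-≤ B 𝔒≤κr+2M) ⟩
    B * (κ * r + 2 * M) + N₀ * r ^ k                     ≡⟨ solve 5 (λ B κ r D N → B :* (κ :* r :+ D) :+ N := r :* (κ :* B) :+ (D :* B :+ N))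
                                                              ≡.refl B κ r (2 * M) (N₀ * r ^ k) ⟩
    r * (κ * B) + (2 * M * B + N₀ * r ^ k)               ≤⟨ ℕ.+-monoʳ-≤ (r * (κ * B)) (ℕ.+-monoˡ-≤ _ 2MB≤) ⟩
    r * (κ * B) + (2 * M * r ^ k + N₀ * r ^ k)           ≡⟨ solve 5 (λ r X D N R → r :* X :+ (D :* (r :* R) :+ N :* (r :* R)) := r :* (X :+ (D :+ N) :* R))
                                                              ≡.refl r (κ * B) (2 * M) N₀ (r ^ suc k₀) ⟩
    r * (κ * B + (2 * M + N₀) * r ^ suc k₀)              ∎)
    where open ℕ.≤-Reasoning

-- Real constants

open import Data.Integer.Base using (+_)
open ℚ-Solver using (solve; _:=_; _:+_; _:*_; _:-_; :-_)

ofℚ : ℚ → ℝ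
ofℚ x = record
  { Lower      = ℚ._< x
  ; Upper      = x ℚ.<_
  ; inhabitedᴸ = x - 1ℚ , ≡.subst (x - 1ℚ ℚ.<_) (ℚ.+-identityʳ x) (ℚ.+-monoʳ-< x (ℚ.negative⁻¹ (ℚ.- 1ℚ)))
  ; inhabitedᵁ = x ℚ.+ 1ℚ , ≡.subst (ℚ._< x ℚ.+ 1ℚ) (ℚ.+-identityʳ x) (ℚ.+-monoʳ-< x (ℚ.positive⁻¹ 1ℚ))
  ; roundedᴸ   = λ q → mk⇔ (λ q<x → ℚ.<-dense q<x) (λ (p , q<p , p<x) → ℚ.<-trans q<p p<x)
  ; roundedᵁ   = λ q → mk⇔ (λ x<q → let (p , x<p , p<q) = ℚ.<-dense x<q in p , p<q , x<p)
                            (λ (p , p<q , x<p) → ℚ.<-trans x<p p<q)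
  ; disjoint   = λ q (q<x , x<q) → ℚ.<-asym q<x x<q
  ; located    = λ p q p<q → cut p q p<q (p ℚ.<? x)
  }
  where
  cut : ∀ p q → p ℚ.< q → _ → p ℚ.< x ⊎ x ℚ.< q
  cut p q p<q (yes p<x) = inj₁ p<x
  cut p q p<q (no p≮x)  = inj₂ (ℚ.≤-<-trans (ℚ.≮⇒≥ p≮x) p<q)

<⇒≱ : ∀ {p q} → p ℚ.< q → ¬ (q ℚ.≤ p)
<⇒≱ p<q q≤p = ℚ.<-irrefl ≡.refl (ℚ.<-≤-trans p<q q≤p)

≤-ofℚ : ∀ {p x} → p ℚ.≤ x → p ≤ᴿ ofℚ x
≤-ofℚ p≤x x<p = <⇒≱ x<p p≤x

module _ (s : ℚ) .{{s>0 : Positive s}} where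

  private
    instance
      s≢0 : ℚ.NonZero s
      s≢0 = ℚ.pos⇒nonZero s

    unscale-scale : ∀ p → (p ℚ.* 1/ s) ℚ.* s ≡ p
    unscale-scale p = ≡.trans (ℚ.*-assoc p (1/ s) s)
      (≡.trans (≡.cong (p ℚ.*_) (ℚ.*-inverseˡ s)) (ℚ.*-identityʳ p))

  ≤-scale-ofℚ : ∀ {p x} → p ℚ.≤ x ℚ.* s → p ≤ᴿ scale s (ofℚ x)
  ≤-scale-ofℚ {p} {x} p≤xs x<p/s =
    <⇒≱ (≡.subst (x ℚ.* s ℚ.<_) (unscale-scale p) (ℚ.*-monoˡ-<-pos s x<p/s)) p≤xs

  ≤-scale⇒≤ : ∀ {p x b} → ℝ.Upper x b → p ≤ᴿ scale s x → p ℚ.≤ b ℚ.* s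
  ≤-scale⇒≤ {p} {x} {b} x<b p≤sx = ≡.subst (ℚ._≤ b ℚ.* s) (unscale-scale p)
    (ℚ.*-monoʳ-≤-nonNeg s {{ℚ.pos⇒nonNeg s}} (ℚ.≮⇒≥ λ b<p/s →
      p≤sx (Equivalence.from (ℝ.roundedᵁ x (p ℚ.* 1/ s)) (b , b<p/s , x<b))))

-- Natural numbers as rationals.

toℚᵘ-/ : ∀ i n .{{_ : NonZero n}} → ℚ.toℚᵘ (i / n) ℚᵘ.≃ (i ℚᵘ./ n)
toℚᵘ-/ i (suc n) = ℚ.toℚᵘ-fromℚᵘ (mkℚᵘ i n)

fromℕ-+ : ∀ m n → fromℕ (m ℕ.+ n) ≡ fromℕ m ℚ.+ fromℕ n
fromℕ-+ m n = ℚ.toℚᵘ-injective (begin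
  ℚ.toℚᵘ (fromℕ (m ℕ.+ n))                       ≈⟨ toℚᵘ-/ (+ (m ℕ.+ n)) 1 ⟩
  mkℚᵘ (+ (m ℕ.+ n)) 0                            ≈⟨ *≡* (≡.cong (ℤ._* + 1) (≡.trans (ℤ.pos-+ m n)
                                                       (≡.sym (≡.cong₂ ℤ._+_ (ℤ.*-identityʳ (+ m)) (ℤ.*-identityʳ (+ n)))))) ⟩
  mkℚᵘ (+ m) 0 ℚᵘ.+ mkℚᵘ (+ n) 0                  ≈⟨ ℚᵘ.+-cong (toℚᵘ-/ (+ m) 1) (toℚᵘ-/ (+ n) 1) ⟨
  ℚ.toℚᵘ (fromℕ m) ℚᵘ.+ ℚ.toℚᵘ (fromℕ n)         ≈⟨ ℚ.toℚᵘ-homo-+ (fromℕ m) (fromℕ n) ⟨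
  ℚ.toℚᵘ (fromℕ m ℚ.+ fromℕ n)                    ∎)
  where open ℚᵘ.≃-Reasoning

fromℕ-* : ∀ m n → fromℕ (m * n) ≡ fromℕ m ℚ.* fromℕ n
fromℕ-* m n = ℚ.toℚᵘ-injective (begin
  ℚ.toℚᵘ (fromℕ (m * n))                          ≈⟨ toℚᵘ-/ (+ (m * n)) 1 ⟩
  mkℚᵘ (+ (m * n)) 0                               ≈⟨ *≡* (≡.cong (ℤ._* + 1) (ℤ.pos-* m n)) ⟩
  mkℚᵘ (+ m) 0 ℚᵘ.* mkℚᵘ (+ n) 0                  ≈⟨ ℚᵘ.*-cong (toℚᵘ-/ (+ m) 1) (toℚᵘ-/ (+ n) 1) ⟨
  ℚ.toℚᵘ (fromℕ m) ℚᵘ.* ℚ.toℚᵘ (fromℕ n)         ≈⟨ ℚ.toℚᵘ-homo-* (fromℕ m) (fromℕ n) ⟨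
  ℚ.toℚᵘ (fromℕ m ℚ.* fromℕ n)                    ∎)
  where open ℚᵘ.≃-Reasoning

/-*-cancel : ∀ b r .{{_ : NonZero r}} → (+ b / r) ℚ.* fromℕ r ≡ fromℕ b
/-*-cancel b (suc r) = ℚ.toℚᵘ-injective (begin
  ℚ.toℚᵘ ((+ b / suc r) ℚ.* fromℕ (suc r))            ≈⟨ ℚ.toℚᵘ-homo-* (+ b / suc r) (fromℕ (suc r)) ⟩
  ℚ.toℚᵘ (+ b / suc r) ℚᵘ.* ℚ.toℚᵘ (fromℕ (suc r))    ≈⟨ ℚᵘ.*-cong (toℚᵘ-/ (+ b) (suc r)) (toℚᵘ-/ (+ suc r) 1) ⟩
  mkℚᵘ (+ b) r ℚᵘ.* mkℚᵘ (+ suc r) 0                   ≈⟨ *≡* (≡.trans (ℤ.*-identityʳ _)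
                                                            (≡.cong (λ n → + b ℤ.* + n) (≡.sym (ℕ.*-identityʳ (suc r))))) ⟩
  mkℚᵘ (+ b) 0                                         ≈⟨ toℚᵘ-/ (+ b) 1 ⟨
  ℚ.toℚᵘ (fromℕ b)                                     ∎)
  where open ℚᵘ.≃-Reasoning

fromℕ-mono-≤ : ∀ {m n} → m ≤ n → fromℕ m ℚ.≤ fromℕ n
fromℕ-mono-≤ {m} {n} m≤n = ℚ.toℚᵘ-cancel-≤ (ℚᵘ.≤-respˡ-≃ (ℚᵘ.≃-sym (toℚᵘ-/ (+ m) 1))
  (ℚᵘ.≤-respʳ-≃ (ℚᵘ.≃-sym (toℚᵘ-/ (+ n) 1)) (*≤* (ℤ.*-monoʳ-≤-nonNeg (+ 1) (ℤ.+≤+ m≤n)))))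

fromℕ-cancel-≤ : ∀ {m n} → fromℕ m ℚ.≤ fromℕ n → m ≤ n
fromℕ-cancel-≤ {m} {n} m≤n with ℚᵘ.≤-respˡ-≃ (toℚᵘ-/ (+ m) 1) (ℚᵘ.≤-respʳ-≃ (toℚᵘ-/ (+ n) 1) (ℚ.toℚᵘ-mono-≤ m≤n))
... | *≤* m≤n′ = ℤ.drop‿+≤+ (ℤ.*-cancelʳ-≤-pos (+ m) (+ n) (+ 1) m≤n′)

fromℕ-mono-< : ∀ {m n} → m ℕ.< n → fromℕ m ℚ.< fromℕ n
fromℕ-mono-< m<n = ℚ.≰⇒> λ n≤m → ℕ.<⇒≱ m<n (fromℕ-cancel-≤ n≤m)

x≤y+z⇒x-y≤z : ∀ {x y z} → x ℚ.≤ y ℚ.+ z → x - y ℚ.≤ z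
x≤y+z⇒x-y≤z {x} {y} {z} x≤y+z = ≡.subst (x - y ℚ.≤_)
  (solve 2 (λ y z → (y :+ z) :- y := z) ≡.refl y z) (ℚ.+-monoˡ-≤ (ℚ.- y) x≤y+z)

x-y≤z⇒x≤y+z : ∀ {x y z} → x - y ℚ.≤ z → x ℚ.≤ y ℚ.+ z
x-y≤z⇒x≤y+z {x} {y} {z} x-y≤z = ≡.subst (ℚ._≤ y ℚ.+ z)
  (solve 2 (λ x y → y :+ (x :- y) := x) ≡.refl x y) (ℚ.+-monoʳ-≤ y x-y≤z)

fromℕ-diff-≤ : ∀ m n d → m ≤ n ℕ.+ d → fromℕ m - fromℕ n ℚ.≤ fromℕ d
fromℕ-diff-≤ m n d m≤n+d =
  x≤y+z⇒x-y≤z (≡.subst (fromℕ m ℚ.≤_) (fromℕ-+ n d) (fromℕ-mono-≤ m≤n+d))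

fromℕ-∣diff∣-≤ : ∀ m n d → m ≤ n ℕ.+ d → n ≤ m ℕ.+ d → ∣ fromℕ m - fromℕ n ∣ ℚ.≤ fromℕ d
fromℕ-∣diff∣-≤ m n d m≤n+d n≤m+d with ℚ.∣p∣≡p∨∣p∣≡-p (fromℕ m - fromℕ n)
... | inj₁ ∣p∣≡p  = ≡.subst (ℚ._≤ fromℕ d) (≡.sym ∣p∣≡p) (fromℕ-diff-≤ m n d m≤n+d)
... | inj₂ ∣p∣≡-p = ≡.subst (ℚ._≤ fromℕ d) (≡.sym (≡.trans ∣p∣≡-p flip)) (fromℕ-diff-≤ n m d n≤m+d)
  where
  flip : ℚ.- (fromℕ m - fromℕ n) ≡ fromℕ n - fromℕ m
  flip = solve 2 (λ m n → :- (m :- n) := n :- m) ≡.refl (fromℕ m) (fromℕ n)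

<-fromℕ : ∀ q → ∃[ n ] q ℚ.< fromℕ n
<-fromℕ q@(ℚ.mkℚ i d _) = suc ℤ.∣ i ∣ , ℚ.toℚᵘ-cancel-<
  (ℚᵘ.<-respʳ-≃ (ℚᵘ.≃-sym (toℚᵘ-/ (+ suc ℤ.∣ i ∣) 1)) (*<* (cross i)))
  where
  cross : ∀ i → i ℤ.* + 1 ℤ.< + suc ℤ.∣ i ∣ ℤ.* + suc d
  cross (+ a)        = ≡.subst₂ ℤ._<_ (≡.sym (ℤ.*-identityʳ (+ a))) (ℤ.pos-* (suc a) (suc d))
    (ℤ.+<+ (ℕ.m≤m*n (suc a) (suc d)))
  cross (ℤ.-[1+ a ]) = ℤ.-<+

upper-fromℕ : (x : ℝ) → ∃[ n ] ℝ.Upper x (fromℕ n)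
upper-fromℕ x =
  let (q , x<q) = ℝ.inhabitedᵁ x
      (n , q<n) = <-fromℕ q
  in n , Equivalence.from (ℝ.roundedᵁ x (fromℕ n)) (q , q<n , x<q)

-- Replacing Γ by a natural number above it and multiplying by r clears the denominator of `β`,
-- leaving an inequality of natural numbers.
lowExcess⇒ : ∀ Γ N₀ k r .{{_ : NonZero r}} 𝔈 𝔒 → ℝ.Upper Γ (fromℕ N₀) →
  LowExcess Γ (suc k) r 𝔈 𝔒 → r * 𝔈 ≤ (r C suc k) * 𝔒 ℕ.+ N₀ * r ^ suc k
lowExcess⇒ Γ N₀ k r 𝔈 𝔒 Γ<N₀ low = fromℕ-cancel-≤ (begin
  fromℕ (r * 𝔈)
    ≡⟨ ≡.trans (≡.cong fromℕ (ℕ.*-comm r 𝔈)) (fromℕ-* 𝔈 r) ⟩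
  fromℕ 𝔈 ℚ.* fromℕ r
    ≤⟨ ℚ.*-monoʳ-≤-nonNeg (fromℕ r) {{ℚ.normalize-nonNeg r 1}} bound ⟩
  (β (suc k) r ℚ.* fromℕ 𝔒 ℚ.+ fromℕ N₀ ℚ.* fromℕ (r ^ k)) ℚ.* fromℕ r
    ≡⟨ ℚ.*-distribʳ-+ (fromℕ r) (β (suc k) r ℚ.* fromℕ 𝔒) _ ⟩
  β (suc k) r ℚ.* fromℕ 𝔒 ℚ.* fromℕ r ℚ.+ fromℕ N₀ ℚ.* fromℕ (r ^ k) ℚ.* fromℕ r
    ≡⟨ ≡.cong₂ ℚ._+_ first second ⟩
  fromℕ ((r C suc k) * 𝔒) ℚ.+ fromℕ (N₀ * r ^ suc k)
    ≡⟨ fromℕ-+ ((r C suc k) * 𝔒) (N₀ * r ^ suc k) ⟨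
  fromℕ ((r C suc k) * 𝔒 ℕ.+ N₀ * r ^ suc k)
    ∎)
  where
  open ℚ.≤-Reasoning

  bound : fromℕ 𝔈 ℚ.≤ β (suc k) r ℚ.* fromℕ 𝔒 ℚ.+ fromℕ N₀ ℚ.* fromℕ (r ^ k)
  bound = x-y≤z⇒x≤y+z (≤-scale⇒≤ (fromℕ (r ^ k)) {{ℚ.normalize-pos (r ^ k) 1 {{_}} {{ℕ.m^n≢0 r k}}}} {x = Γ} Γ<N₀ low)

  first : β (suc k) r ℚ.* fromℕ 𝔒 ℚ.* fromℕ r ≡ fromℕ ((r C suc k) * 𝔒)
  first = ≡.trans (solve 3 (λ b o r → b :* o :* r := b :* r :* o) ≡.refl (β (suc k) r) (fromℕ 𝔒) (fromℕ r))
    (≡.trans (≡.cong (ℚ._* fromℕ 𝔒) (/-*-cancel (r C suc k) r)) (≡.sym (fromℕ-* (r C suc k) 𝔒)))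

  second : fromℕ N₀ ℚ.* fromℕ (r ^ k) ℚ.* fromℕ r ≡ fromℕ (N₀ * r ^ suc k)
  second = ≡.trans (solve 3 (λ n p r → n :* p :* r := n :* (r :* p)) ≡.refl (fromℕ N₀) (fromℕ (r ^ k)) (fromℕ r))
    (≡.trans (≡.cong (fromℕ N₀ ℚ.*_) (≡.sym (fromℕ-* r (r ^ k)))) (≡.sym (fromℕ-* N₀ (r ^ suc k))))

scaled-bound : ∀ {p} n x .{{_ : NonZero n}} → p ℚ.≤ fromℕ (x * n) → p ≤ᴿ n ·ᴿ ofℚ (fromℕ x)
scaled-bound {p} n x p≤xn = ≤-scale-ofℚ (fromℕ n) {{ℚ.normalize-pos n 1}} {x = fromℕ x}
  (≡.subst (p ℚ.≤_) (fromℕ-* x n) p≤xn)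

corollary4p4 : (k : ℕ) → 2 ≤ k → (Γ : ℝ) → 0ℚ <ᴿ Γ →
    Σω Constants λ const → let open Constants const in
    ∀ {c ℓ₁ ℓ₂ m ℓm p} (F : HeytingField c ℓ₁ ℓ₂) → let open LinearAlgebra F in
    (V : VectorSpace m ℓm)
    (r : ℕ) .{{_ : NonZero r}} → k ≤ r → r₀ ≤ r →
    (t : ℕ) → 1 ≤ t →
    (H : Fin t → Subspace V p) →
    (∀ i → HasDim (H i) r) →
    (∀ i j → i ≢ j → ¬ (H i ≡ˢ H j)) →
    (𝔒 𝔈 : ℕ) → HasDim (∑ˢ H) 𝔒 → HasDim (∑ˢ λ i → Λˢ k (H i)) 𝔈 →
    LowExcess Γ k r 𝔈 𝔒 →
    (κ : ℕ) (block : Fin t → Fin κ) → IsComponentPartition (Close r H) block →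
    ( (∀ a → ∃[ i* ] (block i* ≡ a ×
    (∀ i → block i ≡ a → ∀ d → GrDist r (H i) (H i*) d → fromℕ d ≤ᴿ Kₖ)))
    × (∀ i j → block i ≡ block j → ∀ d → GrDist r (H i) (H j) d → fromℕ d ≤ᴿ 2 ·ᴿ Kₖ)
    × (∀ i j → block i ≢ block j → ∀ d → GrDist r (H i) (H j) d →
    (fromℕ r - Dₖ / 1) - fromℕ d ≤ᴿ 2 ·ᴿ Kₖ) )
    × (∀ a d → HasDim (∑ˢ {I = Σ[ i ∈ Fin t ] block i ≡ a} (λ x → H (proj₁ x))) d →
    r ≤ d × (fromℕ d - fromℕ r ≤ᴿ Cₖ))
    × ((A : Fin κ → Fin t) → (∀ a → block (A a) ≡ a) →
    ∀ d → HasDim (∑ˢ λ a → H (A a)) d →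
    d ≤ κ * r × (fromℕ (κ * r) - fromℕ d ≤ᴿ Cₖ))
    × ( (∣ fromℕ 𝔒 - fromℕ (κ * r) ∣ ≤ᴿ O-𝔒)
    × (∣ fromℕ 𝔈 - fromℕ (κ * (r C k)) ∣ ≤ᴿ r ↑ (k ∸ 1) ·ᴿ O-𝔈) )
corollary4p4 (suc (suc k₀)) (s≤s (s≤s z≤n)) Γ _ = constants ,ω
  λ F V r k≤r r₀≤r t 1≤t H H-dim H-distinct 𝔒 𝔈 𝔒-dim 𝔈-dim low κ block partition →
  let open LinearAlgebra F
      module Fam = Family F V k₀ r H (λ i → Bases.hasDim⇒basis F V Level.zero (H i) (H-dim i))
        (Bases.hasDim⇒basis F V Level.zero (∑ˢ H) 𝔒-dim)
        (Wedges.Λ.hasDim⇒basis F V Level.zero k (∑ˢ λ i → Λˢ k (H i)) 𝔈-dim)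
        N₀ (lowExcess⇒ Γ N₀ (suc k₀) r 𝔈 𝔒 Γ<N₀ low) r₀≤r block partition
      near : ∀ {i j d} → block i ≡ block j → GrDist r (H i) (H j) d → d ≤ suc c₀
      near same dist = ℕ.m≤n⇒m≤1+n (ℕ.m≤n⇒m≤1+n (Fam.same-block-distance same dist))
  in
  ( (λ a → let (i* , i*∈a) = IsComponentPartition.nonempty partition a in i* , i*∈a ,
      λ i i∈a d dist → ≤-ofℚ (fromℕ-mono-≤ (near (≡.trans i∈a (≡.sym i*∈a)) dist)))
  , (λ i j same d dist → scaled-bound 2 (suc c₀)
      (fromℕ-mono-≤ (ℕ.≤-trans (near same dist) (ℕ.m≤m*n (suc c₀) 2))))
  , (λ i j distinct d dist → scaled-bound 2 (suc c₀)
      (x≤y+z⇒x-y≤z (x≤y+z⇒x-y≤z (fromℕ-bound₃ c₀ d (suc c₀ * 2) (far d (Fam.distinct-block-distance distinct dist))))))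
  )
  , (λ a d d-dim → let (r≤d , d≤) = Fam.block-dimension a d d-dim in r≤d ,
      ≤-ofℚ (fromℕ-diff-≤ d r c₀ (ℕ.≤-trans d≤ (ℕ.+-monoʳ-≤ r (ℕ.n≤1+n _)))))
  , (λ A A-block d d-dim → let (d≤ , ≤d) = Fam.representatives-dimension A A-block d d-dim in d≤ ,
      ≤-ofℚ (fromℕ-diff-≤ (κ * r) d c₀ (ℕ.≤-trans ≤d (ℕ.+-monoʳ-≤ d (ℕ.n≤1+n _)))))
  , ≤-ofℚ (fromℕ-∣diff∣-≤ 𝔒 (κ * r) (2 * M) Fam.𝔒≤κr+2M Fam.κr≤𝔒+2M)
  , scaled-bound (r ^ suc k₀) (2 * M ℕ.+ N₀) {{ℕ.m^n≢0 r (suc k₀)}} (fromℕ-∣diff∣-≤ 𝔈 (κ * (r C k)) ((2 * M ℕ.+ N₀) * r ^ suc k₀) Fam.𝔈≤κB+ Fam.κB≤𝔈+)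
  where
  k N₀ M c₀ : ℕ
  k  = suc (suc k₀)
  N₀ = proj₁ (upper-fromℕ Γ)
  M  = N₀ * growth k
  -- The bounds proved are 2M; the successor makes `Cₖ` visibly positive and lets `Dₖ` minus one
  -- compute to 2M.
  c₀ = suc (2 * M)

  Γ<N₀ : ℝ.Upper Γ (fromℕ N₀)
  Γ<N₀ = proj₂ (upper-fromℕ Γ)

  constants : Constants
  constants = record
    { Cₖ      = ofℚ (fromℕ c₀)
    ; Cₖ>0    = fromℕ-mono-< {0} {c₀} (s≤s z≤n)
    ; Dₖ      = + c₀
    ; Dₖ≡⌈Cₖ⌉ = fromℕ-mono-< (ℕ.n<1+n (2 * M)) , ℚ.<-irrefl ≡.refl
    ; Kₖ      = ofℚ (fromℕ (suc c₀))
    ; Kₖ>Dₖ   = fromℕ-mono-< (ℕ.n<1+n c₀)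
    ; r₀      = threshold k M
    ; O-𝔒     = ofℚ (fromℕ (2 * M))
    ; O-𝔈     = ofℚ (fromℕ (2 * M ℕ.+ N₀))
    }

  fromℕ-bound₃ : ∀ {r} c d x → r ≤ c ℕ.+ (d ℕ.+ x) → fromℕ r ℚ.≤ fromℕ c ℚ.+ (fromℕ d ℚ.+ fromℕ x)
  fromℕ-bound₃ {r} c d x r≤ = ≡.subst (fromℕ r ℚ.≤_)
    (≡.trans (fromℕ-+ c (d ℕ.+ x)) (≡.cong (fromℕ c ℚ.+_) (fromℕ-+ d x))) (fromℕ-mono-≤ r≤)

  -- The distance bound r - d ≤ 2M is stronger than required; `Dₖ` and twice `Kₖ` only add room.
  far : ∀ {r} d → r ≤ d ℕ.+ 2 * M → r ≤ c₀ ℕ.+ (d ℕ.+ suc c₀ * 2)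
  far d r≤ = ℕ.≤-trans r≤ (ℕ.≤-trans
    (ℕ.+-monoʳ-≤ d (ℕ.≤-trans (ℕ.n≤1+n (2 * M)) (ℕ.≤-trans (ℕ.n≤1+n c₀) (ℕ.m≤m*n (suc c₀) 2))))
    (ℕ.m≤n+m _ c₀))
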